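{- For each positive integer $t$, let $p_t(n)$ be defined by $\sum_{n\ge 0} p_t(n)q^n=\prod_{i\ge1}(1-q^i)^{ -t}$, and let $$\delta_t=\lim_{x\to\infty}\frac{\#\{n\le x:\ p_t(n)\text{ is odd}\}}{x}.$$ Assume that all the densities $\delta_i$ appearing below exist. Then $\delta_t>0$ implies $\delta_1>0$ for each $t\in\{5,7,11,13,17,19,23,25\}$. Moreover, $\delta_t>0$ implies $\delta_r>0$ for each of the pairs $(t,r)\in\{(27,9),(9,3),(25,5),(15,3),(21,3),(27,3)\}$.
   Context: $p_t(n)$ is the number of $t$-multipartitions of $n$; in particular $p_1(n)=p(n)$ is the ordinary partition function. -}

module Defs where

open import Data.Nat using (ℕ; zero; suc; _+_; _*_; _∸_; _≤_; _≤ᵇ_; _%_)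
open import Data.Bool using (if_then_else_)
open import Data.Integer using (+_)
open import Data.Rational.Unnormalised using (ℚᵘ; _/_; _-_; ∣_∣; _<_; _≤_; 0ℚᵘ)
open import Data.Product using (∃; _×_; _,_)
open import Data.List using (List; _∷_; [])

Σ≤ : ℕ → (ℕ → ℕ) → ℕ
Σ≤ zero    f = f zero
Σ≤ (suc n) f = Σ≤ n f + f (suc n)

isZero : ℕ → ℕ
isZero zero    = 1
isZero (suc _) = 0

-- partsUpTo k n = number of partitions of n into parts of size ≤ k,
-- i.e. the coefficient of q^n in ∏_{i=1}^{k} (1 - q^i)^{-1}
-- (multiplying by 1/(1-q^(k+1)) = Σ_j q^(j(k+1))).
partsUpTo : ℕ → ℕ → ℕ
partsUpTo zero    n = isZero n
partsUpTo (suc k) n =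
  Σ≤ n (λ j → if j * suc k ≤ᵇ n then partsUpTo k (n ∸ j * suc k) else 0)

p : ℕ → ℕ
p n = partsUpTo n n

-- multipartition numbers: p_t(n) = coefficient of q^n in ∏_{i≥1}(1-q^i)^{-t},
-- via  P_0 = 1,  P_{t+1} = P · P_t  (Cauchy product of coefficient sequences)
pₜ : ℕ → ℕ → ℕ
pₜ zero    n = isZero n
pₜ (suc t) n = Σ≤ n (λ k → p k * pₜ t (n ∸ k))

oddCount : ℕ → ℕ → ℕ
oddCount t x = Σ≤ x (λ n → pₜ t n % 2)

-- the ratio #{n ≤ x : p_t(n) odd} / x, evaluated at x = k + 1
ratio : ℕ → ℕ → ℚᵘ
ratio t k = (+ oddCount t (suc k)) / suc k

-- the limit δ_t = lim_{x→∞} ratio exists (Cauchy criterion over ℚ)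
DensityExists : ℕ → Set
DensityExists t =
  ∀ (ε : ℚᵘ) → 0ℚᵘ < ε →
    ∃ λ N → ∀ m n → N Data.Nat.≤ m → N Data.Nat.≤ n →
      ∣ ratio t m - ratio t n ∣ < ε

-- δ_t > 0 : the ratios are eventually bounded below by a positive rational
-- (for a convergent sequence this is equivalent to the limit being > 0)
PositiveDensity : ℕ → Set
PositiveDensity t =
  ∃ λ (ε : ℚᵘ) → 0ℚᵘ < ε × ∃ λ N → ∀ x → N Data.Nat.≤ x → ε Data.Rational.Unnormalised.≤ ratio t x

implicationPairs : List (ℕ Data.Product.× ℕ)
implicationPairs =
  (5 , 1) ∷ (7 , 1) ∷ (11 , 1) ∷ (13 , 1) ∷ (17 , 1) ∷ (19 , 1) ∷ (23 , 1) ∷ (25 , 1) ∷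
  (27 , 9) ∷ (9 , 3) ∷ (25 , 5) ∷ (15 , 3) ∷ (21 , 3) ∷ (27 , 3) ∷ []

{-# OPTIONS --safe #-}

-- Modulo 2, let g = q ∏ (1 − q²⁴ⁿ), so that the p_t(n) are the coefficients of g⁻ᵗ, and let
-- T (Σ c(n) qⁿ) = Σ (c(ℓn) + c(n/ℓ)) qⁿ. For ℓ ≤ 23 one has T(g⁻¹) = g⁻ˡ, that is
-- p_ℓ(n) ≡ p(ℓn − (ℓ²−1)/24) + p(n/ℓ), and similarly T(g⁻ʳ) = g⁻ʳˡ for the other pairs (t, r) = (rℓ, r).
-- Hence p_t has at most twice as many odd values up to x as p_r has up to ℓx.
--
-- To compute T(g⁻ʳ), start from a symmetric equation F(g(q), g(q^ℓ)) = 0 of degree ℓ + 1. It yields a linear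
-- recurrence for T(gᵏ), k ∈ ℤ. Since T(gᵏ)² = T(g²ᵏ), and since T(g) = T(g³) = 0 because g and g³ are theta
-- series, the recurrence leaves a quadratic equation for T(g⁻¹) whose nonzero solution is g⁻ˡ.
--
-- The equations F come from a single theta identity, xy = x⁴ + y⁴ for x = D(q) = Σ q^((2a+1)²) and y = D(q³).
-- If G(q) G(q^p) = G(q)^(p+1) + G(q^p)^(p+1), as for (p, G) = (3, D) and then (5, g), there is a series r with
-- G(q) = r/(1 + r^(p+1)) and G(q^p) = r^p/(1 + r^(p+1)). With s = r(q^ℓ), the numerators of E(q) = F(G(q), G(q^ℓ))
-- and of E(q^p) have a common factor in 𝔽₂[r, s]. Dividing it out gives E(q) Q* = E(q^p) Q, and the order of Q*
-- is small enough to force E = 0, because E(q^p) has p times the order of E.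

module Submission where

open import Defs
open import Data.Nat using (ℕ)
open import Data.Product using (_,_)
open import Data.List.Membership.Propositional using (_∈_)

open import Algebra.Bundles using (CommutativeRing)
import Algebra.Solver.Ring
open import Algebra.Solver.Ring.AlmostCommutativeRing using (fromCommutativeRing; _-Raw-AlmostCommutative⟶_)
open import Data.Bool using (Bool; true; false; _∧_; _xor_; not; if_then_else_; T)
open import Data.Bool.ListAction using (all)
import Data.Bool.Properties as Bool
open import Data.Bool.Solver using (module xor-∧-Solver)
open import Data.Empty using (⊥-elim)
open import Data.Integer as ℤ using (-[1+_]; +≤+; +<+)
import Data.Integer.Properties as ℤ
open import Data.List using (List; []; _∷_; map; foldr; null)
open import Data.List.Relation.Unary.All using (All; []; _∷_)
open import Data.List.Relation.Unary.Any using (here; there)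
open import Data.Maybe using (Maybe; just; nothing)
open import Data.Nat as ℕ using (zero; suc; _∸_; _⊓_; _/_; _%_; _≤_; _<_; _≤ᵇ_; _<ᵇ_; _≡ᵇ_; z≤n; s≤s; z<s; NonZero)
open import Data.Nat.Coprimality using (Coprime; coprime?; coprime-divisor)
open import Data.Nat.DivMod using (m%n<n; %-distribˡ-+; %-distribˡ-*; m≡m%n+[m/n]*n; m/n*n≤m; /-mono-≤; m*n/n≡m)
open import Data.Nat.Divisibility using (_∣_; _∤_; divides; _∣?_; _∣0; ∣-refl; ∣-trans; n∣m*n; ∣m∣n⇒∣m+n; m%n≡0⇒n∣m; n∣m⇒m%n≡0)
open import Data.Nat.Induction using (<-rec)
open import Data.Nat.Primality using (Prime; prime?; euclidsLemma)
import Data.Nat.Properties as ℕ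
open import Data.Nat.Solver using (module +-*-Solver)
open import Data.Product using (∃; _×_; proj₁; proj₂; swap)
open import Data.Rational.Unnormalised using (mkℚᵘ; *≤*; *<*)
open import Data.Sum using (_⊎_; inj₁; inj₂; [_,_]′)
open import Function.Base using (_∘_)
open import Function.Bundles using (Equivalence)
open import Level using (0ℓ)
open import Relation.Binary.Definitions using (tri<; tri≈; tri>)
open import Relation.Binary.PropositionalEquality as ≡ using (_≡_; _≢_)
import Relation.Binary.Reasoning.Setoid
open import Relation.Nullary using (Dec; yes; no; _→-dec_)
open import Relation.Nullary.Decidable using (from-yes)

-- Exponents are scaled so that q^(1/24) never occurs: g is q times a series in q²⁴, and as ℓ is
-- prime to 24 the scaling is undone at the end. For ℓ = 3 this fails; there D, which is q times the
-- inverse of P(q⁸)³, replaces g, and the pairs obtained consist of multiples of 3. The modular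
-- equations are verified, not derived: once F and the common factor are given, everything left is a
-- finite computation with polynomials over 𝔽₂. The main obstacle is that the recurrence around -2
-- involves T(gᵏ) for further k, such as 5, 7, 9 or 11 and their doubles. Doubling turns other
-- instances of the recurrence into polynomial equations for these (T(g²⁰) is the fourth power of
-- T(g⁵)), and a lower bound on the order of the unknown excludes the nonzero roots. When -1 is not
-- a square modulo ℓ, T(g⁵) = 0 follows directly from sums of two squares. The case ℓ = 19 is the
-- hardest: T(g⁹) = g³ and T(g¹⁹) = g do not vanish, and T(g⁻¹) has to be found together with T(g⁷)
-- and T(g⁹).

private
  module B = xor-∧-Solver
  module N = +-*-Solver

-- Polynomials over 𝔽₂

-- (a , b) is the monomial xᵃyᵇ. Polynomials are kept in decreasing lexicographic order;
-- the order affects only how much cancels, not the correctness of the operations.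
Monomial : Set
Monomial = ℕ × ℕ

Poly : Set
Poly = List Monomial

_≡ₘ_ : Monomial → Monomial → Bool
(a , b) ≡ₘ (c , d) = if a ≡ᵇ c then b ≡ᵇ d else false

≡ₘ⇒≡ : ∀ m n → (m ≡ₘ n) ≡ true → m ≡ n
≡ₘ⇒≡ (a , b) (c , d) eq with a ≡ᵇ c in eq₁
... | true = ≡.cong₂ _,_ (ℕ.≡ᵇ⇒≡ a c (Equivalence.from Bool.T-≡ eq₁)) (ℕ.≡ᵇ⇒≡ b d (Equivalence.from Bool.T-≡ eq))

_·ₘ_ : Monomial → Monomial → Monomial
(a , b) ·ₘ (c , d) = a ℕ.+ c , b ℕ.+ d

_>ₘ_ : Monomial → Monomial → Bool
(a , b) >ₘ (c , d) = if c <ᵇ a then true else if a <ᵇ c then false else d <ᵇ b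

addₚ : Poly → Poly → Poly
addₚ []       ys = ys
addₚ (x ∷ xs) ys = merge ys
  where
  merge : Poly → Poly
  merge []       = x ∷ xs
  merge (y ∷ ys) = if x ≡ₘ y then addₚ xs ys else if x >ₘ y then x ∷ addₚ xs (y ∷ ys) else y ∷ merge ys

scaleₚ : Monomial → Poly → Poly
scaleₚ m = map (m ·ₘ_)

mulₚ : Poly → Poly → Poly
mulₚ ps qs = foldr (λ m → addₚ (scaleₚ m qs)) [] ps

powₚ : Poly → ℕ → Poly
powₚ ps zero    = (0 , 0) ∷ []
powₚ ps (suc n) = mulₚ ps (powₚ ps n)

-- Division by m + ps with leading monomial m; the first argument bounds the number of steps.
divide : ℕ → Monomial → Poly → Poly → Poly × Poly
divide zero    m       ps rs = [] , rs
divide (suc k) m       ps [] = [] , []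
divide (suc k) (a , b) ps ((c , d) ∷ rs) with ((c ∸ a , d ∸ b) ·ₘ (a , b)) ≡ₘ (c , d)
... | false = [] , (c , d) ∷ rs
... | true  = let rec = divide k (a , b) ps (addₚ rs (scaleₚ (c ∸ a , d ∸ b) ps))
              in (c ∸ a , d ∸ b) ∷ proj₁ rec , proj₂ rec

-- The numerator of F(xᵉ/(1 + xᵏ), yᵉ/(1 + yᵏ)) over the denominator (1 + xᵏ)ⁿ(1 + yᵏ)ⁿ.
numerator : (n k e : ℕ) → Poly → Poly
numerator n k e = foldr (λ (a , b) → addₚ (mulₚ (scaleₚ (e ℕ.* a , e ℕ.* b) (powₚ ((k , 0) ∷ (0 , 0) ∷ []) (n ∸ a)))
                                            (powₚ ((0 , k) ∷ (0 , 0) ∷ []) (n ∸ b)))) []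

-- If x has order 1 and y has order `l`, then xᵃyᵇ has order a + l b, which is the weight used here.
weight≥ : ℕ → ℕ → Poly → Bool
weight≥ l n = foldr (λ (a , b) → (n ℕ.≤ᵇ (a ℕ.+ l ℕ.* b)) ∧_) true

-- The parity of the number of monomials of weight exactly `n`. When no monomial has smaller weight,
-- it is the coefficient of qⁿ in the evaluation.
weight# : ℕ → ℕ → Poly → Bool
weight# l n = foldr (λ (a , b) → ((a ℕ.+ l ℕ.* b) ℕ.≡ᵇ n) xor_) false

-- Evaluation of polynomials in rings of characteristic 2

module Characteristic2 {c ℓ} (R : CommutativeRing c ℓ)
  (x+x≈0 : ∀ x → CommutativeRing._≈_ R (CommutativeRing._+_ R x x) (CommutativeRing.0# R)) where

  open CommutativeRing R
  open import Algebra.Properties.CommutativeSemiring.Exp commutativeSemiring public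
  open import Relation.Binary.Reasoning.Setoid setoid

  private
    𝔽₂ = CommutativeRing.rawRing Bool.xor-∧-commutativeRing

    embed : Bool → Carrier
    embed false = 0#
    embed true  = 1#

    0≈x⇒ : ∀ {x y} → x + y ≈ 0# → x ≈ y
    0≈x⇒ {x} {y} p = begin
      x           ≈⟨ +-identityʳ x ⟨
      x + 0#      ≈⟨ +-congˡ (x+x≈0 y) ⟨
      x + (y + y) ≈⟨ +-assoc x y y ⟨
      x + y + y   ≈⟨ +-congʳ p ⟩
      0# + y      ≈⟨ +-identityˡ y ⟩
      y           ∎

    -- With coefficients in 𝔽₂ the ring solver cancels 1 + 1, so it proves identities that hold only
    -- in characteristic 2.
    embed-morphism : 𝔽₂ -Raw-AlmostCommutative⟶ fromCommutativeRing R
    embed-morphism = record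
      { ⟦_⟧    = embed
      ; +-homo = λ { false y → sym (+-identityˡ _) ; true false → sym (+-identityʳ _) ; true true → sym (x+x≈0 1#) }
      ; *-homo = λ { false y → sym (zeroˡ _) ; true y → sym (*-identityˡ _) }
      ; -‿homo = λ x → 0≈x⇒ (-‿inverseʳ (embed x))
      ; 0-homo = refl
      ; 1-homo = refl
      }

    embed-≟ : ∀ a b → Maybe (embed a ≈ embed b)
    embed-≟ a b with a Bool.≟ b
    ... | yes ≡.refl = just refl
    ... | no _       = nothing

  open Algebra.Solver.Ring 𝔽₂ (fromCommutativeRing R) embed-morphism embed-≟ public
    using (solve; _:=_; _:+_; _:*_; _:^_; con)

  x+y≈0⇒x≈y : ∀ {x y} → x + y ≈ 0# → x ≈ y
  x+y≈0⇒x≈y = 0≈x⇒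

  x≈y⇒x+y≈0 : ∀ {x y} → x ≈ y → x + y ≈ 0#
  x≈y⇒x+y≈0 {x} {y} p = trans (+-congʳ p) (x+x≈0 y)

  evalₘ : Carrier → Carrier → Monomial → Carrier
  evalₘ x y (a , b) = x ^ a * y ^ b

  eval : Carrier → Carrier → Poly → Carrier
  eval x y []       = 0#
  eval x y (m ∷ ms) = evalₘ x y m + eval x y ms

  module _ (x y : Carrier) where

    eval-·ₘ : ∀ m n → evalₘ x y (m ·ₘ n) ≈ evalₘ x y m * evalₘ x y n
    eval-·ₘ (a , b) (c , d) = begin
      x ^ (a ℕ.+ c) * y ^ (b ℕ.+ d)         ≈⟨ *-cong (^-homo-* x a c) (^-homo-* y b d) ⟩
      (x ^ a * x ^ c) * (y ^ b * y ^ d)     ≈⟨ solve 4 (λ p q r s → (p :* q) :* (r :* s) := (p :* r) :* (q :* s))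
          refl
                                                 (x ^ a) (x ^ c) (y ^ b) (y ^ d) ⟩
      (x ^ a * y ^ b) * (x ^ c * y ^ d)     ∎

    eval-addₚ : ∀ ps qs → eval x y (addₚ ps qs) ≈ eval x y ps + eval x y qs
    eval-addₚ []       qs = sym (+-identityˡ _)
    eval-addₚ (p ∷ ps) qs = go qs
      where
      go : ∀ qs → eval x y (addₚ (p ∷ ps) qs) ≈ eval x y (p ∷ ps) + eval x y qs
      go []       = sym (+-identityʳ _)
      go (q ∷ qs) with p ≡ₘ q in eq | p >ₘ q
      ... | true | _ rewrite ≡.sym (≡ₘ⇒≡ p q eq) = trans (eval-addₚ ps qs)
              (solve 3 (λ a b c → b :+ c := (a :+ b) :+ (a :+ c)) refl (evalₘ x y p) (eval x y ps) (eval x y qs))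
      ... | false | true  = trans (+-congˡ (eval-addₚ ps (q ∷ qs))) (sym (+-assoc _ _ _))
      ... | false | false = trans (+-congˡ (go qs))
              (solve 4 (λ a b c d → c :+ ((a :+ b) :+ d) := (a :+ b) :+ (c :+ d)) refl
                (evalₘ x y p) (eval x y ps) (evalₘ x y q) (eval x y qs))

    eval-scaleₚ : ∀ m ps → eval x y (scaleₚ m ps) ≈ evalₘ x y m * eval x y ps
    eval-scaleₚ m []       = sym (zeroʳ _)
    eval-scaleₚ m (p ∷ ps) = trans (+-cong (eval-·ₘ m p) (eval-scaleₚ m ps)) (sym (distribˡ _ _ _))

    eval-mulₚ : ∀ ps qs → eval x y (mulₚ ps qs) ≈ eval x y ps * eval x y qs
    eval-mulₚ []       qs = sym (zeroˡ _)
    eval-mulₚ (p ∷ ps) qs = begin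
      eval x y (addₚ (scaleₚ p qs) (mulₚ ps qs))                 ≈⟨ eval-addₚ (scaleₚ p qs) (mulₚ ps qs) ⟩
      eval x y (scaleₚ p qs) + eval x y (mulₚ ps qs)             ≈⟨ +-cong (eval-scaleₚ p qs) (eval-mulₚ ps qs) ⟩
      evalₘ x y p * eval x y qs + eval x y ps * eval x y qs      ≈⟨ distribʳ _ _ _ ⟨
      (evalₘ x y p + eval x y ps) * eval x y qs                  ∎

    eval-powₚ : ∀ ps n → eval x y (powₚ ps n) ≈ eval x y ps ^ n
    eval-powₚ ps zero    = trans (+-identityʳ _) (*-identityˡ _)
    eval-powₚ ps (suc n) = trans (eval-mulₚ ps (powₚ ps n)) (*-congˡ (eval-powₚ ps n))

    -- Stopping early, for lack of fuel or because the leading term is not divisible, returns the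
    -- unreduced rest as remainder, so the identity is exact in every case.
    eval-divide : ∀ k m ps rs → let (qs , rest) = divide k m ps rs in
                  eval x y rs ≈ eval x y (m ∷ ps) * eval x y qs + eval x y rest
    eval-divide zero    m       ps rs = sym (trans (+-congʳ (zeroʳ _)) (+-identityˡ _))
    eval-divide (suc k) m       ps [] = sym (trans (+-congʳ (zeroʳ _)) (+-identityˡ _))
    eval-divide (suc k) (a , b) ps ((c , d) ∷ rs) with ((c ∸ a , d ∸ b) ·ₘ (a , b)) ≡ₘ (c , d) in e
    ... | false = sym (trans (+-congʳ (zeroʳ _)) (+-identityˡ _))
    ... | true = begin
      evalₘ x y (c , d) + eval x y rs                            ≡⟨ ≡.cong (λ n → evalₘ x y n + eval x y rs)
          (≡.sym (≡ₘ⇒≡ (q ·ₘ m) (c , d) e)) ⟩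
      evalₘ x y (q ·ₘ m) + eval x y rs                           ≈⟨ +-congʳ (eval-·ₘ q m) ⟩
      Q * M + eval x y rs
        ≈⟨ solve 4 (λ Q M P r → Q :* M :+ r := (M :+ P) :* Q :+ (r :+ Q :* P)) refl Q M P (eval x y rs) ⟩
      (M + P) * Q + (eval x y rs + Q * P)
        ≈⟨ +-congˡ (trans (+-congˡ (sym (eval-scaleₚ q ps))) (sym (eval-addₚ rs (scaleₚ q ps)))) ⟩
      (M + P) * Q + eval x y (addₚ rs (scaleₚ q ps))             ≈⟨ +-congˡ (eval-divide k m ps _) ⟩
      (M + P) * Q + ((M + P) * eval x y (proj₁ rec) + eval x y (proj₂ rec))
        ≈⟨ solve 4 (λ Q N r s → N :* Q :+ (N :* r :+ s) := N :* (Q :+ r) :+ s) refl Q (M + P) _ _ ⟩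
      (M + P) * (Q + eval x y (proj₁ rec)) + eval x y (proj₂ rec) ∎
      where
      m = (a , b)
      q = (c ∸ a , d ∸ b)
      M = evalₘ x y m
      Q = evalₘ x y q
      P = eval x y ps
      rec = divide k m ps (addₚ rs (scaleₚ q ps))

    module _ (n k e : ℕ) {u v : Carrier}
      (ux : u * (x ^ k + 1#) ≈ x ^ e) (vy : v * (y ^ k + 1#) ≈ y ^ e) where

      private
        clear : ∀ {z w} a → w * (z ^ k + 1#) ≈ z ^ e → a ≤ n →
                (z ^ k + 1#) ^ n * w ^ a ≈ z ^ (e ℕ.* a) * (z ^ k + 1#) ^ (n ∸ a)
        clear {z} {w} a h a≤n = begin
          D ^ n * w ^ a                    ≡⟨ ≡.cong (λ i → D ^ i * w ^ a) (≡.sym (ℕ.m∸n+n≡m a≤n)) ⟩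
          D ^ (n ∸ a ℕ.+ a) * w ^ a        ≈⟨ *-congʳ (^-homo-* D (n ∸ a) a) ⟩
          D ^ (n ∸ a) * D ^ a * w ^ a
            ≈⟨ solve 3 (λ p q r → p :* q :* r := (r :* q) :* p) refl (D ^ (n ∸ a)) (D ^ a) (w ^ a) ⟩
          w ^ a * D ^ a * D ^ (n ∸ a)      ≈⟨ *-congʳ (^-distrib-* w D a) ⟨
          (w * D) ^ a * D ^ (n ∸ a)        ≈⟨ *-congʳ (^-congˡ a h) ⟩
          (z ^ e) ^ a * D ^ (n ∸ a)        ≈⟨ *-congʳ (^-assocʳ z e a) ⟩
          z ^ (e ℕ.* a) * D ^ (n ∸ a)      ∎
          where D = z ^ k + 1#

        binomialˣ : ∀ i → eval x y (powₚ ((k , 0) ∷ (0 , 0) ∷ []) i) ≈ (x ^ k + 1#) ^ i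
        binomialˣ i = trans (eval-powₚ ((k , 0) ∷ (0 , 0) ∷ []) i)
          (^-congˡ i (+-cong (*-identityʳ _) (trans (+-identityʳ _) (*-identityˡ _))))

        binomialʸ : ∀ i → eval x y (powₚ ((0 , k) ∷ (0 , 0) ∷ []) i) ≈ (y ^ k + 1#) ^ i
        binomialʸ i = trans (eval-powₚ ((0 , k) ∷ (0 , 0) ∷ []) i)
          (^-congˡ i (+-cong (*-identityˡ _) (trans (+-identityʳ _) (*-identityˡ _))))

      -- The degree bound makes `n ∸ a` and `n ∸ b` genuine differences, so each monomial is cleared
      -- by the full denominator.
      eval-numerator : ∀ F → All (λ m → proj₁ m ≤ n × proj₂ m ≤ n) F →
        (x ^ k + 1#) ^ n * (y ^ k + 1#) ^ n * eval u v F ≈ eval x y (numerator n k e F)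
      eval-numerator []            []                    = zeroʳ _
      eval-numerator ((a , b) ∷ F) ((a≤n , b≤n) ∷ bound) = begin
        X * Y * (u ^ a * v ^ b + eval u v F)
          ≈⟨ solve 5 (λ X Y p q r → X :* Y :* (p :* q :+ r) := (X :* p) :* (Y :* q) :+ X :* Y :* r) refl
               X Y (u ^ a) (v ^ b) (eval u v F) ⟩
        (X * u ^ a) * (Y * v ^ b) + X * Y * eval u v F
          ≈⟨ +-cong (*-cong (clear a ux a≤n) (clear b vy b≤n)) (eval-numerator F bound) ⟩
        (x ^ (e ℕ.* a) * Xa) * (y ^ (e ℕ.* b) * Yb) + rest
          ≈⟨ +-congʳ (solve 4 (λ p q r s → (p :* q) :* (r :* s) := (p :* r) :* q :* s) refl
               (x ^ (e ℕ.* a)) Xa (y ^ (e ℕ.* b)) Yb) ⟩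
        (x ^ (e ℕ.* a) * y ^ (e ℕ.* b)) * Xa * Yb + rest
          ≈⟨ +-congʳ (*-cong (*-congˡ (binomialˣ (n ∸ a))) (binomialʸ (n ∸ b))) ⟨
        evalₘ x y m * eval x y Pa * eval x y Pb + rest
          ≈⟨ +-congʳ (trans (*-congʳ (sym (eval-scaleₚ m Pa))) (sym (eval-mulₚ (scaleₚ m Pa) Pb))) ⟩
        eval x y (mulₚ (scaleₚ m Pa) Pb) + rest
          ≈⟨ eval-addₚ (mulₚ (scaleₚ m Pa) Pb) (numerator n k e F) ⟨
        eval x y (numerator n k e ((a , b) ∷ F)) ∎
        where
        X = (x ^ k + 1#) ^ n
        Y = (y ^ k + 1#) ^ n
        Xa = (x ^ k + 1#) ^ (n ∸ a)
        Yb = (y ^ k + 1#) ^ (n ∸ b)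
        m = (e ℕ.* a , e ℕ.* b)
        Pa = powₚ ((k , 0) ∷ (0 , 0) ∷ []) (n ∸ a)
        Pb = powₚ ((0 , k) ∷ (0 , 0) ∷ []) (n ∸ b)
        rest = eval x y (numerator n k e F)

open import Data.Nat using (_+_; _*_)
open import Relation.Binary.PropositionalEquality using (refl; sym; trans; cong; cong₂; subst; subst₂; module ≡-Reasoning)

-- Power series over 𝔽₂

Series : Set
Series = ℕ → Bool

infix 4 _≋_

record _≋_ (f g : Series) : Set where
  constructor pointwise
  field
    at : ∀ n → f n ≡ g n

open _≋_ public

infixl 6 _⊞_
infixl 7 _⊠_

opaque
  _⊞_ : Series → Series → Series
  (f ⊞ g) n = f n xor g n

  ⊞-at : ∀ f g n → (f ⊞ g) n ≡ f n xor g n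
  ⊞-at f g n = refl

  ⊞-≋ : ∀ {f g h} → (∀ n → f n xor g n ≡ h n) → f ⊞ g ≋ h
  ⊞-≋ p = pointwise p

𝟘 : Series
𝟘 _ = false

𝟙 : Series
𝟙 zero    = true
𝟙 (suc _) = false

tl : Series → Series
tl f n = f (suc n)

-- The Cauchy product by recursion on f = f(0) + q · `tl f`.
_⊠_ : Series → Series → Series
(f ⊠ g) zero    = f 0 ∧ g 0
(f ⊠ g) (suc n) = (f 0 ∧ g (suc n)) xor (tl f ⊠ g) n

⊠-at-cong : ∀ {f f′ g g′} n → (∀ k → f k ≡ f′ k) → (∀ k → g k ≡ g′ k) → (f ⊠ g) n ≡ (f′ ⊠ g′) n
⊠-at-cong zero    p q = cong₂ _∧_ (p 0) (q 0)
⊠-at-cong (suc n) p q = cong₂ _xor_ (cong₂ _∧_ (p 0) (q (suc n))) (⊠-at-cong n (λ k → p (suc k)) q)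

⊠-zeroˡ-at : ∀ g n → (𝟘 ⊠ g) n ≡ false
⊠-zeroˡ-at g zero    = refl
⊠-zeroˡ-at g (suc n) = ⊠-zeroˡ-at g n

⊠-distribʳ-at : ∀ h f g n → ((λ k → f k xor g k) ⊠ h) n ≡ (f ⊠ h) n xor (g ⊠ h) n
⊠-distribʳ-at h f g zero    = B.solve 3 (λ a b c → (a B.:+ b) B.:* c B.:= a B.:* c B.:+ b B.:* c) refl (f 0) (g 0)
    (h 0)
⊠-distribʳ-at h f g (suc n) rewrite ⊠-distribʳ-at h (tl f) (tl g) n =
  B.solve 5 (λ a b c d e → (a B.:+ b) B.:* c B.:+ (d B.:+ e) B.:= a B.:* c B.:+ d B.:+ (b B.:* c B.:+ e)) refl
    (f 0) (g 0) (h (suc n)) ((tl f ⊠ h) n) ((tl g ⊠ h) n)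

⊠-scale-at : ∀ b f g n → ((λ k → b ∧ f k) ⊠ g) n ≡ b ∧ (f ⊠ g) n
⊠-scale-at false f g n = ⊠-zeroˡ-at g n
⊠-scale-at true  f g n = refl

⊠-sucʳ : ∀ f g n → (f ⊠ g) (suc n) ≡ (f ⊠ tl g) n xor (f (suc n) ∧ g 0)
⊠-sucʳ f g zero    = refl
⊠-sucʳ f g (suc n) rewrite ⊠-sucʳ (tl f) g n = sym (Bool.xor-assoc (f 0 ∧ g (suc (suc n))) _ _)

⊠-comm-at : ∀ f g n → (f ⊠ g) n ≡ (g ⊠ f) n
⊠-comm-at f g zero    = Bool.∧-comm (f 0) (g 0)
⊠-comm-at f g (suc n) rewrite ⊠-sucʳ g f n | ⊠-comm-at (tl f) g n | Bool.∧-comm (f 0) (g (suc n)) = Bool.xor-comm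
    (g (suc n) ∧ f 0) _

⊠-assoc-at : ∀ f g h n → ((f ⊠ g) ⊠ h) n ≡ (f ⊠ (g ⊠ h)) n
⊠-assoc-at f g h zero    = B.solve 3 (λ a b c → (a B.:* b) B.:* c B.:= a B.:* (b B.:* c)) refl (f 0) (g 0) (h 0)
⊠-assoc-at f g h (suc n)
  rewrite ⊠-distribʳ-at h (λ k → f 0 ∧ tl g k) (tl f ⊠ g) n | ⊠-scale-at (f 0) (tl g) h n | ⊠-assoc-at (tl f) g h n
      =
  B.solve 5 (λ a b c d e → (a B.:* b) B.:* c B.:+ (a B.:* d B.:+ e) B.:= a B.:* (b B.:* c B.:+ d) B.:+ e) refl
    (f 0) (g 0) (h (suc n)) ((tl g ⊠ h) n) ((tl f ⊠ (g ⊠ h)) n)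

⊠-identityˡ-at : ∀ f n → (𝟙 ⊠ f) n ≡ f n
⊠-identityˡ-at f zero    = refl
⊠-identityˡ-at f (suc n) rewrite ⊠-zeroˡ-at f n = Bool.xor-identityʳ (f (suc n))

opaque
  unfolding _⊞_

  ⊞-cong : ∀ {f f′ g g′} → f ≋ f′ → g ≋ g′ → f ⊞ g ≋ f′ ⊞ g′
  ⊞-cong p q = pointwise λ n → cong₂ _xor_ (at p n) (at q n)

  ⊞-assoc : ∀ f g h → (f ⊞ g) ⊞ h ≋ f ⊞ (g ⊞ h)
  ⊞-assoc f g h = pointwise λ n → Bool.xor-assoc (f n) (g n) (h n)

  ⊞-self : ∀ f → f ⊞ f ≋ 𝟘
  ⊞-self f = pointwise λ n → Bool.xor-same (f n)

  ⊠-distribʳ-⊞ : ∀ h f g → (f ⊞ g) ⊠ h ≋ f ⊠ h ⊞ g ⊠ h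
  ⊠-distribʳ-⊞ h f g = pointwise (⊠-distribʳ-at h f g)

seriesRing : CommutativeRing 0ℓ 0ℓ
seriesRing = record
  { Carrier = Series
  ; _≈_ = _≋_
  ; _+_ = _⊞_
  ; _*_ = _⊠_
  ; -_ = λ f → f
  ; 0# = 𝟘
  ; 1# = 𝟙
  ; isCommutativeRing = record
    { isRing = record
      { +-isAbelianGroup = record
        { isGroup = record
          { isMonoid = record
            { isSemigroup = record
              { isMagma = record
                { isEquivalence = record
                  { refl = pointwise λ _ → refl
                  ; sym = λ p → pointwise λ n → sym (at p n)
                  ; trans = λ p q → pointwise λ n → trans (at p n) (at q n)
                  }
                ; ∙-cong = ⊞-cong
                }
              ; assoc = ⊞-assoc
              }
            ; identity = (λ f → ⊞-≋ λ n → refl) , (λ f → ⊞-≋ λ n → Bool.xor-identityʳ (f n))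
            }
          ; inverse = ⊞-self , ⊞-self
          ; ⁻¹-cong = λ p → p
          }
        ; comm = λ f g → ⊞-≋ λ n → trans (Bool.xor-comm (f n) (g n)) (sym (⊞-at g f n))
        }
      ; *-cong = λ p q → pointwise λ n → ⊠-at-cong n (at p) (at q)
      ; *-assoc = λ f g h → pointwise (⊠-assoc-at f g h)
      ; *-identity = (λ f → pointwise (⊠-identityˡ-at f))
                   , (λ f → pointwise λ n → trans (⊠-comm-at f 𝟙 n) (⊠-identityˡ-at f n))
      ; distrib = (λ h f g → pointwise λ n → trans (⊠-comm-at h (f ⊞ g) n) (trans (at (⊠-distribʳ-⊞ h f g) n)
                    (at (⊞-cong (pointwise (⊠-comm-at f h)) (pointwise (⊠-comm-at g h))) n)))
                , ⊠-distribʳ-⊞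
      }
    ; *-comm = λ f g → pointwise (⊠-comm-at f g)
    }
  }

module S = CommutativeRing seriesRing
open Characteristic2 seriesRing ⊞-self public
module ≋-Reasoning = Relation.Binary.Reasoning.Setoid S.setoid

-- Powers of q and orders of vanishing

X : Series
X zero    = false
X (suc n) = 𝟙 n

X⊠-suc : ∀ f n → (X ⊠ f) (suc n) ≡ f n
X⊠-suc f n = trans (⊠-at-cong n (λ _ → refl) (λ _ → refl)) (⊠-identityˡ-at f n)

drop : ℕ → Series → Series
drop k f n = f (k + n)

X^⊠-at : ∀ k f n → ((X ^ k) ⊠ f) (k + n) ≡ f n
X^⊠-at zero    f n = ⊠-identityˡ-at f n
X^⊠-at (suc k) f n = trans (at (S.*-assoc X (X ^ k) f) (suc (k + n))) (trans (X⊠-suc _ (k + n)) (X^⊠-at k f n))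

Below : ℕ → Series → Set
Below k f = ∀ {i} → i < k → f i ≡ false

X^⊠-below : ∀ k f → Below k ((X ^ k) ⊠ f)
X^⊠-below (suc k) f {zero}  _         = refl
X^⊠-below (suc k) f {suc i} (s≤s i<k) = trans (at (S.*-assoc X (X ^ k) f) (suc i))
    (trans (X⊠-suc _ i) (X^⊠-below k f i<k))

below-resp : ∀ {k f g} → f ≋ g → Below k f → Below k g
below-resp p b {i} i<k = trans (sym (at p i)) (b i<k)

below-factor : ∀ k {f} → Below k f → f ≋ (X ^ k) ⊠ drop k f
below-factor k {f} b = pointwise go
  where
  go : ∀ n → f n ≡ ((X ^ k) ⊠ drop k f) n
  go n with k ℕ.≤? n
  ... | yes k≤n = subst (λ n → f n ≡ ((X ^ k) ⊠ drop k f) n) (ℕ.m+[n∸m]≡n k≤n) (sym (X^⊠-at k (drop k f) (n ∸ k)))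
  ... | no  k≰n = trans (b (ℕ.≰⇒> k≰n)) (sym (X^⊠-below k (drop k f) (ℕ.≰⇒> k≰n)))

private
  ⊠-factor : ∀ m n {f g} → Below m f → Below n g → f ⊠ g ≋ (X ^ (m + n)) ⊠ (drop m f ⊠ drop n g)
  ⊠-factor m n {f} {g} bf bg = begin
    f ⊠ g                                              ≈⟨ S.*-cong (below-factor m bf) (below-factor n bg) ⟩
    ((X ^ m) ⊠ drop m f) ⊠ ((X ^ n) ⊠ drop n g)
      ≈⟨ solve 4 (λ a b c d → (a :* b) :* (c :* d) := (a :* c) :* (b :* d)) S.refl (X ^ m) (drop m f) (X ^ n)
          (drop n g) ⟩
    ((X ^ m) ⊠ (X ^ n)) ⊠ (drop m f ⊠ drop n g)        ≈⟨ S.*-congʳ (^-homo-* X m n) ⟨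
    (X ^ (m + n)) ⊠ (drop m f ⊠ drop n g)              ∎
    where open ≋-Reasoning

below-⊠ : ∀ m n {f g} → Below m f → Below n g → Below (m + n) (f ⊠ g)
below-⊠ m n bf bg = below-resp (S.sym (⊠-factor m n bf bg)) (X^⊠-below (m + n) _)

lead-⊠ : ∀ m n {f g} → Below m f → Below n g → (f ⊠ g) (m + n) ≡ f m ∧ g n
lead-⊠ m n {f} {g} bf bg = begin
  (f ⊠ g) (m + n)                                        ≡⟨ at (⊠-factor m n bf bg) (m + n) ⟩
  ((X ^ (m + n)) ⊠ (drop m f ⊠ drop n g)) (m + n)        ≡⟨ cong ((X ^ (m + n)) ⊠ (drop m f ⊠ drop n g))
      (sym (ℕ.+-identityʳ (m + n))) ⟩
  ((X ^ (m + n)) ⊠ (drop m f ⊠ drop n g)) (m + n + 0)    ≡⟨ X^⊠-at (m + n) _ 0 ⟩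
  f (m + 0) ∧ g (n + 0)                                  ≡⟨ cong₂ (λ i j → f i ∧ g j) (ℕ.+-identityʳ m)
      (ℕ.+-identityʳ n) ⟩
  f m ∧ g n                                              ∎
  where open ≡-Reasoning

⊞-at-≡ : ∀ {f g n a b} → f n ≡ a → g n ≡ b → (f ⊞ g) n ≡ a xor b
⊞-at-≡ {f} {g} {n} p q = trans (⊞-at f g n) (cong₂ _xor_ p q)

below-⊞ : ∀ {k f g} → Below k f → Below k g → Below k (f ⊞ g)
below-⊞ bf bg i<k = ⊞-at-≡ (bf i<k) (bg i<k)

below-weaken : ∀ {m n f} → m ≤ n → Below n f → Below m f
below-weaken m≤n b i<m = b (ℕ.<-≤-trans i<m m≤n)

below-⊠ˡ : ∀ {k f} g → Below k f → Below k (f ⊠ g)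
below-⊠ˡ {k} {f} g b = subst (λ k → Below k (f ⊠ g)) (ℕ.+-identityʳ k) (below-⊠ k 0 {f} {g} b (λ ()))

below-⊠ʳ : ∀ {k f} g → Below k f → Below k (g ⊠ f)
below-⊠ʳ g b = below-resp (S.*-comm _ g) (below-⊠ˡ g b)

below-all : ∀ {f} → (∀ k → Below k f) → f ≋ 𝟘
below-all b = pointwise λ n → b (suc n) (ℕ.n<1+n n)

record Order (n : ℕ) (f : Series) : Set where
  constructor order
  field
    below : Below n f
    lead  : f n ≡ true

open Order public

order-resp : ∀ {n f g} → f ≋ g → Order n f → Order n g
order-resp p (order b l) = order (below-resp p b) (trans (sym (at p _)) l)

order-⊠ : ∀ {m n f g} → Order m f → Order n g → Order (m + n) (f ⊠ g)
order-⊠ {m} {n} {f} {g} (order bf lf) (order bg lg) =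
  order (below-⊠ m n bf bg) (trans (lead-⊠ m n {f} {g} bf bg) (cong₂ _∧_ lf lg))

order-𝟙 : Order 0 𝟙
order-𝟙 = order (λ ()) refl

order-^ : ∀ {n f} → Order n f → ∀ k → Order (n * k) (f ^ k)
order-^ {n} o zero    = subst (λ i → Order i 𝟙) (sym (ℕ.*-zeroʳ n)) order-𝟙
order-^ {n} {f} o (suc k) = subst (λ i → Order i (f ^ suc k)) (sym (ℕ.*-suc n k)) (order-⊠ o (order-^ o k))

order-X : Order 1 X
order-X = order (λ { (s≤s z≤n) → refl }) refl

order-X^ : ∀ k → Order k (X ^ k)
order-X^ k = subst (λ i → Order i (X ^ k)) (ℕ.*-identityˡ k) (order-^ order-X k)

order-⊞ : ∀ {n f g} → Order n f → Below (suc n) g → Order n (f ⊞ g)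
order-⊞ (order b l) bg = order (below-⊞ b (λ i<n → bg (ℕ.m<n⇒m<1+n i<n))) (⊞-at-≡ l (bg (ℕ.n<1+n _)))

-- Strong induction: once g is known to vanish below i, the coefficient of the product at n + i is
-- `g i`.
order⇒⊠-cancel-𝟘 : ∀ {n f g} → Order n f → f ⊠ g ≋ 𝟘 → g ≋ 𝟘
order⇒⊠-cancel-𝟘 {n} {f} {g} (order bf lf) p = pointwise (<-rec _ step)
  where
  step : ∀ i → (∀ {j} → j < i → g j ≡ false) → g i ≡ false
  step i bg = trans (sym (cong (_∧ g i) lf)) (trans (sym (lead-⊠ n i {f} {g} bf bg)) (at p (n + i)))

order⇒⊠-cancelˡ : ∀ {n f g h} → Order n f → f ⊠ g ≋ f ⊠ h → g ≋ h
order⇒⊠-cancelˡ {f = f} {g} {h} o p =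
  x+y≈0⇒x≈y (order⇒⊠-cancel-𝟘 o (S.trans (S.distribˡ f g h) (x≈y⇒x+y≈0 p)))

-- The cofactor f² + fg + g² of f + g in f³ + g³ has leading coefficient 1 + 1 + 1.
cube-injective : ∀ {n f g} → Order n f → Order n g → f ^ 3 ≋ g ^ 3 → f ≋ g
cube-injective {n} {f} {g} of og p = x+y≈0⇒x≈y (order⇒⊠-cancel-𝟘 o
  (S.trans (solve 2 (λ f g → (f :* f :+ f :* g :+ g :* g) :* (f :+ g) := f :^ 3 :+ g :^ 3) S.refl f g)
      (x≈y⇒x+y≈0 p)))
  where
  o : Order (n + n) (f ⊠ f ⊞ f ⊠ g ⊞ g ⊠ g)
  o = order (below-⊞ (below-⊞ (below (order-⊠ of of)) (below (order-⊠ of og))) (below (order-⊠ og og)))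
        (⊞-at-≡ (⊞-at-≡ (lead (order-⊠ of of)) (lead (order-⊠ of og))) (lead (order-⊠ og og)))

private
  ∧-true : ∀ {a b} → a ∧ b ≡ true → a ≡ true × b ≡ true
  ∧-true {true} {true} _ = refl , refl

  order-at : ∀ {w n f} → Order w f → n ≤ w → f n ≡ (w ≡ᵇ n)
  order-at {w} {n} {f} o n≤w with w ≡ᵇ n in eq
  ... | true  = trans (cong f (sym (ℕ.≡ᵇ⇒≡ w n (Equivalence.from Bool.T-≡ eq)))) (lead o)
  ... | false = below o (ℕ.≤∧≢⇒< n≤w λ { refl → subst T eq (ℕ.≡⇒≡ᵇ w w refl) })

module _ {l x y} (ox : Order 1 x) (oy : Order l y) where

  order-evalₘ : ∀ a b → Order (a + l * b) (evalₘ x y (a , b))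
  order-evalₘ a b = order-⊠ (subst (λ i → Order i (x ^ a)) (ℕ.*-identityˡ a) (order-^ ox a)) (order-^ oy b)

  eval-below : ∀ n F → weight≥ l n F ≡ true → Below n (eval x y F)
  eval-below n []            _ _ = refl
  eval-below n ((a , b) ∷ F) w with ∧-true w
  ... | w₁ , w₂ = below-⊞ (below-weaken (ℕ.≤ᵇ⇒≤ n _ (Equivalence.from Bool.T-≡ w₁)) (below (order-evalₘ a b)))
      (eval-below n F w₂)

  eval-lead : ∀ n F → weight≥ l n F ≡ true → eval x y F n ≡ weight# l n F
  eval-lead n []            _ = refl
  eval-lead n ((a , b) ∷ F) w with ∧-true w
  ... | w₁ , w₂ = ⊞-at-≡ (order-at (order-evalₘ a b) (ℕ.≤ᵇ⇒≤ n _ (Equivalence.from Bool.T-≡ w₁))) (eval-lead n F w₂)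

-- The operators V and U

constant : Bool → Series
constant b zero    = b
constant b (suc _) = false

constant-∧ : ∀ b f n → (constant b ⊠ f) n ≡ b ∧ f n
constant-∧ b f zero    = refl
constant-∧ b f (suc n) = trans (cong ((b ∧ f (suc n)) xor_) (⊠-zeroˡ-at f n)) (Bool.xor-identityʳ _)

head-tail : ∀ f → f ≋ constant (f 0) ⊞ X ⊠ tl f
head-tail f = S.sym (⊞-≋ λ where
  zero    → Bool.xor-identityʳ (f 0)
  (suc n) → X⊠-suc (tl f) n)

-- V ℓ f = f(q^ℓ); spread c f emits the coefficients of f separated by l zeros, the first one after c zeros.
spread : (l c : ℕ) → Series → Series
spread l zero    f zero    = f 0
spread l zero    f (suc n) = spread l l (tl f) n
spread l (suc c) f zero    = false
spread l (suc c) f (suc n) = spread l c f n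

V : ℕ → Series → Series
V zero    f = f
V (suc l) f = spread l 0 f

spread-cong : ∀ l c {f g} n → (∀ k → f k ≡ g k) → spread l c f n ≡ spread l c g n
spread-cong l zero    zero    p = p 0
spread-cong l zero    (suc n) p = spread-cong l l n (λ k → p (suc k))
spread-cong l (suc c) zero    p = refl
spread-cong l (suc c) (suc n) p = spread-cong l c n p

spread-xor : ∀ l c f g n → spread l c (λ k → f k xor g k) n ≡ spread l c f n xor spread l c g n
spread-xor l zero    f g zero    = refl
spread-xor l zero    f g (suc n) = spread-xor l l (tl f) (tl g) n
spread-xor l (suc c) f g zero    = refl
spread-xor l (suc c) f g (suc n) = spread-xor l c f g n

spread-X^ : ∀ l c f → spread l c f ≋ (X ^ c) ⊠ spread l 0 f
spread-X^ l zero    f = S.sym (S.*-identityˡ _)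
spread-X^ l (suc c) f = pointwise λ where
  zero    → refl
  (suc n) → trans (at (spread-X^ l c f) n) (sym (trans (at (S.*-assoc X (X ^ c) _) (suc n)) (X⊠-suc _ n)))

V-cong : ∀ l {f g} → f ≋ g → V l f ≋ V l g
V-cong zero    p = p
V-cong (suc l) p = pointwise λ n → spread-cong l 0 n (at p)

V-⊞ : ∀ l f g → V l (f ⊞ g) ≋ V l f ⊞ V l g
V-⊞ zero    f g = S.refl
V-⊞ (suc l) f g = S.sym (⊞-≋ λ n → sym (trans (spread-cong l 0 n (⊞-at f g)) (spread-xor l 0 f g n)))

V-head-tail : ∀ l f → V (suc l) f ≋ constant (f 0) ⊞ (X ^ suc l) ⊠ V (suc l) (tl f)
V-head-tail l f = S.trans (S.sym (⊞-≋ λ where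
    zero    → Bool.xor-identityʳ (f 0)
    (suc n) → trans (X⊠-suc ((X ^ l) ⊠ V (suc l) (tl f)) n) (sym (at (spread-X^ l l (tl f)) n))))
  (S.+-congˡ (S.sym (S.*-assoc X (X ^ l) _)))

-- Each unfolding gains a factor `X ^ suc m`, so the recursion determines every coefficient.
-- Multiplicativity of `V`, its composition law and Frobenius are obtained from this without
-- convolution sums.
head-tail-unique : ∀ m (A Φ Ψ : Series → Series) →
  (∀ f → Φ f ≋ A f ⊞ (X ^ suc m) ⊠ Φ (tl f)) →
  (∀ f → Ψ f ≋ A f ⊞ (X ^ suc m) ⊠ Ψ (tl f)) →
  ∀ f → Φ f ≋ Ψ f
head-tail-unique m A Φ Ψ hΦ hΨ f = pointwise λ n → <-rec (λ n → ∀ f → Φ f n ≡ Ψ f n) step n f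
  where
  step : ∀ n → (∀ {k} → k < n → ∀ f → Φ f k ≡ Ψ f k) → ∀ f → Φ f n ≡ Ψ f n
  step n ih f = trans (at (hΦ f) n) (trans (⊞-at-≡ refl eq) (sym (trans (at (hΨ f) n) (⊞-at _ _ n))))
    where
    eq : ((X ^ suc m) ⊠ Φ (tl f)) n ≡ ((X ^ suc m) ⊠ Ψ (tl f)) n
    eq with suc m ℕ.≤? n
    ... | no  m≰n = trans (X^⊠-below (suc m) _ (ℕ.≰⇒> m≰n)) (sym (X^⊠-below (suc m) _ (ℕ.≰⇒> m≰n)))
    ... | yes m≤n with ℕ.m+[n∸m]≡n m≤n
    ... | e = subst (λ i → ((X ^ suc m) ⊠ Φ (tl f)) i ≡ ((X ^ suc m) ⊠ Ψ (tl f)) i) e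
      (trans (X^⊠-at (suc m) _ (n ∸ suc m)) (trans (ih (ℕ.∸-monoʳ-< z<s m≤n) (tl f))
          (sym (X^⊠-at (suc m) _ (n ∸ suc m)))))

spread-𝟘 : ∀ l c n → spread l c 𝟘 n ≡ false
spread-𝟘 l zero    zero    = refl
spread-𝟘 l zero    (suc n) = spread-𝟘 l l n
spread-𝟘 l (suc c) zero    = refl
spread-𝟘 l (suc c) (suc n) = spread-𝟘 l c n

V-𝟘 : ∀ l → V l 𝟘 ≋ 𝟘
V-𝟘 zero    = S.refl
V-𝟘 (suc l) = pointwise (spread-𝟘 l 0)

V-constant-⊠ : ∀ l b f → V l (constant b ⊠ f) ≋ constant b ⊠ V l f
V-constant-⊠ l false f = S.trans (V-cong l (pointwise (constant-∧ false f)))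
    (S.trans (V-𝟘 l) (S.sym (pointwise (constant-∧ false (V l f)))))
V-constant-⊠ l true  f = S.trans (V-cong l (pointwise (constant-∧ true f)))
    (S.sym (pointwise (constant-∧ true (V l f))))

V-X⊠ : ∀ l f → V (suc l) (X ⊠ f) ≋ (X ^ suc l) ⊠ V (suc l) f
V-X⊠ l f = S.trans (V-head-tail l (X ⊠ f)) (S.trans
  (S.+-cong (pointwise λ { zero → refl ; (suc n) → refl }) (S.*-congˡ (V-cong (suc l) (pointwise (X⊠-suc f)))))
  (S.+-identityˡ _))

V-⊠ : ∀ l f g → V (suc l) (f ⊠ g) ≋ V (suc l) f ⊠ V (suc l) g
V-⊠ l f g = head-tail-unique l (λ f → constant (f 0) ⊠ W g) (λ f → W (f ⊠ g)) (λ f → W f ⊠ W g)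
  (λ f → begin
    W (f ⊠ g)                                               ≈⟨ V-cong (suc l) (S.*-congʳ (head-tail f)) ⟩
    W ((constant (f 0) ⊞ X ⊠ tl f) ⊠ g)                     ≈⟨ V-cong (suc l)
        (S.trans (S.distribʳ _ _ _) (S.+-congˡ (S.*-assoc _ _ _))) ⟩
    W (constant (f 0) ⊠ g ⊞ X ⊠ (tl f ⊠ g))                 ≈⟨ V-⊞ (suc l) _ _ ⟩
    W (constant (f 0) ⊠ g) ⊞ W (X ⊠ (tl f ⊠ g))             ≈⟨ S.+-cong (V-constant-⊠ (suc l) (f 0) g) (V-X⊠ l _) ⟩
    constant (f 0) ⊠ W g ⊞ (X ^ suc l) ⊠ W (tl f ⊠ g)       ∎)
  (λ f → S.trans (S.*-congʳ (V-head-tail l f)) (S.trans (S.distribʳ _ _ _) (S.+-congˡ (S.*-assoc _ _ _))))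
  f
  where
  open ≋-Reasoning
  W = V (suc l)

V-𝟙 : ∀ l → V (suc l) 𝟙 ≋ 𝟙
V-𝟙 l = pointwise λ { zero → refl ; (suc n) → spread-𝟘 l l n }

V-^ : ∀ l f k → V (suc l) (f ^ k) ≋ V (suc l) f ^ k
V-^ l f zero    = V-𝟙 l
V-^ l f (suc k) = S.trans (V-⊠ l f (f ^ k)) (S.*-congˡ (V-^ l f k))

V-eval : ∀ l x y F → V (suc l) (eval x y F) ≋ eval (V (suc l) x) (V (suc l) y) F
V-eval l x y []            = V-𝟘 (suc l)
V-eval l x y ((a , b) ∷ F) = S.trans (V-⊞ (suc l) _ _)
  (S.+-cong (S.trans (V-⊠ l _ _) (S.*-cong (V-^ l x a) (V-^ l y b))) (V-eval l x y F))

V-X : ∀ l → V (suc l) X ≋ X ^ suc l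
V-X l = S.trans (V-cong (suc l) (S.sym (S.*-identityʳ X))) (S.trans (V-X⊠ l 𝟙)
    (S.trans (S.*-congˡ (V-𝟙 l)) (S.*-identityʳ _)))

V-X^⊠ : ∀ l k f → V (suc l) ((X ^ k) ⊠ f) ≋ (X ^ (suc l * k)) ⊠ V (suc l) f
V-X^⊠ l k f = S.trans (V-⊠ l _ _) (S.*-congʳ (S.trans (V-^ l X k)
    (S.trans (^-congˡ k (V-X l)) (^-assocʳ X (suc l) k))))

V-V : ∀ k l f → V (suc k) (V (suc l) f) ≋ V (suc k * suc l) f
V-V k l = head-tail-unique (l + k * suc l) (λ f → constant (f 0)) _ _
  (λ f → S.trans (V-cong (suc k) (V-head-tail l f)) (S.trans (V-⊞ (suc k) _ _)
      (S.+-cong (V-constant (f 0)) (V-X^⊠ k (suc l) _))))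
  (V-head-tail (l + k * suc l))
  where
  V-constant : ∀ b → V (suc k) (constant b) ≋ constant b
  V-constant b = S.trans (V-cong (suc k) (S.sym (S.*-identityʳ _)))
      (S.trans (V-constant-⊠ (suc k) b 𝟙) (S.trans (S.*-congˡ (V-𝟙 k)) (S.*-identityʳ _)))

V-comm : ∀ k l f → V (suc k) (V (suc l) f) ≋ V (suc l) (V (suc k) f)
V-comm k l f = S.trans (V-V k l f) (S.trans (S.reflexive (cong (λ m → V m f) (ℕ.*-comm (suc k) (suc l))))
    (S.sym (V-V l k f)))

frobenius : ∀ f → f ⊠ f ≋ V 2 f
frobenius = head-tail-unique 1 (λ f → constant (f 0)) (λ f → f ⊠ f) (V 2)
  (λ f → S.trans (S.*-cong (head-tail f) (head-tail f))
    (S.trans (solve 3 (λ c x t → (c :+ x :* t) :* (c :+ x :* t) := c :* c :+ x :^ 2 :* (t :* t)) S.refl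
        (constant (f 0)) X (tl f))
      (S.+-congʳ (pointwise λ n → trans (constant-∧ (f 0) (constant (f 0)) n) (idem (f 0) n)))))
  (V-head-tail 1)
  where
  idem : ∀ b n → b ∧ constant b n ≡ constant b n
  idem b zero    = Bool.∧-idem b
  idem b (suc n) = Bool.∧-zeroʳ b

V-at : ∀ l f k → V (suc l) f (k * suc l) ≡ f k
V-at l f zero    = refl
V-at l f (suc k) = trans (at (V-head-tail l f) (suc l + k * suc l))
    (trans (⊞-at _ _ (suc l + k * suc l)) (trans (X^⊠-at (suc l) _ (k * suc l)) (V-at l (tl f) k)))

square-zero : ∀ {f} → f ⊠ f ≋ 𝟘 → f ≋ 𝟘
square-zero {f} p = pointwise λ k → trans (sym (V-at 1 f k)) (trans (sym (at (frobenius f) (k * 2))) (at p (k * 2)))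

V-at-∤ : ∀ l f n → suc l ∤ n → V (suc l) f n ≡ false
V-at-∤ l f n = <-rec (λ n → ∀ f → suc l ∤ n → V (suc l) f n ≡ false) step n f
  where
  step : ∀ n → (∀ {k} → k < n → ∀ f → suc l ∤ k → V (suc l) f k ≡ false) → ∀ f → suc l ∤ n → V (suc l) f n ≡ false
  step zero    ih f l∤n = ⊥-elim (l∤n (suc l ∣0))
  step (suc n) ih f l∤n with suc l ℕ.≤? suc n
  ... | no  l≰n = trans (at (V-head-tail l f) (suc n)) (⊞-at-≡ refl (X^⊠-below (suc l) _ (ℕ.≰⇒> l≰n)))
  ... | yes l≤n = trans (trans (at (V-head-tail l f) (suc n)) (⊞-at _ _ (suc n)))
    (trans (cong ((X ^ suc l) ⊠ V (suc l) (tl f)) (sym e)) (trans (X^⊠-at (suc l) _ (suc n ∸ suc l))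
      (ih (ℕ.∸-monoʳ-< z<s l≤n) (tl f) λ d → l∤n (subst (suc l ∣_) e (∣m∣n⇒∣m+n ∣-refl d)))))
    where e = ℕ.m+[n∸m]≡n l≤n

order-V : ∀ l {n f} → Order n f → Order (suc l * n) (V (suc l) f)
order-V l {n} {f} (order b t) = order-resp (S.sym (S.trans (V-cong (suc l) (below-factor n b)) (V-X^⊠ l n _)))
  (subst (λ i → Order i ((X ^ (suc l * n)) ⊠ V (suc l) (drop n f))) (ℕ.+-identityʳ _)
    (order-⊠ (order-X^ (suc l * n)) (order (λ ()) (trans (cong f (ℕ.+-identityʳ n)) t))))

below-V : ∀ l {n f} → Below n f → Below (suc l * n) (V (suc l) f)
below-V l {n} {f} b = below-resp (S.sym (S.trans (V-cong (suc l) (below-factor n b)) (V-X^⊠ l n _)))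
    (X^⊠-below (suc l * n) _)

U : ℕ → Series → Series
U l f n = f (n * l)

U-cong : ∀ l {f g} → f ≋ g → U l f ≋ U l g
U-cong l p = pointwise λ n → at p (n * l)

-- The projection formula: at multiples of ℓ, a factor in q^ℓ only meets the coefficients of g at
-- multiples of ℓ.
U-V-⊠ : ∀ l f g → U (suc l) (V (suc l) f ⊠ g) ≋ f ⊠ U (suc l) g
U-V-⊠ l f g = pointwise λ n → go n f
  where
  unroll : ∀ f → V (suc l) f ⊠ g ≋ constant (f 0) ⊠ g ⊞ (X ^ suc l) ⊠ (V (suc l) (tl f) ⊠ g)
  unroll f = S.trans (S.*-congʳ (V-head-tail l f)) (S.trans (S.distribʳ _ _ _) (S.+-congˡ (S.*-assoc _ _ _)))
  go : ∀ n f → (V (suc l) f ⊠ g) (n * suc l) ≡ (f ⊠ U (suc l) g) n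
  go zero    f = refl
  go (suc n) f = trans (at (unroll f) (suc l + n * suc l))
    (⊞-at-≡ (constant-∧ (f 0) g _) (trans (X^⊠-at (suc l) _ (n * suc l)) (go n (tl f))))

U-V-coprime : ∀ l m f → Coprime (suc m) l → U l (V (suc m) f) ≋ V (suc m) (U l f)
U-V-coprime l m f c = pointwise go
  where
  go : ∀ n → V (suc m) f (n * l) ≡ V (suc m) (U l f) n
  go n with suc m ∣? n
  ... | no  m∤n = trans (V-at-∤ m f _ λ d → m∤n (coprime-divisor c (subst (suc m ∣_) (ℕ.*-comm n l) d)))
      (sym (V-at-∤ m _ n m∤n))
  ... | yes (divides k refl) = trans (cong (V (suc m) f) eq) (trans (V-at m f (k * l)) (sym (V-at m (U l f) k)))
    where
    eq : k * suc m * l ≡ k * l * suc m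
    eq = trans (ℕ.*-assoc k (suc m) l) (trans (cong (k *_) (ℕ.*-comm (suc m) l)) (sym (ℕ.*-assoc k l (suc m))))

-- Modular equations

degree≤ : ℕ → Poly → Bool
degree≤ n = all (λ (a , b) → (a ≤ᵇ n) ∧ (b ≤ᵇ n))

-- The fuel 1000 exceeds the number of monomials in every quotient that occurs.
private
  quotient : (p l : ℕ) → Poly → Monomial → Poly → ℕ → Poly × Poly
  quotient p l F m ps e = divide 1000 m ps (numerator (suc l) (suc p) e F)

  absurd : {A : Set} → true ≡ false → A
  absurd ()

  null⇒[] : ∀ {A : Set} {xs : List A} → null xs ≡ true → xs ≡ []
  null⇒[] {xs = []} _ = refl

  degree≤⇒ : ∀ n F → degree≤ n F ≡ true → All (λ m → proj₁ m ≤ n × proj₂ m ≤ n) F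
  degree≤⇒ n []            _ = []
  degree≤⇒ n ((a , b) ∷ F) d with ∧-true d
  ... | d₁ , d₂ with ∧-true d₁
  ... | da , db = (ℕ.≤ᵇ⇒≤ a n (Equivalence.from Bool.T-≡ da) , ℕ.≤ᵇ⇒≤ b n (Equivalence.from Bool.T-≡ db)) ∷
      degree≤⇒ n F d₂

-- Both numerators of F, at (G(q), G(q^ℓ)) and at (G(q^p), G(q^pℓ)), are multiples of m + ps,
-- and the second cofactor has order exactly (p - 1)(ℓ + 1) in q.
certified : (p l : ℕ) → Poly → Monomial → Poly → Bool
certified p l F m ps =
  degree≤ (suc l) F ∧ (weight≥ l (suc l) F ∧ (not (weight# l (suc l) F) ∧
      (null (proj₂ (quotient p l F m ps 1)) ∧ check (quotient p l F m ps p))))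
  where
  check : Poly × Poly → Bool
  check (qs , rs) = null rs ∧ (weight≥ l ((p ∸ 1) * suc l) qs ∧ weight# l ((p ∸ 1) * suc l) qs)

record Parametrised (p : ℕ) (G : Series) : Set where
  field
    r       : Series
    order-r : Order 1 r
    G-r     : G ⊠ ((r ^ suc p) ⊞ 𝟙) ≋ r ^ 1
    VG-r    : V p G ⊠ ((r ^ suc p) ⊞ 𝟙) ≋ r ^ p

module ModularEquation {p′ l′ : ℕ} .{{_ : NonZero p′}} {G : Series} (oG : Order 1 G)
    (param : Parametrised (suc p′) G)
         (F : Poly) (m : Monomial) (ps : Poly) where

  open Parametrised param

  private
    p⁺ = suc p′
    l = suc l′
    s = V l r
    H = V l G
    E = eval G H F
    w = p′ * suc l
    Qs = proj₁ (quotient p⁺ l F m ps p⁺)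
    Den = ((r ^ suc p⁺) ⊞ 𝟙) ^ suc l ⊠ ((s ^ suc p⁺) ⊞ 𝟙) ^ suc l

    order-s : Order l s
    order-s = subst (λ i → Order i s) (ℕ.*-identityʳ l) (order-V l′ order-r)

    order-H : Order l H
    order-H = subst (λ i → Order i H) (ℕ.*-identityʳ l) (order-V l′ oG)

    transfer : ∀ {g} e → g ⊠ ((r ^ suc p⁺) ⊞ 𝟙) ≋ r ^ e → V l g ⊠ ((s ^ suc p⁺) ⊞ 𝟙) ≋ s ^ e
    transfer {g} e h = begin
      V l g ⊠ ((s ^ suc p⁺) ⊞ 𝟙)             ≈⟨ S.*-congˡ (S.+-cong (V-^ l′ r (suc p⁺)) (V-𝟙 l′)) ⟨
      V l g ⊠ (V l (r ^ suc p⁺) ⊞ V l 𝟙)     ≈⟨ S.*-congˡ (V-⊞ l _ _) ⟨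
      V l g ⊠ V l ((r ^ suc p⁺) ⊞ 𝟙)         ≈⟨ V-⊠ l′ _ _ ⟨
      V l (g ⊠ ((r ^ suc p⁺) ⊞ 𝟙))           ≈⟨ V-cong l h ⟩
      V l (r ^ e)                           ≈⟨ V-^ l′ r e ⟩
      s ^ e                                 ∎
      where open ≋-Reasoning

    order-Den : Order 0 Den
    order-Den = order-⊠ (factor order-r) (factor order-s)
      where
      factor : ∀ {n z} → Order (suc n) z → Order 0 (((z ^ suc p⁺) ⊞ 𝟙) ^ suc l)
      factor {n} {z} o = order-^ {0} (order-resp (S.+-comm 𝟙 (z ^ suc p⁺))
        (order-⊞ order-𝟙 (below-weaken (s≤s z≤n) (below (order-^ o (suc p⁺)))))) (suc l)

    V-E : V p⁺ E ≋ eval (V p⁺ G) (V l (V p⁺ G)) F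
    V-E = S.trans (V-eval p′ G H F) (eval-congʳ F)
      where
      eval-congʳ : ∀ F → eval (V p⁺ G) (V p⁺ H) F ≋ eval (V p⁺ G) (V l (V p⁺ G)) F
      eval-congʳ []            = S.refl
      eval-congʳ ((a , b) ∷ F) = S.+-cong (S.*-congˡ (^-congˡ b (V-comm p′ l′ G))) (eval-congʳ F)

  modular-equation : certified p⁺ l F m ps ≡ true → eval G (V l G) F ≋ 𝟘
  modular-equation cert with ∧-true cert
  ... | c₁ , cert₁ with ∧-true cert₁
  ... | c₂ , cert₂ with ∧-true cert₂
  ... | c₃ , cert₃ with ∧-true cert₃
  ... | c₄ , cert₄ with ∧-true cert₄
  ... | c₅ , cert₅ with ∧-true {weight≥ l w Qs} {weight# l w Qs} cert₅
  ... | c₆ , c₇ = pointwise (<-rec _ step)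
    where
    Q  = eval r s (proj₁ (quotient p⁺ l F m ps 1))
    Q* = eval r s Qs
    P  = eval r s (m ∷ ps)

    bound = degree≤⇒ (suc l) F c₁

    exact : ∀ e → null (proj₂ (quotient p⁺ l F m ps e)) ≡ true →
            eval r s (numerator (suc l) (suc p⁺) e F) ≋ P ⊠ eval r s (proj₁ (quotient p⁺ l F m ps e))
    exact e c = S.trans (eval-divide r s 1000 m ps (numerator (suc l) (suc p⁺) e F))
      (S.trans (S.+-congˡ (S.reflexive (cong (eval r s) (null⇒[] c)))) (S.+-identityʳ _))

    DE : Den ⊠ E ≋ P ⊠ Q
    DE = S.trans (eval-numerator r s (suc l) (suc p⁺) 1 G-r (transfer 1 G-r) F bound) (exact 1 c₄)

    DVE : Den ⊠ V p⁺ E ≋ P ⊠ Q*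
    DVE = S.trans (S.*-congˡ V-E)
      (S.trans (eval-numerator r s (suc l) (suc p⁺) p⁺ VG-r (transfer p⁺ VG-r) F bound) (exact p⁺ c₅))

    relation : E ⊠ Q* ≋ V p⁺ E ⊠ Q
    relation = order⇒⊠-cancelˡ order-Den (begin
      Den ⊠ (E ⊠ Q*)       ≈⟨ S.*-assoc _ _ _ ⟨
      (Den ⊠ E) ⊠ Q*       ≈⟨ S.*-congʳ DE ⟩
      (P ⊠ Q) ⊠ Q*         ≈⟨ solve 3 (λ P Q R → (P :* Q) :* R := (P :* R) :* Q) S.refl P Q Q* ⟩
      (P ⊠ Q*) ⊠ Q         ≈⟨ S.*-congʳ DVE ⟨
      (Den ⊠ V p⁺ E) ⊠ Q    ≈⟨ S.*-assoc _ _ _ ⟩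
      Den ⊠ (V p⁺ E ⊠ Q)    ∎)
      where open ≋-Reasoning

    step : ∀ i → (∀ {j} → j < i → E j ≡ false) → E i ≡ false
    step i ih with ℕ.<-cmp i (suc l)
    ... | tri< i<l _ _ = eval-below oG order-H (suc l) F c₂ i<l
    -- Here the comparison of orders made below is an equality and gives nothing. The coefficient
    -- vanishes because the monomials of `F` of weight ℓ + 1, in the applications xˡ⁺¹ and xy, are
    -- even in number; `c₃` records this.
    ... | tri≈ _ refl _ = trans (eval-lead oG order-H (suc l) F c₂)
        (Bool.¬-not λ e → absurd (trans (sym c₃) (cong not e)))
    ... | tri> _ _ l<i = begin
      E i                          ≡⟨ Bool.∧-identityʳ (E i) ⟨
      E i ∧ true                   ≡⟨ cong (E i ∧_) (trans (eval-lead order-r order-s w Qs c₆) c₇) ⟨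
      E i ∧ Q* w                   ≡⟨ lead-⊠ i w {E} {Q*} ih (eval-below order-r order-s w Qs c₆) ⟨
      (E ⊠ Q*) (i + w)             ≡⟨ at relation (i + w) ⟩
      -- `V p⁺ E` vanishes below p i = i + (p - 1) i, and i > ℓ + 1 makes this larger than i + w = i
      -- + (p - 1)(ℓ + 1).
      (V p⁺ E ⊠ Q) (i + w)          ≡⟨ below-⊠ˡ Q (below-V p′ {i} ih) (ℕ.+-monoʳ-< i (ℕ.*-monoʳ-< p′ l<i)) ⟩
      false                        ∎
      where open ≡-Reasoning

open ModularEquation using (modular-equation)

-- Negative powers of G are not power series. The inverse of the unit part φ, which is q/G, stands
-- in for them.
record Uniformiser (G : Series) : Set where
  field
    φ φ⁻¹ : Series
    G≋Xφ  : G ≋ X ⊠ φ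
    φφ⁻¹  : φ ⊠ φ⁻¹ ≋ 𝟙

  order-φ : Order 0 φ
  order-φ = order (λ ()) (go (φ 0) (at φφ⁻¹ 0))
    where
    go : ∀ b {c} → b ∧ c ≡ true → b ≡ true
    go true _ = refl

  order-G : Order 1 G
  order-G = order-resp (S.sym G≋Xφ) (order-⊠ order-X order-φ)

  -- G(q^ℓ)/G(q) for ℓ = k + 1
  ratio-V : ℕ → Series
  ratio-V k = (X ^ k) ⊠ (V (suc k) φ ⊠ φ⁻¹)

  G-ratio-V : ∀ k → G ⊠ ratio-V k ≋ V (suc k) G
  G-ratio-V k = begin
    G ⊠ ratio-V k                                      ≈⟨ S.*-congʳ G≋Xφ ⟩
    (X ⊠ φ) ⊠ ((X ^ k) ⊠ (V (suc k) φ ⊠ φ⁻¹))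
      ≈⟨ solve 5 (λ x f y g i → (x :* f) :* (y :* (g :* i)) := (x :* y) :* g :* (f :* i)) S.refl X φ (X ^ k)
          (V (suc k) φ) φ⁻¹ ⟩
    (X ^ suc k) ⊠ V (suc k) φ ⊠ (φ ⊠ φ⁻¹)              ≈⟨ S.trans (S.*-congˡ φφ⁻¹) (S.*-identityʳ _) ⟩
    (X ^ suc k) ⊠ V (suc k) φ                          ≈⟨ V-X⊠ k φ ⟨
    V (suc k) (X ⊠ φ)                                  ≈⟨ V-cong (suc k) G≋Xφ ⟨
    V (suc k) G                                        ∎
    where open ≋-Reasoning

  below-ratio-V : ∀ k → Below 1 (ratio-V (suc k))
  below-ratio-V k = below-weaken (s≤s z≤n) (X^⊠-below (suc k) _)

-- Parametrisation by the series r

module _ {G : Series} (unif : Uniformiser G) where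
  open Uniformiser unif
  open ≋-Reasoning

  private
    order-1+ : ∀ {z} → Below 1 z → Order 1 (G ⊠ (𝟙 ⊞ z))
    order-1+ b = order-⊠ order-G (order-⊞ order-𝟙 b)

  -- With t = G(q³)/G(q) the relation reads t = (G(1 + t²))², so r = √t is a power series.
  parametrise₃ : G ⊠ V 3 G ≋ (G ^ 4) ⊞ (V 3 G ^ 4) → Parametrised 3 G
  parametrise₃ h = record { r = r ; order-r = order-1+ (below-⊠ˡ t (below-ratio-V 1)) ; G-r = G-r ; VG-r = VG-r }
    where
    t = ratio-V 2
    r = G ⊠ (𝟙 ⊞ t ⊠ t)

    t-eq : t ≋ G ⊠ G ⊠ (𝟙 ⊞ t ^ 4)
    t-eq = order⇒⊠-cancelˡ (order-⊠ order-G order-G) (begin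
      G ⊠ G ⊠ t                                ≈⟨ S.*-assoc G G t ⟩
      G ⊠ (G ⊠ t)                              ≈⟨ S.*-congˡ (G-ratio-V 2) ⟩
      G ⊠ V 3 G                                ≈⟨ h ⟩
      (G ^ 4) ⊞ (V 3 G ^ 4)                    ≈⟨ S.+-congˡ (^-congˡ 4 (G-ratio-V 2)) ⟨
      (G ^ 4) ⊞ ((G ⊠ t) ^ 4)
        ≈⟨ solve 2 (λ g t → g :^ 4 :+ (g :* t) :^ 4 := (g :* g) :* ((g :* g) :* (con true :+ t :^ 4))) S.refl G t ⟩
      G ⊠ G ⊠ (G ⊠ G ⊠ (𝟙 ⊞ t ^ 4))            ∎)

    r² : r ^ 2 ≋ t
    r² = S.trans (solve 2 (λ g t → (g :* (con true :+ t :* t)) :^ 2 := g :* g :* (con true :+ t :^ 4)) S.refl G t)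
        (S.sym t-eq)

    r⁴ : r ^ 4 ≋ t ⊠ t
    r⁴ = S.trans (solve 1 (λ r → r :^ 4 := r :^ 2 :* r :^ 2) S.refl r) (S.*-cong r² r²)

    G-r : G ⊠ ((r ^ 4) ⊞ 𝟙) ≋ r ^ 1
    G-r = S.trans (S.*-congˡ (S.+-congʳ r⁴))
      (solve 2 (λ g t → g :* (t :* t :+ con true) := (g :* (con true :+ t :* t)) :^ 1) S.refl G t)

    VG-r : V 3 G ⊠ ((r ^ 4) ⊞ 𝟙) ≋ r ^ 3
    VG-r = begin
      V 3 G ⊠ ((r ^ 4) ⊞ 𝟙)        ≈⟨ S.*-congʳ (G-ratio-V 2) ⟨
      (G ⊠ t) ⊠ ((r ^ 4) ⊞ 𝟙)      ≈⟨ solve 3 (λ g t d → (g :* t) :* d := t :* (g :* d)) S.refl G t ((r ^ 4) ⊞ 𝟙) ⟩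
      t ⊠ (G ⊠ ((r ^ 4) ⊞ 𝟙))      ≈⟨ S.*-cong (S.sym r²) G-r ⟩
      (r ^ 2) ⊠ (r ^ 1)            ≈⟨ solve 1 (λ r → r :^ 2 :* r :^ 1 := r :^ 3) S.refl r ⟩
      r ^ 3                        ∎

  -- Here t = G(q⁵)/G(q) satisfies t = G⁴(1 + t⁶), hence is a fourth power.
  parametrise₅ : G ⊠ V 5 G ≋ (G ^ 6) ⊞ (V 5 G ^ 6) → Parametrised 5 G
  parametrise₅ h = record { r = r ; order-r = order-1+ (below-⊠ˡ _ below-1+) ; G-r = G-r ; VG-r = VG-r }
    where
    t = ratio-V 4
    -- Two successive square roots: u² = t by `t-eq`, and writing u² for t in the definition of `u`
    -- shows that u is the square of `r`.
    u = G ⊠ G ⊠ (𝟙 ⊞ t ^ 3)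
    r = G ⊠ (𝟙 ⊞ u ^ 3)

    t-eq : t ≋ (G ^ 4) ⊠ (𝟙 ⊞ t ^ 6)
    t-eq = order⇒⊠-cancelˡ (order-⊠ order-G order-G) (begin
      G ⊠ G ⊠ t                                ≈⟨ S.*-assoc G G t ⟩
      G ⊠ (G ⊠ t)                              ≈⟨ S.*-congˡ (G-ratio-V 4) ⟩
      G ⊠ V 5 G                                ≈⟨ h ⟩
      (G ^ 6) ⊞ (V 5 G ^ 6)                    ≈⟨ S.+-congˡ (^-congˡ 6 (G-ratio-V 4)) ⟨
      (G ^ 6) ⊞ ((G ⊠ t) ^ 6)
        ≈⟨ solve 2 (λ g t → g :^ 6 :+ (g :* t) :^ 6 := (g :* g) :* (g :^ 4 :* (con true :+ t :^ 6))) S.refl G t ⟩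
      G ⊠ G ⊠ ((G ^ 4) ⊠ (𝟙 ⊞ t ^ 6))          ∎)

    u² : u ^ 2 ≋ t
    u² = S.trans (solve 2 (λ g t → (g :* g :* (con true :+ t :^ 3)) :^ 2 := g :^ 4 :* (con true :+ t :^ 6)) S.refl
        G t) (S.sym t-eq)

    r² : r ^ 2 ≋ u
    r² = begin
      r ^ 2                              ≈⟨ solve 2 (λ g u → (g :* (con true :+ u :^ 3)) :^ 2 := g :* g :*
          (con true :+ (u :^ 2) :^ 3)) S.refl G u ⟩
      G ⊠ G ⊠ (𝟙 ⊞ (u ^ 2) ^ 3)          ≈⟨ S.*-congˡ (S.+-congˡ (^-congˡ 3 u²)) ⟩
      u                                  ∎

    r⁶ : r ^ 6 ≋ u ^ 3
    r⁶ = S.trans (solve 1 (λ r → r :^ 6 := (r :^ 2) :^ 3) S.refl r) (^-congˡ 3 r²)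

    G-r : G ⊠ ((r ^ 6) ⊞ 𝟙) ≋ r ^ 1
    G-r = S.trans (S.*-congˡ (S.+-congʳ r⁶))
      (solve 2 (λ g u → g :* (u :^ 3 :+ con true) := (g :* (con true :+ u :^ 3)) :^ 1) S.refl G u)

    VG-r : V 5 G ⊠ ((r ^ 6) ⊞ 𝟙) ≋ r ^ 5
    VG-r = begin
      V 5 G ⊠ ((r ^ 6) ⊞ 𝟙)        ≈⟨ S.*-congʳ (G-ratio-V 4) ⟨
      (G ⊠ t) ⊠ ((r ^ 6) ⊞ 𝟙)      ≈⟨ solve 3 (λ g t d → (g :* t) :* d := t :* (g :* d)) S.refl G t ((r ^ 6) ⊞ 𝟙) ⟩
      t ⊠ (G ⊠ ((r ^ 6) ⊞ 𝟙))      ≈⟨ S.*-cong (S.trans (S.sym u²) (^-congˡ 2 (S.sym r²))) G-r ⟩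
      ((r ^ 2) ^ 2) ⊠ (r ^ 1)      ≈⟨ solve 1 (λ r → (r :^ 2) :^ 2 :* r :^ 1 := r :^ 5) S.refl r ⟩
      r ^ 5                        ∎

    below-1+ : Below 1 u
    below-1+ = below-⊠ˡ _ (below-⊠ˡ G (below order-G))

-- Theta series

⨁ : ℕ → (ℕ → Bool) → Bool
⨁ zero    f = false
⨁ (suc n) f = f n xor ⨁ n f

⨁-cong : ∀ n {f g} → (∀ i → i < n → f i ≡ g i) → ⨁ n f ≡ ⨁ n g
⨁-cong zero    p = refl
⨁-cong (suc n) p = cong₂ _xor_ (p n ℕ.≤-refl) (⨁-cong n (λ i i<n → p i (ℕ.m<n⇒m<1+n i<n)))

⨁-xor : ∀ n f g → ⨁ n (λ i → f i xor g i) ≡ ⨁ n f xor ⨁ n g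
⨁-xor zero    f g = refl
⨁-xor (suc n) f g = trans (cong ((f n xor g n) xor_) (⨁-xor n f g))
  (B.solve 4 (λ a b c d → (a B.:+ b) B.:+ (c B.:+ d) B.:= (a B.:+ c) B.:+ (b B.:+ d)) refl (f n) (g n) (⨁ n f)
      (⨁ n g))

⨁-head : ∀ n f → ⨁ (suc n) f ≡ f 0 xor ⨁ n (f ∘ suc)
⨁-head zero    f = refl
⨁-head (suc n) f = begin
  f (suc n) xor ⨁ (suc n) f                  ≡⟨ cong (f (suc n) xor_) (⨁-head n f) ⟩
  f (suc n) xor (f 0 xor ⨁ n (f ∘ suc))      ≡⟨ Bool.xor-assoc (f (suc n)) (f 0) _ ⟨
  (f (suc n) xor f 0) xor ⨁ n (f ∘ suc)      ≡⟨ cong (_xor ⨁ n (f ∘ suc)) (Bool.xor-comm (f (suc n)) (f 0)) ⟩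
  (f 0 xor f (suc n)) xor ⨁ n (f ∘ suc)      ≡⟨ Bool.xor-assoc (f 0) (f (suc n)) _ ⟩
  f 0 xor (f (suc n) xor ⨁ n (f ∘ suc))      ∎
  where open ≡-Reasoning

⨁-extend : ∀ k n f → (∀ i → n ≤ i → f i ≡ false) → ⨁ (k + n) f ≡ ⨁ n f
⨁-extend zero    n f z = refl
⨁-extend (suc k) n f z = trans (cong (_xor ⨁ (k + n) f) (z (k + n) (ℕ.m≤n+m n k))) (⨁-extend k n f z)

⨁-support : ∀ {m n f} → n ≤ m → (∀ i → n ≤ i → f i ≡ false) → ⨁ m f ≡ ⨁ n f
⨁-support {m} {n} {f} n≤m z = trans (cong (λ k → ⨁ k f) (sym (ℕ.m∸n+n≡m n≤m))) (⨁-extend (m ∸ n) n f z)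

⨁-true : ∀ n f → ⨁ n f ≡ true → ∃ λ i → f i ≡ true
⨁-true (suc n) f e with f n in eq
... | true  = n , eq
... | false = ⨁-true n f e

⨁-single : ∀ n f a → a < n → f a ≡ true → (∀ i → i ≢ a → f i ≡ false) → ⨁ n f ≡ true
⨁-single (suc n) f a a<n e z with n ℕ.≟ a
... | yes refl = trans (cong₂ _xor_ e (trans (⨁-cong n (λ i i<n → z i (ℕ.<⇒≢ i<n))) (⨁-false n))) refl
  where
  ⨁-false : ∀ n → ⨁ n (λ _ → false) ≡ false
  ⨁-false zero    = refl
  ⨁-false (suc n) = ⨁-false n
... | no  n≢a  = trans (cong (_xor ⨁ n f) (z n n≢a)) (⨁-single n f a (ℕ.≤∧≢⇒< (ℕ.≤-pred a<n) (n≢a ∘ sym)) e z)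

-- Off-diagonal terms pair up under exchange of i and j and cancel modulo 2.
⨁-symmetric : ∀ n (A : ℕ → ℕ → Bool) → (∀ i j → A i j ≡ A j i) → ⨁ n (λ i → ⨁ n (A i)) ≡ ⨁ n (λ i → A i i)
⨁-symmetric zero    A s = refl
⨁-symmetric (suc n) A s = begin
  (A n n xor ⨁ n (A n)) xor ⨁ n (λ i → A i n xor ⨁ n (A i))
    ≡⟨ cong ((A n n xor ⨁ n (A n)) xor_) (⨁-xor n (λ i → A i n) (λ i → ⨁ n (A i))) ⟩
  (A n n xor ⨁ n (A n)) xor (⨁ n (λ i → A i n) xor ⨁ n (λ i → ⨁ n (A i)))
    ≡⟨ cong₂ (λ x y → (A n n xor ⨁ n (A n)) xor (x xor y)) (⨁-cong n (λ i _ → s i n)) (⨁-symmetric n A s) ⟩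
  (A n n xor ⨁ n (A n)) xor (⨁ n (A n) xor ⨁ n (λ i → A i i))
    ≡⟨ B.solve 3 (λ a b c → (a B.:+ b) B.:+ (b B.:+ c) B.:= a B.:+ c) refl (A n n) (⨁ n (A n)) _ ⟩
  A n n xor ⨁ n (λ i → A i i) ∎
  where
  open ≡-Reasoning

≡ᵇ-true : ∀ {m n} → m ≡ n → (m ≡ᵇ n) ≡ true
≡ᵇ-true {m} {n} e = Equivalence.to Bool.T-≡ (ℕ.≡⇒≡ᵇ m n e)

≡ᵇ-false : ∀ {m n} → m ≢ n → (m ≡ᵇ n) ≡ false
≡ᵇ-false {m} {n} ne with m ≡ᵇ n in eq
... | false = refl
... | true  = ⊥-elim (ne (ℕ.≡ᵇ⇒≡ m n (Equivalence.from Bool.T-≡ eq)))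

bool-ext : ∀ {a b} → (a ≡ true → b ≡ true) → (b ≡ true → a ≡ true) → a ≡ b
bool-ext {true}  {b}     f g = sym (f refl)
bool-ext {false} {true}  f g = g refl
bool-ext {false} {false} f g = refl

-- θ e = Σ_a q^(e a), provided that e a ≥ a.
θ : (ℕ → ℕ) → Series
θ e n = ⨁ (suc n) (λ a → e a ≡ᵇ n)

record Exponents (e : ℕ → ℕ) : Set where
  field
    grows     : ∀ a → a ≤ e a
    injective : ∀ {a b} → e a ≡ e b → a ≡ b

  misses : ∀ {a n} → n < a → (e a ≡ᵇ n) ≡ false
  misses {a} n<a = ≡ᵇ-false (ℕ.>⇒≢ (ℕ.<-≤-trans n<a (grows a)))

  θ-at : ∀ {n N} → n < N → θ e n ≡ ⨁ N (λ a → e a ≡ᵇ n)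
  θ-at n<N = sym (⨁-support n<N (λ _ → misses))

  θ-hit : ∀ a → θ e (e a) ≡ true
  θ-hit a = ⨁-single (suc (e a)) _ a (s≤s (grows a)) (≡ᵇ-true {e a} refl) (λ i i≢a → ≡ᵇ-false (i≢a ∘ injective))

open Exponents public

θ-true : ∀ e n → θ e n ≡ true → ∃ λ a → e a ≡ n
θ-true e n t with ⨁-true (suc n) _ t
... | a , p = a , ℕ.≡ᵇ⇒≡ (e a) n (Equivalence.from Bool.T-≡ p)

V-true : ∀ l f n → V (suc l) f n ≡ true → ∃ λ k → n ≡ k * suc l × f k ≡ true
V-true l f n t with suc l ∣? n
... | no l∤n = absurd (trans (sym t) (V-at-∤ l f n l∤n))
... | yes (divides k refl) = k , refl , trans (sym (V-at l f k)) t

scaled : ∀ {e} l → Exponents e → Exponents (λ a → suc l * e a)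
scaled l E = record
  { grows     = λ a → ℕ.≤-trans (grows E a) (ℕ.m≤n*m _ (suc l))
  ; injective = λ p → injective E (ℕ.*-cancelˡ-≡ _ _ (suc l) p)
  }

V-θ : ∀ {e} l → Exponents e → V (suc l) (θ e) ≋ θ (λ a → suc l * e a)
V-θ {e} l E = pointwise λ n → bool-ext (to n) (from n)
  where
  to : ∀ n → V (suc l) (θ e) n ≡ true → θ (λ a → suc l * e a) n ≡ true
  to n t with V-true l (θ e) n t
  ... | k , refl , t′ with θ-true e k t′
  ... | a , refl = trans (cong (θ (λ a → suc l * e a)) (ℕ.*-comm (e a) (suc l))) (θ-hit (scaled l E) a)
  from : ∀ n → θ (λ a → suc l * e a) n ≡ true → V (suc l) (θ e) n ≡ true
  from n t with θ-true (λ a → suc l * e a) n t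
  ... | a , refl = trans (cong (V (suc l) (θ e)) (ℕ.*-comm (suc l) (e a))) (trans (V-at l (θ e) (e a)) (θ-hit E a))

⊠-local : ∀ n {f f′ g} → (∀ k → k ≤ n → f k ≡ f′ k) → (f ⊠ g) n ≡ (f′ ⊠ g) n
⊠-local zero    {g = g} p = cong (_∧ g 0) (p 0 z≤n)
⊠-local (suc n) {g = g} p = cong₂ _xor_ (cong (_∧ g (suc n)) (p 0 z≤n)) (⊠-local n (λ k k≤n → p (suc k) (s≤s k≤n)))

⊠-⨁ : ∀ N (F : ℕ → Series) g n → ((λ k → ⨁ N (λ a → F a k)) ⊠ g) n ≡ ⨁ N (λ a → (F a ⊠ g) n)
⊠-⨁ zero    F g n = ⊠-zeroˡ-at g n
⊠-⨁ (suc N) F g n = trans (⊠-distribʳ-at g (F N) (λ k → ⨁ N (λ a → F a k)) n)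
    (cong ((F N ⊠ g) n xor_) (⊠-⨁ N F g n))

-- The series `i ≡ᵇ_` is the monomial qⁱ.
≡ᵇ-⊠ : ∀ i j n → ((i ≡ᵇ_) ⊠ (j ≡ᵇ_)) n ≡ (i + j ≡ᵇ n)
≡ᵇ-⊠ zero    j n       = trans (⊠-at-cong n (λ { zero → refl ; (suc _) → refl }) (λ _ → refl))
    (⊠-identityˡ-at (j ≡ᵇ_) n)
≡ᵇ-⊠ (suc i) j zero    = refl
≡ᵇ-⊠ (suc i) j (suc n) = ≡ᵇ-⊠ i j n

θ-⊠ : ∀ {d e} → Exponents d → Exponents e → ∀ {n N} → n < N →
      (θ d ⊠ θ e) n ≡ ⨁ N (λ a → ⨁ N (λ b → d a + e b ≡ᵇ n))
θ-⊠ {d} {e} D E {n} {N} n<N = begin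
  (θ d ⊠ θ e) n                                              ≡⟨ ⊠-local n (λ k k≤n → θ-at D (ℕ.≤-<-trans k≤n n<N)) ⟩
  ((λ k → ⨁ N (λ a → d a ≡ᵇ k)) ⊠ θ e) n                     ≡⟨ ⊠-⨁ N (λ a → d a ≡ᵇ_) (θ e) n ⟩
  ⨁ N (λ a → ((d a ≡ᵇ_) ⊠ θ e) n)                            ≡⟨ ⨁-cong N (λ a _ → inner a) ⟩
  ⨁ N (λ a → ⨁ N (λ b → d a + e b ≡ᵇ n))                     ∎
  where
  open ≡-Reasoning
  inner : ∀ a → ((d a ≡ᵇ_) ⊠ θ e) n ≡ ⨁ N (λ b → d a + e b ≡ᵇ n)
  inner a = begin
    ((d a ≡ᵇ_) ⊠ θ e) n                                      ≡⟨ ⊠-comm-at (d a ≡ᵇ_) (θ e) n ⟩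
    (θ e ⊠ (d a ≡ᵇ_)) n                                      ≡⟨ ⊠-local n (λ k k≤n → θ-at E (ℕ.≤-<-trans k≤n n<N)) ⟩
    ((λ k → ⨁ N (λ b → e b ≡ᵇ k)) ⊠ (d a ≡ᵇ_)) n             ≡⟨ ⊠-⨁ N (λ b → e b ≡ᵇ_) (d a ≡ᵇ_) n ⟩
    ⨁ N (λ b → ((e b ≡ᵇ_) ⊠ (d a ≡ᵇ_)) n)
      ≡⟨ ⨁-cong N (λ b _ → trans (≡ᵇ-⊠ (e b) (d a) n) (cong (_≡ᵇ n) (ℕ.+-comm (e b) (d a)))) ⟩
    ⨁ N (λ b → d a + e b ≡ᵇ n)                               ∎

-- Odd squares and the equation of degree 3

double : ℕ → ℕ
double zero    = zero
double (suc n) = suc (suc (double n))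

double≡+ : ∀ n → double n ≡ n + n
double≡+ zero    = refl
double≡+ (suc n) = cong suc (trans (cong suc (double≡+ n)) (sym (ℕ.+-suc n n)))

oddSquare : ℕ → ℕ
oddSquare a = suc (double a) * suc (double a)

double-injective : ∀ {a b} → double a ≡ double b → a ≡ b
double-injective {zero}  {zero}  _ = refl
double-injective {suc a} {suc b} e = cong suc (double-injective (ℕ.suc-injective (ℕ.suc-injective e)))

n≤double : ∀ n → n ≤ double n
n≤double zero    = z≤n
n≤double (suc n) = s≤s (ℕ.m≤n⇒m≤1+n (n≤double n))

square-injective : ∀ {m n} → m * m ≡ n * n → m ≡ n
square-injective {m} {n} e with ℕ.<-cmp m n
... | tri≈ _ p _ = p
... | tri< m<n _ _ = ⊥-elim (ℕ.<⇒≢ (ℕ.*-mono-< m<n m<n) e)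
... | tri> _ _ n<m = ⊥-elim (ℕ.<⇒≢ (ℕ.*-mono-< n<m n<m) (sym e))

oddSquares : Exponents oddSquare
oddSquares = record
  { grows     = λ a → ℕ.≤-trans (ℕ.m≤n⇒m≤1+n (n≤double a)) (ℕ.m≤m*n _ (suc (double a)))
  ; injective = λ p → double-injective (ℕ.suc-injective (square-injective p))
  }

-- Δ(z) modulo 2
D : Series
D = θ oddSquare

-- For fixed b, the odd numbers 2a+1 are the |2(2c+1) - (2b+1)| together with the 2(2c+1) + (2b+1);
-- the former are 2(κ b c) + 1, the latter 2(2c+b+1) + 1.
κ : ℕ → ℕ → ℕ
κ zero          c       = double c
κ (suc zero)    zero    = 0
κ (suc zero)    (suc c) = suc (double c)
κ (suc (suc b)) zero    = suc b
κ (suc (suc b)) (suc c) = κ b c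

κ-large : ∀ b c → b ≤ double c → b + κ b c ≡ double c
κ-large zero          c       _               = refl
κ-large (suc zero)    (suc c) _               = refl
κ-large (suc (suc b)) (suc c) (s≤s (s≤s b≤c)) = cong (suc ∘ suc) (κ-large b c b≤c)

module _ (φ : ℕ → Bool) (M : ℕ) {B : ℕ} (support : ∀ a → B ≤ a → φ a ≡ false) where

  private
    evens-odds : ∀ N → ⨁ (double N) φ ≡ ⨁ N (λ c → φ (suc (double c))) xor ⨁ N (λ c → φ (double c))
    evens-odds zero    = refl
    evens-odds (suc N) = trans (cong (λ s → φ (suc (double N)) xor (φ (double N) xor s)) (evens-odds N))
      (B.solve 4 (λ a b c d → a B.:+ (b B.:+ (c B.:+ d)) B.:= (a B.:+ c) B.:+ (b B.:+ d)) refl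
        (φ (suc (double N))) (φ (double N)) _ _)

  -- Induction on b in steps of two: passing from b to b + 2 moves the single value φ(b + 1) from
  -- the first family to the second, where it becomes the term `κ (suc (suc b)) 0`. The starting
  -- cases split the numbers by parity. Terms pushed past the truncation vanish, since φ vanishes
  -- from B on.
  odds-partition : B ≤ suc M → ∀ b → B + b ≤ double M →
    ⨁ (suc M) φ ≡ ⨁ (suc M) (λ c → φ (suc (b + double c))) xor ⨁ (suc M) (φ ∘ κ b)
  odds-partition B≤ zero B+b≤ =
    trans (sym (⨁-support {double (suc M)} {suc M} (n≤double (suc M)) (λ i Mi → support i (ℕ.≤-trans B≤ Mi))))
        (evens-odds (suc M))
  odds-partition B≤ (suc zero) B+b≤ = trans (odds-partition B≤ 0 (ℕ.≤-trans (ℕ.+-monoʳ-≤ B z≤n) B+b≤)) (begin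
    (φ (suc (double M)) xor o) xor ⨁ (suc M) (φ ∘ double)
      ≡⟨ cong₂ (λ x y → (x xor o) xor y) (support _ (B≤2M 1)) (⨁-head M (φ ∘ double)) ⟩
    o xor (φ 0 xor ⨁ M (λ c → φ (suc (suc (double c)))))
      ≡⟨ B.solve 3 (λ a b c → a B.:+ (b B.:+ c) B.:= c B.:+ (b B.:+ a)) refl o (φ 0) _ ⟩
    ⨁ M (λ c → φ (suc (suc (double c)))) xor (φ 0 xor o)
      ≡⟨ cong₂ (λ x y → (x xor ⨁ M (λ c → φ (suc (suc (double c))))) xor y) (support _ (B≤2M 2))
          (⨁-head M (φ ∘ κ 1)) ⟨
    ⨁ (suc M) (λ c → φ (suc (suc (double c)))) xor ⨁ (suc M) (φ ∘ κ 1) ∎)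
    where
    open ≡-Reasoning
    o = ⨁ M (λ c → φ (suc (double c)))
    B≤2M : ∀ k → B ≤ k + double M
    B≤2M k = ℕ.≤-trans (ℕ.m≤m+n B 1) (ℕ.≤-trans B+b≤ (ℕ.m≤n+m _ k))
  odds-partition B≤ (suc (suc b)) B+b≤ = trans (odds-partition B≤ b B+b≤′) (begin
    ⨁ (suc M) f xor ⨁ (suc M) (φ ∘ κ b)
      ≡⟨ cong₂ (λ x y → (x xor ⨁ (suc M) f) xor (y xor ⨁ M (φ ∘ κ b))) top-f top-κ ⟨
    ⨁ (suc (suc M)) f xor (false xor ⨁ M (φ ∘ κ b))
      ≡⟨ cong (_xor ⨁ M (φ ∘ κ b)) (⨁-head (suc M) f) ⟩
    (f 0 xor ⨁ (suc M) (f ∘ suc)) xor ⨁ M (φ ∘ κ b)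
      ≡⟨ cong (λ i → (φ (suc i) xor ⨁ (suc M) (f ∘ suc)) xor ⨁ M (φ ∘ κ b)) (ℕ.+-identityʳ b) ⟩
    (φ (suc b) xor ⨁ (suc M) (f ∘ suc)) xor ⨁ M (φ ∘ κ b)
      ≡⟨ B.solve 3 (λ a b c → (a B.:+ b) B.:+ c B.:= b B.:+ (a B.:+ c)) refl (φ (suc b)) _ _ ⟩
    ⨁ (suc M) (f ∘ suc) xor (φ (suc b) xor ⨁ M (φ ∘ κ b))
      ≡⟨ cong₂ _xor_ (⨁-cong (suc M) (λ c _ → cong (φ ∘ suc) (shift c))) (sym (⨁-head M (φ ∘ κ (suc (suc b))))) ⟩
    ⨁ (suc M) (λ c → φ (suc (suc (suc b) + double c))) xor ⨁ (suc M) (φ ∘ κ (suc (suc b))) ∎)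
    where
    open ≡-Reasoning
    f : ℕ → Bool
    f c = φ (suc (b + double c))
    B+b≤′ : B + b ≤ double M
    B+b≤′ = ℕ.≤-trans (ℕ.+-monoʳ-≤ B (ℕ.m≤n⇒m≤1+n (ℕ.n≤1+n b))) B+b≤
    shift : ∀ c → b + double (suc c) ≡ suc (suc b) + double c
    shift c = trans (ℕ.+-suc b _) (cong suc (ℕ.+-suc b _))
    top-f : f (suc M) ≡ false
    top-f = (support _ (ℕ.≤-trans (ℕ.m≤m+n B b) (ℕ.≤-trans B+b≤′
        (ℕ.m≤n⇒m≤1+n (ℕ.≤-trans (ℕ.m≤n⇒m≤1+n (ℕ.n≤1+n _)) (ℕ.m≤n+m _ b))))))
    top-κ : false ≡ φ (κ b M)
    top-κ = sym (support _ (ℕ.+-cancelʳ-≤ b B (κ b M) (ℕ.≤-trans B+b≤′ (ℕ.≤-reflexive (sym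
      (trans (ℕ.+-comm (κ b M) b) (κ-large b M (ℕ.≤-trans (ℕ.m≤n+m b B) B+b≤′))))))))

private
  sqd : ℕ → ℕ
  sqd a = suc (a + a) * suc (a + a)

  oddSquare≡ : ∀ a → oddSquare a ≡ sqd a
  oddSquare≡ a = cong (λ x → suc x * suc x) (double≡+ a)

-- With y = 2b + 1 and z = 2c + 1 this is (2z - y)² + 3y² = 4(y² - yz + z²), the negative term 16bc
-- having been moved to the left. It serves to make the symmetry in b and c visible.
κ-form : ∀ b c → oddSquare (κ b c) + 3 * oddSquare b + 16 * (b * c) ≡ 16 * (b * b + c * c) + 8 * (b + c) + 4
κ-form b c = trans (cong₂ (λ x y → x + 3 * y + 16 * (b * c)) (oddSquare≡ (κ b c)) (oddSquare≡ b)) (go b c)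
  where
  go : ∀ b c → sqd (κ b c) + 3 * sqd b + 16 * (b * c) ≡ 16 * (b * b + c * c) + 8 * (b + c) + 4
  go zero c rewrite double≡+ c =
    N.solve 1 (λ c → (N.con 1 N.:+ ((c N.:+ c) N.:+ (c N.:+ c))) N.:* (N.con 1 N.:+ ((c N.:+ c) N.:+ (c N.:+ c)))
        N.:+ N.con 3 N.:+ N.con 0
                  N.:= N.con 16 N.:* (N.con 0 N.:+ c N.:* c) N.:+ N.con 8 N.:* c N.:+ N.con 4) refl c
  go (suc zero) zero = refl
  go (suc zero) (suc c) rewrite double≡+ c =
    N.solve 1 (λ c → let d = N.con 1 N.:+ (c N.:+ c) ; s = N.con 1 N.:+ c in
        (N.con 1 N.:+ (d N.:+ d)) N.:* (N.con 1 N.:+ (d N.:+ d)) N.:+ N.con 27 N.:+ N.con 16 N.:* (s N.:+ N.con 0)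
        N.:= N.con 16 N.:* (N.con 1 N.:+ s N.:* s) N.:+ N.con 8 N.:* (N.con 1 N.:+ s) N.:+ N.con 4) refl c
  go (suc (suc b)) zero =
    N.solve 1 (λ b → let d = N.con 1 N.:+ b ; s = N.con 2 N.:+ b in
        (N.con 1 N.:+ (d N.:+ d)) N.:* (N.con 1 N.:+ (d N.:+ d)) N.:+ N.con 3 N.:*
            ((N.con 1 N.:+ (s N.:+ s)) N.:* (N.con 1 N.:+ (s N.:+ s))) N.:+ N.con 16 N.:* (s N.:* N.con 0)
        N.:= N.con 16 N.:* (s N.:* s N.:+ N.con 0) N.:+ N.con 8 N.:* (s N.:+ N.con 0) N.:+ N.con 4) refl b
  go (suc (suc b)) (suc c) = begin
    k + 3 * sqd (2 + b) + 16 * ((2 + b) * (1 + c))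
      ≡⟨ N.solve 3 (λ k b c → let s = N.con 2 N.:+ b in
           k N.:+ N.con 3 N.:* ((N.con 1 N.:+ (s N.:+ s)) N.:* (N.con 1 N.:+ (s N.:+ s))) N.:+ N.con 16 N.:*
               (s N.:* (N.con 1 N.:+ c))
           N.:= (k N.:+ N.con 3 N.:* ((N.con 1 N.:+ (b N.:+ b)) N.:* (N.con 1 N.:+ (b N.:+ b))) N.:+ N.con 16 N.:*
               (b N.:* c))
                N.:+ (N.con 64 N.:* b N.:+ N.con 32 N.:* c N.:+ N.con 104)) refl k b c ⟩
    (k + 3 * sqd b + 16 * (b * c)) + (64 * b + 32 * c + 104)
      ≡⟨ cong (_+ (64 * b + 32 * c + 104)) (go b c) ⟩
    (16 * (b * b + c * c) + 8 * (b + c) + 4) + (64 * b + 32 * c + 104)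
      ≡⟨ N.solve 2 (λ b c → let s = N.con 2 N.:+ b ; t = N.con 1 N.:+ c in
           (N.con 16 N.:* (b N.:* b N.:+ c N.:* c) N.:+ N.con 8 N.:* (b N.:+ c) N.:+ N.con 4) N.:+
               (N.con 64 N.:* b N.:+ N.con 32 N.:* c N.:+ N.con 104)
           N.:= N.con 16 N.:* (s N.:* s N.:+ t N.:* t) N.:+ N.con 8 N.:* (s N.:+ t) N.:+ N.con 4) refl b c ⟩
    16 * ((2 + b) * (2 + b) + (1 + c) * (1 + c)) + 8 * ((2 + b) + (1 + c)) + 4 ∎
    where
    open ≡-Reasoning
    k = sqd (κ b c)

κ-diagonal : ∀ b → κ b b ≡ b
κ-diagonal b = ℕ.+-cancelˡ-≡ b _ _ (trans (κ-large b b (n≤double b)) (double≡+ b))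

private
  form⁻ form⁺ : ℕ → ℕ → ℕ
  form⁻ b c = 3 * oddSquare b + oddSquare (κ b c)
  form⁺ b c = 3 * oddSquare b + oddSquare (suc (b + double c))

  form⁻-symmetric : ∀ b c → form⁻ b c ≡ form⁻ c b
  form⁻-symmetric b c = ℕ.+-cancelʳ-≡ (16 * (b * c)) _ _ (begin
    form⁻ b c + 16 * (b * c)                                 ≡⟨ cong (_+ 16 * (b * c))
        (ℕ.+-comm (3 * oddSquare b) _) ⟩
    oddSquare (κ b c) + 3 * oddSquare b + 16 * (b * c)       ≡⟨ κ-form b c ⟩
    16 * (b * b + c * c) + 8 * (b + c) + 4                   ≡⟨ cong₂ (λ x y → 16 * x + 8 * y + 4)
        (ℕ.+-comm (b * b) (c * c)) (ℕ.+-comm b c) ⟩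
    16 * (c * c + b * b) + 8 * (c + b) + 4                   ≡⟨ κ-form c b ⟨
    oddSquare (κ c b) + 3 * oddSquare c + 16 * (c * b)       ≡⟨ cong₂ (λ x y → x + 16 * y)
        (ℕ.+-comm (oddSquare (κ c b)) _) (ℕ.*-comm c b) ⟩
    form⁻ c b + 16 * (b * c)                                 ∎)
    where open ≡-Reasoning

  form⁺-≡ : ∀ b c → form⁺ b c ≡ 3 * sqd b + sqd (suc (b + (c + c)))
  form⁺-≡ b c = cong₂ (λ x y → 3 * x + y) (oddSquare≡ b) (trans (cong (λ i → oddSquare (suc (b + i))) (double≡+ c))
      (oddSquare≡ (suc (b + (c + c)))))

  form⁺-symmetric : ∀ b c → form⁺ b c ≡ form⁺ c b
  form⁺-symmetric b c = trans (form⁺-≡ b c) (trans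
    (N.solve 2 (λ b c → let s = λ x → (N.con 1 N.:+ (x N.:+ x)) N.:* (N.con 1 N.:+ (x N.:+ x)) in
       N.con 3 N.:* s b N.:+ s (N.con 1 N.:+ (b N.:+ (c N.:+ c))) N.:= N.con 3 N.:* s c N.:+ s
           (N.con 1 N.:+ (c N.:+ (b N.:+ b)))) refl b c)
    (sym (form⁺-≡ c b)))

  form⁻-diagonal : ∀ b → form⁻ b b ≡ 4 * oddSquare b
  form⁻-diagonal b = trans (cong (λ i → 3 * oddSquare b + oddSquare i) (κ-diagonal b))
    (N.solve 1 (λ x → N.con 3 N.:* x N.:+ x N.:= N.con 4 N.:* x) refl (oddSquare b))

  form⁺-diagonal : ∀ b → form⁺ b b ≡ 12 * oddSquare b
  form⁺-diagonal b = trans (form⁺-≡ b b) (trans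
    (N.solve 1 (λ b → let s = λ x → (N.con 1 N.:+ (x N.:+ x)) N.:* (N.con 1 N.:+ (x N.:+ x)) in
       N.con 3 N.:* s b N.:+ s (N.con 1 N.:+ (b N.:+ (b N.:+ b))) N.:= N.con 12 N.:* s b) refl b)
    (cong (12 *_) (sym (oddSquare≡ b))))

fourth-power : ∀ f → f ^ 4 ≋ V 4 f
fourth-power f = begin
  f ^ 4                  ≈⟨ solve 1 (λ f → f :^ 4 := (f :* f) :* (f :* f)) S.refl f ⟩
  (f ⊠ f) ⊠ (f ⊠ f)      ≈⟨ frobenius (f ⊠ f) ⟩
  V 2 (f ⊠ f)            ≈⟨ V-cong 2 (frobenius f) ⟩
  V 2 (V 2 f)            ≈⟨ V-V 1 1 f ⟩
  V 4 f                  ∎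
  where open ≋-Reasoning

-- D(q)D(q³) = Σ q^(x² + 3y²) over odd x, y > 0. Substituting x = |2z - y| or x = 2z + y with z odd
-- turns the exponent into 4(y² ∓ yz + z²), which is symmetric, so only y = z survives modulo 2.
D-modular₃ : D ⊠ V 3 D ≋ (D ^ 4) ⊞ (V 3 D ^ 4)
D-modular₃ = pointwise λ n → begin
  (D ⊠ V 3 D) n
    ≡⟨ at (S.trans (S.*-comm D (V 3 D)) (S.*-congʳ (V-θ 2 oddSquares))) n ⟩
  (θ (λ b → 3 * oddSquare b) ⊠ θ oddSquare) n
    ≡⟨ θ-⊠ (scaled 2 oddSquares) oddSquares (ℕ.m<n⇒m<1+n (ℕ.n<1+n n)) ⟩
  ⨁ (2 + n) (λ b → ⨁ (2 + n) (λ a → 3 * oddSquare b + oddSquare a ≡ᵇ n))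
    -- Terms with a > n vanish, so B = n + 1; with M = n + 1 every b below n + 2 satisfies B + b ≤
    -- 2M.
    ≡⟨ ⨁-cong (2 + n) (λ b b< → odds-partition _ (suc n) (vanish n b) (ℕ.n≤1+n _) b (bound n b b<)) ⟩
  ⨁ (2 + n) (λ b → ⨁ (2 + n) (λ c → form⁺ b c ≡ᵇ n) xor ⨁ (2 + n) (λ c → form⁻ b c ≡ᵇ n))
    ≡⟨ ⨁-xor (2 + n) (λ b → ⨁ (2 + n) (λ c → form⁺ b c ≡ᵇ n)) (λ b → ⨁ (2 + n) (λ c → form⁻ b c ≡ᵇ n)) ⟩
  ⨁ (2 + n) (λ b → ⨁ (2 + n) (λ c → form⁺ b c ≡ᵇ n)) xor ⨁ (2 + n) (λ b → ⨁ (2 + n) (λ c → form⁻ b c ≡ᵇ n))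
    ≡⟨ cong₂ _xor_ (⨁-symmetric (2 + n) _ (λ b c → cong (_≡ᵇ n) (form⁺-symmetric b c)))
                   (⨁-symmetric (2 + n) _ (λ b c → cong (_≡ᵇ n) (form⁻-symmetric b c))) ⟩
  ⨁ (2 + n) (λ b → form⁺ b b ≡ᵇ n) xor ⨁ (2 + n) (λ b → form⁻ b b ≡ᵇ n)
    ≡⟨ cong₂ _xor_ (⨁-cong (2 + n) (λ b _ → cong (_≡ᵇ n) (form⁺-diagonal b)))
        (⨁-cong (2 + n) (λ b _ → cong (_≡ᵇ n) (form⁻-diagonal b))) ⟩
  ⨁ (2 + n) (λ b → 12 * oddSquare b ≡ᵇ n) xor ⨁ (2 + n) (λ b → 4 * oddSquare b ≡ᵇ n)
    ≡⟨ cong₂ _xor_ (θ-at (scaled 11 oddSquares) (ℕ.m<n⇒m<1+n (ℕ.n<1+n n)))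
        (θ-at (scaled 3 oddSquares) (ℕ.m<n⇒m<1+n (ℕ.n<1+n n))) ⟨
  θ (λ b → 12 * oddSquare b) n xor θ (λ b → 4 * oddSquare b) n
    ≡⟨ cong₂ _xor_ (at (S.trans (S.trans (fourth-power (V 3 D)) (V-V 3 2 D)) (V-θ 11 oddSquares)) n)
                   (at (S.trans (fourth-power D) (V-θ 3 oddSquares)) n) ⟨
  (V 3 D ^ 4) n xor (D ^ 4) n
    ≡⟨ Bool.xor-comm ((V 3 D ^ 4) n) ((D ^ 4) n) ⟩
  (D ^ 4) n xor (V 3 D ^ 4) n
    ≡⟨ ⊞-at (D ^ 4) (V 3 D ^ 4) n ⟨
  ((D ^ 4) ⊞ (V 3 D ^ 4)) n ∎
  where
  open ≡-Reasoning
  vanish : ∀ n b a → suc n ≤ a → (3 * oddSquare b + oddSquare a ≡ᵇ n) ≡ false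
  vanish n b a n<a = ≡ᵇ-false (ℕ.>⇒≢ (ℕ.<-≤-trans n<a (ℕ.≤-trans (grows oddSquares a)
      (ℕ.m≤n+m (oddSquare a) (3 * oddSquare b)))))
  bound : ∀ n b → b < 2 + n → suc n + b ≤ double (suc n)
  bound n b (s≤s b≤) = ℕ.≤-trans (ℕ.+-monoʳ-≤ (suc n) b≤) (ℕ.≤-reflexive (sym (double≡+ (suc n))))

-- For an odd prime ℓ, ℓn is an odd square iff n is ℓ times an odd square.
U-D : ∀ {l} → Prime (suc (double (suc l))) → U (suc (double (suc l))) D ≋ V (suc (double (suc l))) D
U-D {l} ℓ-prime = pointwise λ n → bool-ext (to n) (from n)
  where
  ℓ = suc (double (suc l))

  odd-or-even : ∀ n → ∃ λ k → (n ≡ double k) ⊎ (n ≡ suc (double k))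
  odd-or-even zero = 0 , inj₁ refl
  odd-or-even (suc n) with odd-or-even n
  ... | k , inj₁ p = k , inj₂ (cong suc p)
  ... | k , inj₂ p = suc k , inj₁ (cong suc p)

  odd≢even : ∀ a b → suc (double a) ≢ double b
  odd≢even (suc a) (suc b) e = odd≢even a b (ℕ.suc-injective (ℕ.suc-injective e))

  double-* : ∀ k m → double k * m ≡ double (k * m)
  double-* k m rewrite double≡+ k | double≡+ (k * m) = ℕ.*-distribʳ-+ m k k

  swap-square : ∀ m l → (m * l) * (m * l) ≡ m * m * l * l
  swap-square = N.solve 2 (λ m l → (m N.:* l) N.:* (m N.:* l) N.:= m N.:* m N.:* l N.:* l) refl

  ∣odd : ∀ a → ℓ ∣ suc (double a) → ∃ λ b → suc (double a) ≡ suc (double b) * ℓ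
  ∣odd a (divides k e) with odd-or-even k
  ... | b , inj₁ refl = ⊥-elim (odd≢even a (b * ℓ) (trans e (double-* b ℓ)))
  ... | b , inj₂ refl = b , e

  to : ∀ n → U ℓ D n ≡ true → V ℓ D n ≡ true
  to n t with θ-true oddSquare (n * ℓ) t
  ... | a , e with ∣odd a (reduce (euclidsLemma (suc (double a)) (suc (double a)) ℓ-prime (divides n e)))
    where
    reduce : ∀ {A : Set} → A ⊎ A → A
    reduce (inj₁ x) = x
    reduce (inj₂ x) = x
  ... | b , e′ = trans (cong (V ℓ D) n≡) (trans (V-at (double (suc l)) D (oddSquare b)) (θ-hit oddSquares b))
    where
    n≡ : n ≡ oddSquare b * ℓ
    n≡ = ℕ.*-cancelʳ-≡ n (oddSquare b * ℓ) ℓ (trans (sym e) (trans (cong (λ x → x * x) e′)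
        (swap-square (suc (double b)) ℓ)))

  from : ∀ n → V ℓ D n ≡ true → U ℓ D n ≡ true
  from n t with V-true (double (suc l)) D n t
  ... | k , refl , t′ with θ-true oddSquare k t′
  ... | b , refl with odd-product
    where
    odd-product : ∃ λ c → suc (double b) * ℓ ≡ suc (double c)
    odd-product with odd-or-even (suc (double b) * ℓ)
    ... | c , inj₂ p = c , p
    ... | c , inj₁ p = ⊥-elim (odd≢even (suc l + b * ℓ) c (trans (cong suc eq) p))
      where
      eq : double (suc l + b * ℓ) ≡ double (suc l) + double b * ℓ
      eq = trans (double≡+ (suc l + b * ℓ)) (trans (N.solve 2
          (λ x y → (x N.:+ y) N.:+ (x N.:+ y) N.:= (x N.:+ x) N.:+ (y N.:+ y)) refl (suc l) (b * ℓ))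
             (cong₂ _+_ (sym (double≡+ (suc l))) (trans (sym (double≡+ (b * ℓ))) (sym (double-* b ℓ)))))
  ... | c , p = trans (cong D (trans (sym (swap-square (suc (double b)) ℓ)) (cong (λ x → x * x) p)))
      (θ-hit oddSquares c)

-- Partition numbers modulo 2

odd : ℕ → Bool
odd zero    = false
odd (suc n) = not (odd n)

odd-+ : ∀ m n → odd (m + n) ≡ odd m xor odd n
odd-+ zero    n = refl
odd-+ (suc m) n = trans (cong not (odd-+ m n)) (sym (not-xor (odd m) (odd n)))
  where
  not-xor : ∀ a b → (not a) xor b ≡ not (a xor b)
  not-xor false b = refl
  not-xor true  b = sym (Bool.not-involutive b)

odd-* : ∀ m n → odd (m * n) ≡ odd m ∧ odd n
odd-* zero    n = refl
odd-* (suc m) n = trans (odd-+ n (m * n)) (trans (cong (odd n xor_) (odd-* m n)) (absorb (odd m) (odd n)))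
  where
  absorb : ∀ a b → b xor (a ∧ b) ≡ not a ∧ b
  absorb false b = Bool.xor-identityʳ b
  absorb true  b = Bool.xor-same b

odd-Σ≤ : ∀ n f → odd (Σ≤ n f) ≡ ⨁ (suc n) (odd ∘ f)
odd-Σ≤ zero    f = sym (Bool.xor-identityʳ (odd (f 0)))
odd-Σ≤ (suc n) f = trans (odd-+ (Σ≤ n f) (f (suc n))) (trans (cong (_xor odd (f (suc n))) (odd-Σ≤ n f))
    (Bool.xor-comm _ (odd (f (suc n)))))

⊠-convolution : ∀ f g n → (f ⊠ g) n ≡ ⨁ (suc n) (λ k → f k ∧ g (n ∸ k))
⊠-convolution f g zero    = sym (Bool.xor-identityʳ _)
⊠-convolution f g (suc n) = trans (cong ((f 0 ∧ g (suc n)) xor_) (⊠-convolution (tl f) g n))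
    (sym (⨁-head (suc n) (λ k → f k ∧ g (suc n ∸ k))))

P : Series
P n = odd (p n)

odd-pₜ : ∀ t → (λ n → odd (pₜ t n)) ≋ P ^ t
odd-pₜ zero = pointwise λ { zero → refl ; (suc n) → refl }
odd-pₜ (suc t) = S.trans (pointwise λ n → begin
    odd (Σ≤ n (λ k → p k * pₜ t (n ∸ k)))            ≡⟨ odd-Σ≤ n _ ⟩
    ⨁ (suc n) (λ k → odd (p k * pₜ t (n ∸ k)))       ≡⟨ ⨁-cong (suc n) (λ k _ → odd-* (p k) _) ⟩
    ⨁ (suc n) (λ k → P k ∧ odd (pₜ t (n ∸ k)))       ≡⟨ ⊠-convolution P _ n ⟨
    (P ⊠ (λ n → odd (pₜ t n))) n                     ∎)
  (S.*-congˡ (odd-pₜ t))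
  where open ≡-Reasoning

parts : ℕ → Series
parts k n = odd (partsUpTo k n)

private
  multiples : Series → ℕ → ℕ → ℕ → Bool
  multiples f k n j = if j * k ≤ᵇ n then f (n ∸ j * k) else false

  ≤ᵇ-false : ∀ {m n} → n < m → (m ≤ᵇ n) ≡ false
  ≤ᵇ-false {m} {n} n<m = Bool.¬-not λ e → ℕ.<⇒≱ n<m (ℕ.≤ᵇ⇒≤ m n (Equivalence.from Bool.T-≡ e))

  ≤ᵇ-+ : ∀ k m n → (k + m ≤ᵇ k + n) ≡ (m ≤ᵇ n)
  ≤ᵇ-+ k m n = bool-ext
    (λ e → Equivalence.to Bool.T-≡ (ℕ.≤⇒≤ᵇ (ℕ.+-cancelˡ-≤ k m n (ℕ.≤ᵇ⇒≤ _ _ (Equivalence.from Bool.T-≡ e)))))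
    (λ e → Equivalence.to Bool.T-≡ (ℕ.≤⇒≤ᵇ (ℕ.+-monoʳ-≤ k (ℕ.≤ᵇ⇒≤ m n (Equivalence.from Bool.T-≡ e)))))

parts-suc-at : ∀ k n → parts (suc k) n ≡ ⨁ (suc n) (multiples (parts k) (suc k) n)
parts-suc-at k n = trans (odd-Σ≤ n _) (⨁-cong (suc n) (λ j _ → push (j * suc k ≤ᵇ n) (partsUpTo k (n ∸ j * suc k))))
  where
  push : ∀ b m → odd (if b then m else 0) ≡ (if b then odd m else false)
  push true  m = refl
  push false m = refl

-- The term j = 0 of the defining sum is `parts k n`; the terms j ≥ 1 form the same sum at n - (k +
-- 1), up to terms beyond the support.
parts-suc : ∀ k → parts (suc k) ≋ parts k ⊞ (X ^ suc k) ⊠ parts (suc k)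
parts-suc k = S.sym (⊞-≋ λ n → sym (trans (parts-suc-at k n)
    (trans (⨁-head n (multiples (parts k) (suc k) n)) (cong (parts k n xor_) (rest n)))))
  where
  K = suc k
  f = multiples (parts k) K
  rest : ∀ n → ⨁ n (f n ∘ suc) ≡ ((X ^ K) ⊠ parts K) n
  rest n with K ℕ.≤? n
  ... | no K≰n = trans (⨁-support {n} {0} {f n ∘ suc} z≤n (λ j _ → cong
      (if_then parts k (n ∸ suc j * K) else false) (≤ᵇ-false (ℕ.<-≤-trans (ℕ.≰⇒> K≰n) (ℕ.m≤m+n K (j * K))))))
                   (sym (X^⊠-below K _ (ℕ.≰⇒> K≰n)))
  ... | yes K≤n = subst (λ n → ⨁ n (f n ∘ suc) ≡ ((X ^ K) ⊠ parts K) n) (ℕ.m+[n∸m]≡n K≤n) (begin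
    ⨁ (K + m) (f (K + m) ∘ suc)     ≡⟨ ⨁-cong (K + m) (λ j _ → cong₂ (λ b i → if b then parts k i else false)
        (≤ᵇ-+ K (j * K) m) (ℕ.[m+n]∸[m+o]≡n∸o K m (j * K))) ⟩
    ⨁ (K + m) (f m)                 ≡⟨ ⨁-support (s≤s (ℕ.m≤n+m m k))
        (λ j m<j → cong (if_then parts k (m ∸ j * K) else false) (≤ᵇ-false (ℕ.<-≤-trans m<j (ℕ.m≤m*n j K)))) ⟩
    ⨁ (suc m) (f m)                 ≡⟨ parts-suc-at k m ⟨
    parts K m                       ≡⟨ X^⊠-at K (parts K) m ⟨
    ((X ^ K) ⊠ parts K) (K + m)     ∎)
    where
    open ≡-Reasoning
    m = n ∸ K

1+X^ : ℕ → Series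
1+X^ k = 𝟙 ⊞ X ^ k

eulerUpTo : ℕ → Series
eulerUpTo zero    = 𝟙
eulerUpTo (suc k) = eulerUpTo k ⊠ 1+X^ (suc k)

eulerUpTo-parts : ∀ k → eulerUpTo k ⊠ parts k ≋ 𝟙
eulerUpTo-parts zero    = S.trans (S.*-identityˡ _) (pointwise λ { zero → refl ; (suc n) → refl })
eulerUpTo-parts (suc k) = begin
  eulerUpTo k ⊠ 1+X^ (suc k) ⊠ parts (suc k)                       ≈⟨ S.*-assoc _ _ _ ⟩
  eulerUpTo k ⊠ (1+X^ (suc k) ⊠ parts (suc k))                     ≈⟨ S.*-congˡ
      (S.trans (S.distribʳ _ _ _) (S.+-congʳ (S.*-identityˡ _))) ⟩
  eulerUpTo k ⊠ (parts (suc k) ⊞ (X ^ suc k) ⊠ parts (suc k))   ≈⟨ S.*-congˡ (S.+-congʳ (parts-suc k)) ⟩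
  eulerUpTo k ⊠ (parts k ⊞ (X ^ suc k) ⊠ parts (suc k) ⊞ (X ^ suc k) ⊠ parts (suc k))
    ≈⟨ solve 3 (λ f a b → f :* (a :+ b :+ b) := f :* a) S.refl (eulerUpTo k) (parts k)
        ((X ^ suc k) ⊠ parts (suc k)) ⟩
  eulerUpTo k ⊠ parts k                                         ≈⟨ eulerUpTo-parts k ⟩
  𝟙                                                       ∎
  where open ≋-Reasoning

parts-stable : ∀ j n → parts (j + n) n ≡ P n
parts-stable zero    n = refl
parts-stable (suc j) n = trans (at (parts-suc (j + n)) n) (trans
    (⊞-at-≡ (parts-stable j n) (X^⊠-below (suc (j + n)) _ (s≤s (ℕ.m≤n+m n j)))) (Bool.xor-identityʳ (P n)))

P-eulerUpTo : ∀ k → Below (suc k) (P ⊠ eulerUpTo k ⊞ 𝟙)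
P-eulerUpTo k = below-resp eq (below-⊠ˡ (eulerUpTo k) agree)
  where
  agree : Below (suc k) (P ⊞ parts k)
  agree {i} (s≤s i≤k) = trans (⊞-at-≡ refl (trans (cong (λ m → parts m i) (sym (ℕ.m∸n+n≡m i≤k)))
      (parts-stable (k ∸ i) i))) (Bool.xor-same (P i))
  eq : (P ⊞ parts k) ⊠ eulerUpTo k ≋ P ⊠ eulerUpTo k ⊞ 𝟙
  eq = S.trans (S.distribʳ _ _ _) (S.+-congˡ (S.trans (S.*-comm _ _) (eulerUpTo-parts k)))

X^-at : ∀ m i → (X ^ m) i ≡ (m ≡ᵇ i)
X^-at zero    zero    = refl
X^-at zero    (suc i) = refl
X^-at (suc m) zero    = refl
X^-at (suc m) (suc i) = trans (X⊠-suc (X ^ m) i) (X^-at m i)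

-- Triangular numbers and the Euler product

tri : ℕ → ℕ
tri zero    = 0
tri (suc n) = suc n + tri n

double-tri : ∀ n → tri n + tri n ≡ n * suc n
double-tri zero    = refl
double-tri (suc n) = trans (N.solve 2 (λ n t → (N.con 1 N.:+ n N.:+ t) N.:+ (N.con 1 N.:+ n N.:+ t) N.:= (t N.:+ t)
    N.:+ (N.con 2 N.:+ (n N.:+ n))) refl n (tri n))
  (trans (cong (_+ (2 + (n + n))) (double-tri n))
    (N.solve 1 (λ n → n N.:* (N.con 1 N.:+ n) N.:+ (N.con 2 N.:+ (n N.:+ n)) N.:= (N.con 1 N.:+ n) N.:*
        (N.con 2 N.:+ n)) refl n))

tri-double : ∀ n → tri (double n) ≡ n * suc (double n)
tri-double n rewrite double≡+ n = ℕ.*-cancelˡ-≡ _ _ 2 (trans (cong (tri (n + n) +_) (ℕ.+-identityʳ _))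
    (trans (double-tri (n + n))
  (N.solve 1 (λ n → (n N.:+ n) N.:* (N.con 1 N.:+ (n N.:+ n)) N.:= N.con 2 N.:* (n N.:* (N.con 1 N.:+ (n N.:+ n))))
      refl n)))

tri-mono : ∀ {m n} → m < n → tri m < tri n
tri-mono {m} {suc n} (s≤s m≤n) with ℕ.m≤n⇒m<n∨m≡n m≤n
... | inj₁ m<n = ℕ.<-≤-trans (tri-mono m<n) (ℕ.m≤n+m (tri n) (suc n))
... | inj₂ refl = s≤s (ℕ.m≤n+m (tri n) n)

triangular : Exponents tri
triangular = record { grows = grows′ ; injective = inj }
  where
  grows′ : ∀ a → a ≤ tri a
  grows′ zero    = z≤n
  grows′ (suc a) = ℕ.m≤m+n (suc a) (tri a)
  inj : ∀ {a b} → tri a ≡ tri b → a ≡ b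
  inj {a} {b} e with ℕ.<-cmp a b
  ... | tri≈ _ a≡b _ = a≡b
  ... | tri< a<b _ _ = ⊥-elim (ℕ.<⇒≢ (tri-mono a<b) e)
  ... | tri> _ _ b<a = ⊥-elim (ℕ.<⇒≢ (tri-mono b<a) (sym e))

ψ : Series
ψ = θ tri

private
  Ψ : ℕ → Series
  Ψ zero    = 𝟘
  Ψ (suc n) = X ^ tri n ⊞ Ψ n

  Ψ-at : ∀ N i → Ψ N i ≡ ⨁ N (λ a → tri a ≡ᵇ i)
  Ψ-at zero    i = refl
  Ψ-at (suc N) i = ⊞-at-≡ (X^-at (tri N) i) (Ψ-at N i)

  ψ-Ψ : ∀ N → Below N (ψ ⊞ Ψ N)
  ψ-Ψ N {i} i<N = trans (⊞-at-≡ (θ-at triangular i<N) (Ψ-at N i)) (Bool.xor-same (⨁ N _))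

  -- Shanks' identity with cleared denominators: O n = ∏_{i≤n} (1 + q^(2i-1)) and
  -- ev m s = ∏_{s<i≤s+m} (1 + q^(2i)).
  O : ℕ → Series
  O zero    = 𝟙
  O (suc n) = O n ⊠ 1+X^ (suc (double n))

  ev : ℕ → ℕ → Series
  ev zero    s = 𝟙
  ev (suc m) s = ev m s ⊠ 1+X^ (double (suc (m + s)))

  ev-bottom : ∀ m s → ev (suc m) s ≋ 1+X^ (double (suc s)) ⊠ ev m (suc s)
  ev-bottom zero    s = S.trans (S.*-identityˡ _) (S.sym (S.*-identityʳ _))
  ev-bottom (suc m) s = S.trans (S.*-congʳ (ev-bottom m s)) (S.trans (S.*-assoc _ _ _)
    (S.*-congˡ (S.*-congˡ (S.reflexive (cong (λ i → 1+X^ (double (suc i))) (sym (ℕ.+-suc m s)))))))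

  term : ℕ → ℕ → Series
  term n s = ev (n ∸ s) s ⊠ O s ⊠ X ^ (s * suc (double n))

  Tₛ : ℕ → ℕ → Series
  Tₛ n zero    = 𝟘
  Tₛ n (suc k) = term n k ⊞ Tₛ n k

  -- The closed form of the partial sums up to s = k in the telescoping below.
  Cₖ : ℕ → ℕ → Series
  Cₖ n k = ev (n ∸ k) k ⊠ O (suc k) ⊠ X ^ (suc k * suc (double n))

  -- The first summand on the right is `Cₖ n (s − 1)` by `ev-bottom` when s > 0, and zero when s =
  -- 0; hence the sum over s telescopes.
  term-step : ∀ n s → s ≤ n → term (suc n) s ⊞ 1+X^ (suc (double n)) ⊠ term n s ≋
              ev (n ∸ s) s ⊠ O s ⊠ 1+X^ (double s) ⊠ X ^ (s * suc (double n)) ⊞ Cₖ n s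
  term-step n s s≤n = begin
    term (suc n) s ⊞ 1+X^ d ⊠ term n s
      ≈⟨ S.+-congʳ (S.*-cong (S.*-congʳ ev-suc) exp₁) ⟩
    (e ⊠ 1+X^ (suc d)) ⊠ o ⊠ (x ⊠ (y ⊠ y)) ⊞ 1+X^ d ⊠ (e ⊠ o ⊠ x)
      ≈⟨ solve 6 (λ e o x y q w → (e :* (con true :+ q :* w)) :* o :* (x :* (y :* y)) :+ (con true :+ w) :*
          (e :* o :* x)
                 := e :* o :* (con true :+ y :* y) :* x :+ e :* (o :* (con true :+ q :* (y :* y))) :* (w :* x))
                     S.refl e o x y X (X ^ d) ⟩
    e ⊠ o ⊠ (𝟙 ⊞ y ⊠ y) ⊠ x ⊞ e ⊠ (o ⊠ (𝟙 ⊞ X ⊠ (y ⊠ y))) ⊠ ((X ^ d) ⊠ x)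
      ≈⟨ S.+-cong (S.*-congʳ (S.*-congˡ (S.+-congˡ y²))) (S.*-cong
          (S.*-congˡ (S.*-congˡ (S.+-congˡ (S.*-congˡ y²)))) (S.sym (^-homo-* X d (s * d)))) ⟩
    e ⊠ o ⊠ 1+X^ (double s) ⊠ x ⊞ Cₖ n s ∎
    where
    open ≋-Reasoning
    d = suc (double n)
    e = ev (n ∸ s) s
    o = O s
    x = X ^ (s * d)
    y = X ^ s
    y² : y ⊠ y ≋ X ^ double s
    y² = S.trans (S.sym (^-homo-* X s s)) (S.reflexive (cong (X ^_) (sym (double≡+ s))))
    ev-suc : ev (suc n ∸ s) s ≋ e ⊠ 1+X^ (suc d)
    ev-suc = S.trans (S.reflexive (cong (λ i → ev i s) (ℕ.+-∸-assoc 1 s≤n)))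
      (S.*-congˡ (S.reflexive (cong (λ i → 1+X^ (double (suc i))) (ℕ.m∸n+n≡m s≤n))))
    exp₁ : X ^ (s * suc (double (suc n))) ≋ x ⊠ (y ⊠ y)
    exp₁ = S.trans (S.reflexive (cong (X ^_) (N.solve 2 (λ s d → s N.:* (N.con 2 N.:+ d) N.:= s N.:* d N.:+
        (s N.:+ s)) refl s d)))
      (S.trans (^-homo-* X (s * d) (s + s)) (S.*-congˡ (^-homo-* X s s)))

  telescope : ∀ n k → k ≤ n → Tₛ (suc n) (suc k) ⊞ 1+X^ (suc (double n)) ⊠ Tₛ n (suc k) ≋ Cₖ n k
  telescope n zero    _   = begin
    (term (suc n) 0 ⊞ 𝟘) ⊞ 1+X^ d ⊠ (term n 0 ⊞ 𝟘)
      ≈⟨ solve 3 (λ a b c → (a :+ con false) :+ b :* (c :+ con false) := a :+ b :* c) S.refl (term (suc n) 0)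
          (1+X^ d) (term n 0) ⟩
    term (suc n) 0 ⊞ 1+X^ d ⊠ term n 0                           ≈⟨ term-step n 0 z≤n ⟩
    ev n 0 ⊠ 𝟙 ⊠ 1+X^ 0 ⊠ 𝟙 ⊞ Cₖ n 0
      ≈⟨ solve 2 (λ a b → a :* con true :* (con true :+ con true) :* con true :+ b := b) S.refl (ev n 0) (Cₖ n 0) ⟩
    Cₖ n 0                                                    ∎
    where
    open ≋-Reasoning
    d = suc (double n)
  telescope n (suc k) k<n = begin
    (term (suc n) (suc k) ⊞ Tₛ (suc n) (suc k)) ⊞ 1+X^ d ⊠ (term n (suc k) ⊞ Tₛ n (suc k))
      ≈⟨ solve 5 (λ a b c u v → (a :+ u) :+ b :* (c :+ v) := (a :+ b :* c) :+ (u :+ b :* v)) S.refl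
           (term (suc n) (suc k)) (1+X^ d) (term n (suc k)) (Tₛ (suc n) (suc k)) (Tₛ n (suc k)) ⟩
    (term (suc n) (suc k) ⊞ 1+X^ d ⊠ term n (suc k)) ⊞ (Tₛ (suc n) (suc k) ⊞ 1+X^ d ⊠ Tₛ n (suc k))
      ≈⟨ S.+-cong (term-step n (suc k) k<n) (telescope n k (ℕ.<⇒≤ k<n)) ⟩
    (ev m (suc k) ⊠ O (suc k) ⊠ 1+X^ (double (suc k)) ⊠ x ⊞ Cₖ n (suc k)) ⊞ Cₖ n k
      ≈⟨ S.+-congˡ (S.*-congʳ (S.*-congʳ ev-k)) ⟩
    (ev m (suc k) ⊠ O (suc k) ⊠ 1+X^ (double (suc k)) ⊠ x ⊞ Cₖ n (suc k)) ⊞ (1+X^ (double (suc k)) ⊠ ev m (suc k))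
        ⊠ O (suc k) ⊠ x
      ≈⟨ solve 5 (λ e o a x c → (e :* o :* a :* x :+ c) :+ (a :* e) :* o :* x := c) S.refl
           (ev m (suc k)) (O (suc k)) (1+X^ (double (suc k))) x (Cₖ n (suc k)) ⟩
    Cₖ n (suc k) ∎
    where
    open ≋-Reasoning
    d = suc (double n)
    m = n ∸ suc k
    x = X ^ (suc k * d)
    ev-k : ev (n ∸ k) k ≋ 1+X^ (double (suc k)) ⊠ ev m (suc k)
    ev-k = S.trans (S.reflexive (cong (λ i → ev i k) (sym (trans (sym (ℕ.+-∸-assoc 1 k<n)) refl)))) (ev-bottom m k)

  -- Passing from n to n + 1 adds two triangular numbers: tri(2n + 1) = (n + 1)(2n + 1) is supplied
  -- by the telescoped remainder `Cₖ n n`, and tri(2n + 2) = (n + 1)(2n + 3) by the new last term.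
  shanks : ∀ n → O n ⊠ Ψ (suc (double n)) ≋ Tₛ n (suc n)
  shanks zero    = solve 0 (con true :* (con true :+ con false) := con true :* con true :* con true :+ con false)
      S.refl
  shanks (suc n) = begin
    O (suc n) ⊠ (X ^ tri (suc (suc (double n))) ⊞ (X ^ tri (suc (double n)) ⊞ Ψ (suc (double n))))
      ≈⟨ S.*-congˡ (S.+-cong (S.reflexive (cong (X ^_) (tri-double (suc n))))
          (S.+-congʳ (S.reflexive (cong (X ^_) tri-odd)))) ⟩
    O n ⊠ 1+X^ d ⊠ (X ^ (suc n * suc (double (suc n))) ⊞ (X ^ (suc n * d) ⊞ Ψ d))
      ≈⟨ solve 5 (λ o a x y z → o :* a :* (x :+ (y :+ z)) := o :* a :* x :+ (o :* a :* y :+ a :* (o :* z))) S.refl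
           (O n) (1+X^ d) (X ^ (suc n * suc (double (suc n)))) (X ^ (suc n * d)) (Ψ d) ⟩
    O (suc n) ⊠ X ^ (suc n * suc (double (suc n))) ⊞ (O (suc n) ⊠ X ^ (suc n * d) ⊞ 1+X^ d ⊠ (O n ⊠ Ψ d))
      ≈⟨ S.+-cong first (S.+-cong second (S.*-congˡ (shanks n))) ⟩
    term (suc n) (suc n) ⊞ (Cₖ n n ⊞ 1+X^ d ⊠ Tₛ n (suc n))
      ≈⟨ S.+-congˡ (S.+-congʳ (telescope n n ℕ.≤-refl)) ⟨
    term (suc n) (suc n) ⊞ ((Tₛ (suc n) (suc n) ⊞ 1+X^ d ⊠ Tₛ n (suc n)) ⊞ 1+X^ d ⊠ Tₛ n (suc n))
      ≈⟨ solve 3 (λ a b c → a :+ ((b :+ c) :+ c) := a :+ b) S.refl (term (suc n) (suc n)) (Tₛ (suc n) (suc n))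
          (1+X^ d ⊠ Tₛ n (suc n)) ⟩
    Tₛ (suc n) (suc (suc n)) ∎
    where
    open ≋-Reasoning
    d = suc (double n)
    tri-odd : tri d ≡ suc n * d
    tri-odd = cong (d +_) (tri-double n)
    ev-0 : ∀ n → ev (n ∸ n) n ≋ 𝟙
    ev-0 n = S.reflexive (cong (λ i → ev i n) (ℕ.n∸n≡0 n))
    first : O (suc n) ⊠ X ^ (suc n * suc (double (suc n))) ≋ term (suc n) (suc n)
    first = S.*-congʳ (S.sym (S.trans (S.*-congʳ (ev-0 (suc n))) (S.*-identityˡ _)))
    second : O (suc n) ⊠ X ^ (suc n * d) ≋ Cₖ n n
    second = S.*-congʳ (S.sym (S.trans (S.*-congʳ (ev-0 n)) (S.*-identityˡ _)))

  -- Every term with s ≥ 1 is divisible by q^(2n + 1), so only the term s = 0, which is `ev n 0`, is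
  -- visible to this order.
  Tₛ-ev : ∀ n k → Below (suc (double n)) (Tₛ n (suc k) ⊞ ev n 0)
  Tₛ-ev n zero = below-resp (S.sym (S.trans (solve 1 (λ e → (e :* con true :* con true :+ con false) :+ e := con
      false) S.refl (ev n 0)) S.refl)) (λ _ → refl)
  Tₛ-ev n (suc k) = below-resp (S.sym (S.+-assoc _ _ _))
    (below-⊞ (below-⊠ʳ _ (below-weaken (ℕ.m≤n*m (suc (double n)) (suc k))
        (below (order-X^ (suc k * suc (double n)))))) (Tₛ-ev n k))

  ev-square : ∀ n → ev n 0 ≋ eulerUpTo n ⊠ eulerUpTo n
  ev-square zero    = S.sym (S.*-identityˡ _)
  ev-square (suc n) = S.trans (S.*-cong (ev-square n) A-square)
    (solve 2 (λ f a → (f :* f) :* (a :* a) := (f :* a) :* (f :* a)) S.refl (eulerUpTo n) (1+X^ (suc n)))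
    where
    A-square : 1+X^ (double (suc (n + 0))) ≋ 1+X^ (suc n) ⊠ 1+X^ (suc n)
    A-square = S.trans (S.+-congˡ (S.trans (S.reflexive (cong (X ^_)
        (trans (cong (double ∘ suc) (ℕ.+-identityʳ n)) (double≡+ (suc n))))) (^-homo-* X (suc n) (suc n))))
      (solve 1 (λ x → con true :+ x :* x := (con true :+ x) :* (con true :+ x)) S.refl (X ^ suc n))

  eulerUpTo-double : ∀ n → eulerUpTo (double n) ≋ O n ⊠ ev n 0
  eulerUpTo-double zero    = S.sym (S.*-identityˡ _)
  eulerUpTo-double (suc n) = S.trans (S.*-congʳ (S.*-congʳ (eulerUpTo-double n)))
    (S.trans (solve 4 (λ o e a b → o :* e :* a :* b := (o :* a) :* (e :* b)) S.refl (O n) (ev n 0)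
        (1+X^ (suc (double n))) (1+X^ (double (suc n))))
      (S.*-congˡ (S.*-congˡ (S.reflexive (cong (λ i → 1+X^ (double (suc i))) (sym (ℕ.+-identityʳ n)))))))

-- Gauss's product for Σ q^(n(n+1)/2), which modulo 2 is the cube of the Euler product. Let a and b
-- be the Euler product truncated at n and 2n. Multiplying `shanks` by `ev n 0` gives bψ = a⁴ up to
-- high order, while P a and P b are close to 1.
P³ψ : (P ^ 3) ⊠ ψ ≋ 𝟙
P³ψ = x+y≈0⇒x≈y (below-all (λ k → below-weaken (ℕ.n≤1+n k) (bound k)))
  where
  bound : ∀ n → Below (suc n) ((P ^ 3) ⊠ ψ ⊞ 𝟙)
  -- The difference from 1 is a combination of the three errors Pb + 1, bψ + a⁴ and (Pa + 1)⁴ = P⁴a⁴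
  -- + 1.
  bound n = below-resp (solve 4 (λ P a b ψ →
      (P :* b :+ con true) :* (P :^ 3 :* ψ) :+ ((b :* ψ :+ a :^ 4) :* P :^ 4 :+ (P :* a :+ con true) :*
          (P :* a :+ con true) :^ 3)
      := P :^ 3 :* ψ :+ con true) S.refl P a b ψ)
    (below-⊞ (below-⊠ˡ _ (below-weaken (s≤s (n≤double n)) (P-eulerUpTo (double n))))
      (below-⊞ (below-⊠ˡ _ (below-weaken (s≤s (n≤double n)) middle)) (below-⊠ˡ _ (P-eulerUpTo n))))
    where
    a = eulerUpTo n
    b = eulerUpTo (double n)
    d = suc (double n)
    middle : Below d (b ⊠ ψ ⊞ a ^ 4)
    middle = below-resp eq (below-⊞ (below-⊠ʳ b (ψ-Ψ d)) (below-⊠ʳ (ev n 0) (Tₛ-ev n n)))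
      where
      open ≋-Reasoning
      eq : b ⊠ (ψ ⊞ Ψ d) ⊞ ev n 0 ⊠ (Tₛ n (suc n) ⊞ ev n 0) ≋ b ⊠ ψ ⊞ a ^ 4
      eq = begin
        b ⊠ (ψ ⊞ Ψ d) ⊞ ev n 0 ⊠ (Tₛ n (suc n) ⊞ ev n 0)
          ≈⟨ S.+-congˡ (S.*-congˡ (S.+-congʳ (shanks n))) ⟨
        b ⊠ (ψ ⊞ Ψ d) ⊞ ev n 0 ⊠ (O n ⊠ Ψ d ⊞ ev n 0)
          ≈⟨ solve 5 (λ b ψ Ψ e o → b :* (ψ :+ Ψ) :+ e :* (o :* Ψ :+ e) := b :* ψ :+ (b :* Ψ :+ (o :* e) :* Ψ) :+ e
              :* e) S.refl b ψ (Ψ d) (ev n 0) (O n) ⟩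
        b ⊠ ψ ⊞ (b ⊠ Ψ d ⊞ (O n ⊠ ev n 0) ⊠ Ψ d) ⊞ ev n 0 ⊠ ev n 0
          ≈⟨ S.+-cong (S.+-congˡ (S.+-congˡ (S.*-congʳ (S.sym (eulerUpTo-double n)))))
              (S.*-cong (ev-square n) (ev-square n)) ⟩
        b ⊠ ψ ⊞ (b ⊠ Ψ d ⊞ b ⊠ Ψ d) ⊞ (a ⊠ a) ⊠ (a ⊠ a)
          ≈⟨ solve 3 (λ p q a → p :+ (q :+ q) :+ (a :* a) :* (a :* a) := p :+ a :^ 4) S.refl (b ⊠ ψ) (b ⊠ Ψ d) a ⟩
        b ⊠ ψ ⊞ a ^ 4 ∎

-- ∏ (1 − qⁿ) modulo 2
opaque
  euler : Series
  euler = ψ ⊠ (P ^ 2)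

  -- `euler` is the inverse of P read off from `P³ψ`, so that no infinite product has to be formed.
  euler-P : euler ⊠ P ≋ 𝟙
  euler-P = S.trans (solve 2 (λ ψ P → (ψ :* P :^ 2) :* P := P :^ 3 :* ψ) S.refl ψ P) P³ψ

  euler³ : euler ^ 3 ≋ ψ
  euler³ = begin
    euler ^ 3                                  ≈⟨ solve 2 (λ ψ P → (ψ :* P :^ 2) :^ 3 := ψ :* (P :^ 3 :* ψ) :^ 2)
        S.refl ψ P ⟩
    ψ ⊠ ((P ^ 3) ⊠ ψ) ^ 2                  ≈⟨ S.*-congˡ (^-congˡ 2 P³ψ) ⟩
    ψ ⊠ 𝟙 ^ 2                              ≈⟨ solve 1 (λ ψ → ψ :* con true :^ 2 := ψ) S.refl ψ ⟩
    ψ                                      ∎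
    where open ≋-Reasoning

D-ψ : D ≋ X ⊠ V 8 ψ
D-ψ = S.trans (pointwise λ n → ⨁-cong (suc n) (λ a _ → cong (_≡ᵇ n) (oddSquare-tri a)))
        (S.trans θ-suc (S.*-congˡ (S.sym (V-θ 7 triangular))))
  where
  oddSquare-tri : ∀ a → oddSquare a ≡ suc (8 * tri a)
  oddSquare-tri a rewrite double≡+ a = trans
    (N.solve 1 (λ a → (N.con 1 N.:+ (a N.:+ a)) N.:* (N.con 1 N.:+ (a N.:+ a)) N.:= N.con 1 N.:+ N.con 4 N.:*
        (a N.:* (N.con 1 N.:+ a))) refl a)
    (cong suc (trans (cong (4 *_) (sym (double-tri a))) (N.solve 1
        (λ t → N.con 4 N.:* (t N.:+ t) N.:= N.con 8 N.:* t) refl (tri a))))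
  θ-suc : θ (λ a → suc (8 * tri a)) ≋ X ⊠ θ (λ a → 8 * tri a)
  θ-suc = pointwise λ where
    zero    → refl
    (suc n) → trans (cong (_xor ⨁ (suc n) (λ a → 8 * tri a ≡ᵇ n)) (misses (scaled 7 triangular) (ℕ.n<1+n n)))
        (sym (X⊠-suc _ n))

uniformiser-V : ∀ k {h h⁻¹} → h ⊠ h⁻¹ ≋ 𝟙 → Uniformiser (X ⊠ V (suc k) h)
uniformiser-V k {h} {h⁻¹} e = record
  { φ = V (suc k) h ; φ⁻¹ = V (suc k) h⁻¹ ; G≋Xφ = S.refl
  ; φφ⁻¹ = S.trans (S.sym (V-⊠ k h h⁻¹)) (S.trans (V-cong (suc k) e) (V-𝟙 k))
  }

D-uniformiser : Uniformiser D
D-uniformiser = record { Uniformiser (uniformiser-V 7 (S.trans (S.*-comm ψ (P ^ 3)) P³ψ)) ; G≋Xφ = D-ψ }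

order-D : Order 1 D
order-D = Uniformiser.order-G D-uniformiser

-- η(24z) modulo 2
opaque
  g : Series
  g = X ⊠ V 24 euler

  g-def : g ≋ X ⊠ V 24 euler
  g-def = S.refl

g-uniformiser : Uniformiser g
g-uniformiser = record { Uniformiser (uniformiser-V 23 euler-P) ; G≋Xφ = g-def }

order-g : Order 1 g
order-g = Uniformiser.order-G g-uniformiser

g³ : g ^ 3 ≋ V 3 D
g³ = begin
  g ^ 3                       ≈⟨ ^-congˡ 3 g-def ⟩
  (X ⊠ V 24 euler) ^ 3            ≈⟨ ^-distrib-* X (V 24 euler) 3 ⟩
  (X ^ 3) ⊠ (V 24 euler ^ 3)      ≈⟨ S.*-congˡ (S.trans (S.sym (V-^ 23 euler 3)) (V-cong 24 euler³)) ⟩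
  (X ^ 3) ⊠ V 24 ψ            ≈⟨ S.*-congˡ (V-V 2 7 ψ) ⟨
  (X ^ 3) ⊠ V 3 (V 8 ψ)       ≈⟨ V-X⊠ 2 (V 8 ψ) ⟨
  V 3 (X ⊠ V 8 ψ)             ≈⟨ V-cong 3 D-ψ ⟨
  V 3 D                       ∎
  where open ≋-Reasoning

-- Euler's pentagonal number theorem modulo 2: adding the degree-3 equations for (D(q), D(q³)) and (D(q³), D(q⁹))
-- shows that D(q) + D(q⁹) is a cube root of D(q³).
g-theta : g ≋ D ⊞ V 9 D
g-theta = cube-injective order-g order-γ (S.trans g³ (S.sym γ³))
  where
  γ = D ⊞ V 9 D
  order-γ : Order 1 γ
  order-γ = order-⊞ order-D (below-weaken (s≤s (s≤s z≤n)) (below (order-V 8 order-D)))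
  D₃₉ : V 3 D ⊠ V 9 D ≋ V 3 D ^ 4 ⊞ V 9 D ^ 4
  D₃₉ = begin
    V 3 D ⊠ V 9 D                        ≈⟨ S.*-congˡ (V-V 2 2 D) ⟨
    V 3 D ⊠ V 3 (V 3 D)                  ≈⟨ V-⊠ 2 D (V 3 D) ⟨
    V 3 (D ⊠ V 3 D)                      ≈⟨ V-cong 3 D-modular₃ ⟩
    V 3 (D ^ 4 ⊞ V 3 D ^ 4)              ≈⟨ V-⊞ 3 (D ^ 4) (V 3 D ^ 4) ⟩
    V 3 (D ^ 4) ⊞ V 3 (V 3 D ^ 4)        ≈⟨ S.+-cong (V-^ 2 D 4)
        (S.trans (V-^ 2 (V 3 D) 4) (^-congˡ 4 (V-V 2 2 D))) ⟩
    V 3 D ^ 4 ⊞ V 9 D ^ 4                ∎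
    where open ≋-Reasoning
  γ³ : γ ^ 3 ≋ V 3 D
  γ³ = order⇒⊠-cancelˡ order-γ (begin
    γ ⊠ γ ^ 3                                            ≈⟨ solve 3
        (λ a b c → (a :+ c) :* (a :+ c) :^ 3 := (a :^ 4 :+ b :^ 4) :+ (b :^ 4 :+ c :^ 4)) S.refl D (V 3 D) (V 9 D) ⟩
    (D ^ 4 ⊞ V 3 D ^ 4) ⊞ (V 3 D ^ 4 ⊞ V 9 D ^ 4)        ≈⟨ S.+-cong D-modular₃ D₃₉ ⟨
    D ⊠ V 3 D ⊞ V 3 D ⊠ V 9 D                            ≈⟨ solve 3 (λ a b c → a :* b :+ b :* c := (a :+ c) :* b)
        S.refl D (V 3 D) (V 9 D) ⟩
    γ ⊠ V 3 D                                            ∎)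
    where open ≋-Reasoning

-- This comes from the parametrisation of degree 3. That the right-hand side is a cube is what
-- allows the cube root taken in `g-modular₅`.
D-modular₅ : D ⊠ V 5 D ≋ (D ^ 2 ⊞ V 5 D ^ 2) ^ 3
D-modular₅ = x+y≈0⇒x≈y (S.trans
  (solve 2 (λ x y → x :* y :+ (x :^ 2 :+ y :^ 2) :^ 3
     := x :^ 6 :* y :^ 0 :+ (x :^ 4 :* y :^ 2 :+ (x :^ 2 :* y :^ 4 :+
         (x :^ 1 :* y :^ 1 :+ (x :^ 0 :* y :^ 6 :+ con false))))) S.refl D (V 5 D))
  (modular-equation order-D (parametrise₃ D-uniformiser D-modular₃)
    ((6 , 0) ∷ (4 , 2) ∷ (2 , 4) ∷ (1 , 1) ∷ (0 , 6) ∷ [])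
    (6 , 0) ((5 , 5) ∷ (5 , 1) ∷ (4 , 2) ∷ (2 , 4) ∷ (1 , 5) ∷ (1 , 1) ∷ (0 , 6) ∷ []) refl))

-- Since g³ = D(q³), the equation for D with q replaced by q³ is the cube of this one.
g-modular₅ : g ⊠ V 5 g ≋ g ^ 6 ⊞ V 5 g ^ 6
g-modular₅ = cube-injective {6} (order-⊠ order-g order-h)
  (order-⊞ (order-^ order-g 6) (below-weaken (ℕ.m≤m+n 7 23) (below (order-^ order-h 6)))) (begin
  (g ⊠ h) ^ 3                                   ≈⟨ ^-distrib-* g h 3 ⟩
  g ^ 3 ⊠ h ^ 3                                 ≈⟨ S.*-cong g³ h³ ⟩
  V 3 D ⊠ V 3 (V 5 D)                           ≈⟨ V-⊠ 2 D (V 5 D) ⟨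
  V 3 (D ⊠ V 5 D)                               ≈⟨ V-cong 3 D-modular₅ ⟩
  V 3 ((D ^ 2 ⊞ V 5 D ^ 2) ^ 3)                 ≈⟨ V-^ 2 (D ^ 2 ⊞ V 5 D ^ 2) 3 ⟩
  V 3 (D ^ 2 ⊞ V 5 D ^ 2) ^ 3                   ≈⟨ ^-congˡ 3
      (S.trans (V-⊞ 3 (D ^ 2) (V 5 D ^ 2)) (S.+-cong (V-^ 2 D 2) (V-^ 2 (V 5 D) 2))) ⟩
  (V 3 D ^ 2 ⊞ V 3 (V 5 D) ^ 2) ^ 3             ≈⟨ ^-congˡ 3 (S.+-cong (^-congˡ 2 g³) (^-congˡ 2 h³)) ⟨
  ((g ^ 3) ^ 2 ⊞ (h ^ 3) ^ 2) ^ 3               ≈⟨ ^-congˡ 3 (S.+-cong (^-assocʳ g 3 2) (^-assocʳ h 3 2)) ⟩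
  (g ^ 6 ⊞ h ^ 6) ^ 3                           ∎)
  where
  open ≋-Reasoning
  h = V 5 g
  order-h : Order 5 h
  order-h = order-V 4 order-g
  h³ : h ^ 3 ≋ V 3 (V 5 D)
  h³ = S.trans (S.sym (V-^ 4 g 3)) (S.trans (V-cong 5 g³) (V-comm 4 2 D))

g-parametrised : Parametrised 5 g
g-parametrised = parametrise₅ g-uniformiser g-modular₅

-- Modular equations of degree 7 to 23 for g

F₇ : Poly
F₇ = (8 , 0) ∷ (4 , 4) ∷ (1 , 1) ∷ (0 , 8) ∷ []

-- The polynomial listed last is the relation between r(q) and r(q^ℓ): when E = 0, its product with
-- the nonzero series `Q*` vanishes. The numerators of E(q) and of E(q^p) both vanish at these two
-- series, which is why it is to be looked for as a common factor.
g-modular₇ : eval g (V 7 g) F₇ ≋ 𝟘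
g-modular₇ = modular-equation order-g g-parametrised F₇ (8 , 0) (
  (7 , 7) ∷ (7 , 1) ∷ (6 , 2) ∷ (2 , 6) ∷ (1 , 7) ∷ (1 , 1) ∷ (0 , 8) ∷ []) refl

F₁₁ : Poly
F₁₁ = (12 , 0) ∷ (3 , 3) ∷ (1 , 1) ∷ (0 , 12) ∷ []

g-modular₁₁ : eval g (V 11 g) F₁₁ ≋ 𝟘
g-modular₁₁ = modular-equation order-g g-parametrised F₁₁ (12 , 0) (
  (11 , 11) ∷ (11 , 5) ∷ (10 , 10) ∷ (9 , 9) ∷ (9 , 3) ∷ (7 , 7) ∷ (7 , 1) ∷ (6 , 6) ∷ (5 , 11) ∷ (5 , 5) ∷
  (3 , 9) ∷ (3 , 3) ∷ (2 , 2) ∷ (1 , 7) ∷ (1 , 1) ∷ (0 , 12) ∷ []) refl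

F₁₃ : Poly
F₁₃ = (14 , 0) ∷ (12 , 2) ∷ (2 , 12) ∷ (1 , 1) ∷ (0 , 14) ∷ []

g-modular₁₃ : eval g (V 13 g) F₁₃ ≋ 𝟘
g-modular₁₃ = modular-equation order-g g-parametrised F₁₃ (14 , 0) (
  (13 , 13) ∷ (13 , 7) ∷ (10 , 4) ∷ (8 , 6) ∷ (7 , 13) ∷ (7 , 1) ∷ (6 , 8) ∷ (4 , 10) ∷ (1 , 7) ∷ (1 , 1) ∷
  (0 , 14) ∷ []) refl

F₁₇ : Poly
F₁₇ = (18 , 0) ∷ (12 , 6) ∷ (8 , 2) ∷ (6 , 12) ∷ (2 , 8) ∷ (1 , 1) ∷ (0 , 18) ∷ []

g-modular₁₇ : eval g (V 17 g) F₁₇ ≋ 𝟘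
g-modular₁₇ = modular-equation order-g g-parametrised F₁₇ (18 , 0) (
  (17 , 17) ∷ (17 , 11) ∷ (16 , 10) ∷ (15 , 15) ∷ (15 , 9) ∷ (14 , 8) ∷ (12 , 6) ∷ (11 , 17) ∷ (11 , 11) ∷
  (10 , 16) ∷ (10 , 4) ∷ (9 , 15) ∷ (9 , 3) ∷ (8 , 14) ∷ (8 , 2) ∷ (7 , 7) ∷ (7 , 1) ∷ (6 , 12) ∷ (4 , 10) ∷
  (3 , 9) ∷ (3 , 3) ∷ (2 , 8) ∷ (1 , 7) ∷ (1 , 1) ∷ (0 , 18) ∷ []) refl

F₁₉ : Poly
F₁₉ = (20 , 0) ∷ (12 , 8) ∷ (11 , 3) ∷ (8 , 12) ∷ (6 , 2) ∷ (3 , 11) ∷ (2 , 6) ∷ (1 , 1) ∷ (0 , 20) ∷ []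

g-modular₁₉ : eval g (V 19 g) F₁₉ ≋ 𝟘
g-modular₁₉ = modular-equation order-g g-parametrised F₁₉ (20 , 0) (
  (19 , 19) ∷ (19 , 13) ∷ (19 , 7) ∷ (19 , 1) ∷ (18 , 14) ∷ (18 , 2) ∷ (16 , 4) ∷ (14 , 18) ∷ (14 , 6) ∷
  (13 , 19) ∷ (13 , 13) ∷ (13 , 7) ∷ (13 , 1) ∷ (12 , 8) ∷ (8 , 12) ∷ (7 , 19) ∷ (7 , 13) ∷ (7 , 7) ∷
  (7 , 1) ∷ (6 , 14) ∷ (6 , 2) ∷ (4 , 16) ∷ (2 , 18) ∷ (2 , 6) ∷ (1 , 19) ∷ (1 , 13) ∷ (1 , 7) ∷ (1 , 1) ∷
  (0 , 20) ∷ []) refl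

F₂₃ : Poly
F₂₃ = (24 , 0) ∷ (6 , 6) ∷ (3 , 3) ∷ (2 , 2) ∷ (1 , 1) ∷ (0 , 24) ∷ []

g-modular₂₃ : eval g (V 23 g) F₂₃ ≋ 𝟘
g-modular₂₃ = modular-equation order-g g-parametrised F₂₃ (24 , 0) (
  (23 , 23) ∷ (23 , 17) ∷ (23 , 11) ∷ (23 , 5) ∷ (21 , 21) ∷ (21 , 15) ∷ (19 , 19) ∷ (19 , 13) ∷ (19 , 7) ∷
  (19 , 1) ∷ (17 , 23) ∷ (17 , 17) ∷ (17 , 11) ∷ (17 , 5) ∷ (15 , 21) ∷ (15 , 15) ∷ (13 , 19) ∷ (13 , 13) ∷
  (13 , 7) ∷ (13 , 1) ∷ (11 , 23) ∷ (11 , 17) ∷ (11 , 11) ∷ (11 , 5) ∷ (9 , 9) ∷ (9 , 3) ∷ (7 , 19) ∷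
  (7 , 13) ∷ (7 , 7) ∷ (7 , 1) ∷ (5 , 23) ∷ (5 , 17) ∷ (5 , 11) ∷ (5 , 5) ∷ (3 , 9) ∷ (3 , 3) ∷ (1 , 19) ∷
  (1 , 13) ∷ (1 , 7) ∷ (1 , 1) ∷ (0 , 24) ∷ []) refl

-- Hecke operators

U-⊞ : ∀ l f g → U l (f ⊞ g) ≋ U l f ⊞ U l g
U-⊞ l f g = pointwise λ n → trans (⊞-at f g (n * l)) (sym (⊞-at (U l f) (U l g) n))

U-𝟙 : ∀ l → U (suc l) 𝟙 ≋ 𝟙
U-𝟙 l = pointwise λ { zero → refl ; (suc n) → refl }

U-X^⊠ : ∀ l k f → U (suc l) ((X ^ (suc l * k)) ⊠ f) ≋ (X ^ k) ⊠ U (suc l) f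
U-X^⊠ l k f = S.trans (U-cong (suc l) (S.*-congʳ (S.sym (S.trans (V-^ l X k)
    (S.trans (^-congˡ k (V-X l)) (^-assocʳ X (suc l) k))))))
  (U-V-⊠ l (X ^ k) f)

⊞-𝟘 : ∀ {x y} → x ≋ 𝟘 → y ≋ 𝟘 → x ⊞ y ≋ 𝟘
⊞-𝟘 p q = S.trans (S.+-cong p q) (S.+-identityˡ 𝟘)

⊠-𝟘 : ∀ c {x} → x ≋ 𝟘 → c ⊠ x ≋ 𝟘
⊠-𝟘 c p = S.trans (S.*-congˡ p) (S.zeroʳ c)

-- With t k and t⁻ k the images of Gᵏ and (Gᵏ)⁻¹ under T = U + V, the latter multiplied by q^(ℓk),
-- a relation F(G(q), G(q^ℓ)) = 0 gives a linear recurrence for T(Gᵏ), k ∈ ℤ.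
module Hecke {G : Series} (uniformiser : Uniformiser G) (l″ : ℕ) (odd-ℓ : Coprime 2 (suc (suc l″))) where

  open Uniformiser uniformiser public

  private
    l′ : ℕ
    l′ = suc l″

  l : ℕ
  l = suc l′

  private
    -- This is ℓ² - 1. As G⁻ᵏ = q⁻ᵏφ⁻ᵏ, multiplying U(G⁻ᵏ) by q^(ℓk) puts q^(ℓ²k - k) in front of
    -- φ⁻ᵏ under `U`.
    e : ℕ
    e = l′ + l′ * suc l′

  H Q : Series
  H = V l G
  Q = X ^ l

  t t⁻ : ℕ → Series
  t k = U l (G ^ k) ⊞ H ^ k
  t⁻ k = U l ((X ^ (e * k)) ⊠ φ⁻¹ ^ k) ⊞ V l φ⁻¹ ^ k

  G-φ⁻¹ : G ⊠ φ⁻¹ ≋ X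
  G-φ⁻¹ = S.trans (S.*-congʳ G≋Xφ) (S.trans (S.*-assoc _ _ _) (S.trans (S.*-congˡ φφ⁻¹) (S.*-identityʳ X)))

  H-φ⁻¹ : H ⊠ V l φ⁻¹ ≋ Q
  H-φ⁻¹ = S.trans (S.sym (V-⊠ l′ G φ⁻¹)) (S.trans (V-cong l G-φ⁻¹) (V-X l′))

  -- The second variable of F is taken umbrally: its b-th power is replaced by `w b`.
  combine : (ℕ → Series) → Poly → Series
  combine w []            = 𝟘
  combine w ((a , b) ∷ F) = (G ^ a) ⊠ w b ⊞ combine w F

  combine-cong : ∀ {v w} → (∀ b → v b ≋ w b) → ∀ F → combine v F ≋ combine w F
  combine-cong p []            = S.refl
  combine-cong p ((a , b) ∷ F) = S.+-cong (S.*-congˡ (p b)) (combine-cong p F)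

  private
    Wg : Series → Series → ℕ → Series
    Wg K L b = U l (K ⊠ G ^ b) ⊞ L ⊠ H ^ b

    -- Formally, the solutions y of F(G, y) = 0 are G(q^ℓ) and the series G(ζ q^(1/ℓ)) with ζ^ℓ = 1,
    -- and summing over the latter is `U`, as ℓ is odd. So T(Gᵏ) is a power sum of the roots and the
    -- recurrence is Newton's. In the proof, Gᵃ passes under `U` as Hᵃ by the projection formula, so
    -- the `U` half sees F(H, G) and the other half F(G, H).
    combine-Wg : ∀ K L F → combine (Wg K L) F ≋ U l (K ⊠ eval H G F) ⊞ L ⊠ eval G H F
    combine-Wg K L [] = S.sym (⊞-𝟘 (S.trans (U-cong l (S.zeroʳ K)) (pointwise λ _ → refl)) (S.zeroʳ L))
    combine-Wg K L ((a , b) ∷ F) = begin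
      (G ^ a) ⊠ (U l (K ⊠ G ^ b) ⊞ L ⊠ H ^ b) ⊞ combine (Wg K L) F
        ≈⟨ S.+-cong (S.distribˡ _ _ _) (combine-Wg K L F) ⟩
      ((G ^ a) ⊠ U l (K ⊠ G ^ b) ⊞ (G ^ a) ⊠ (L ⊠ H ^ b)) ⊞ (U l (K ⊠ eval H G F) ⊞ L ⊠ eval G H F)
        ≈⟨ S.+-congʳ (S.+-congʳ (S.trans (S.sym (U-V-⊠ l′ (G ^ a) _)) (U-cong l
             (S.trans (S.*-congʳ (V-^ l′ G a)) (solve 3 (λ h k g → h :* (k :* g) := k :* (h :* g)) S.refl (H ^ a) K
                 (G ^ b)))))) ⟩
      (U l (K ⊠ (H ^ a ⊠ G ^ b)) ⊞ (G ^ a) ⊠ (L ⊠ H ^ b)) ⊞ (U l (K ⊠ eval H G F) ⊞ L ⊠ eval G H F)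
        ≈⟨ solve 6 (λ u g m h v n → (u :+ g :* (m :* h)) :+ (v :+ m :* n) := (u :+ v) :+ m :* (g :* h :+ n)) S.refl
             (U l (K ⊠ (H ^ a ⊠ G ^ b))) (G ^ a) L (H ^ b) (U l (K ⊠ eval H G F)) (eval G H F) ⟩
      (U l (K ⊠ (H ^ a ⊠ G ^ b)) ⊞ U l (K ⊠ eval H G F)) ⊞ L ⊠ eval G H ((a , b) ∷ F)
        ≈⟨ S.+-congʳ (S.trans (S.sym (U-⊞ l _ _)) (U-cong l (S.sym (S.distribˡ K _ _)))) ⟩
      U l (K ⊠ eval H G ((a , b) ∷ F)) ⊞ L ⊠ eval G H ((a , b) ∷ F) ∎
      where open ≋-Reasoning

  module Recurrence (F : Poly) (F-GH : eval G H F ≋ 𝟘) (F-HG : eval H G F ≋ 𝟘) where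

    private
      vanishing : ∀ K L → combine (Wg K L) F ≋ 𝟘
      vanishing K L = S.trans (combine-Wg K L F)
        (⊞-𝟘 (S.trans (U-cong l (⊠-𝟘 K F-HG)) (pointwise λ _ → refl)) (⊠-𝟘 L F-GH))

    recurrence⁺ : ∀ m → combine (λ b → t (m + b)) F ≋ 𝟘
    recurrence⁺ m = S.trans (combine-cong (λ b → S.+-cong (U-cong l (^-homo-* G m b)) (^-homo-* H m b)) F)
        (vanishing (G ^ m) (H ^ m))

    -- The term at the integer k - M, in the normalisation of `t` when k ≥ M and of `t⁻` otherwise.
    t[_-_] : ℕ → ℕ → Series
    t[ k     - zero  ] = t k
    t[ zero  - suc M ] = t⁻ (suc M)
    t[ suc k - suc M ] = t[ k - M ]

    private
      Wg⁻ : ℕ → ℕ → Series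
      Wg⁻ M b = Wg ((X ^ (e * M)) ⊠ φ⁻¹ ^ M) (V l φ⁻¹ ^ M) b

      negative : ∀ b c → Wg⁻ (b + c) b ≋ Q ^ b ⊠ t⁻ c
      negative b c = S.trans (S.+-cong upper lower) (S.sym (S.distribˡ _ _ _))
        where
        open ≋-Reasoning
        exponent : e * (b + c) + b ≡ l * (l * b) + e * c
        exponent = N.solve 3 (λ m b c → let l = N.con 1 N.:+ m ; e = m N.:+ m N.:* l in
            e N.:* (b N.:+ c) N.:+ b N.:= l N.:* (l N.:* b) N.:+ e N.:* c) refl l′ b c
        upper : U l ((X ^ (e * (b + c))) ⊠ φ⁻¹ ^ (b + c) ⊠ G ^ b) ≋ Q ^ b ⊠ U l ((X ^ (e * c)) ⊠ φ⁻¹ ^ c)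
        upper = begin
          U l ((X ^ (e * (b + c))) ⊠ φ⁻¹ ^ (b + c) ⊠ G ^ b)
            ≈⟨ U-cong l (S.*-congʳ (S.*-congˡ (^-homo-* φ⁻¹ b c))) ⟩
          U l ((X ^ (e * (b + c))) ⊠ (φ⁻¹ ^ b ⊠ φ⁻¹ ^ c) ⊠ G ^ b)
            ≈⟨ U-cong l (solve 4 (λ x p q g → x :* (p :* q) :* g := x :* (g :* p) :* q) S.refl (X ^ (e * (b + c)))
                (φ⁻¹ ^ b) (φ⁻¹ ^ c) (G ^ b)) ⟩
          U l ((X ^ (e * (b + c))) ⊠ (G ^ b ⊠ φ⁻¹ ^ b) ⊠ φ⁻¹ ^ c)
            ≈⟨ U-cong l (S.*-congʳ (S.*-congˡ (S.trans (S.sym (^-distrib-* G φ⁻¹ b)) (^-congˡ b G-φ⁻¹)))) ⟩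
          U l ((X ^ (e * (b + c))) ⊠ (X ^ b) ⊠ φ⁻¹ ^ c)
            ≈⟨ U-cong l (S.*-congʳ (S.trans (S.sym (^-homo-* X (e * (b + c)) b))
                (S.trans (S.reflexive (cong (X ^_) exponent)) (^-homo-* X (l * (l * b)) (e * c))))) ⟩
          U l ((X ^ (l * (l * b))) ⊠ (X ^ (e * c)) ⊠ φ⁻¹ ^ c)
            ≈⟨ S.trans (U-cong l (S.*-assoc _ _ _)) (U-X^⊠ l′ (l * b) _) ⟩
          (X ^ (l * b)) ⊠ U l ((X ^ (e * c)) ⊠ φ⁻¹ ^ c)
            ≈⟨ S.*-congʳ (^-assocʳ X l b) ⟨
          Q ^ b ⊠ U l ((X ^ (e * c)) ⊠ φ⁻¹ ^ c) ∎
        lower : V l φ⁻¹ ^ (b + c) ⊠ H ^ b ≋ Q ^ b ⊠ V l φ⁻¹ ^ c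
        lower = begin
          V l φ⁻¹ ^ (b + c) ⊠ H ^ b                       ≈⟨ S.*-congʳ (^-homo-* (V l φ⁻¹) b c) ⟩
          V l φ⁻¹ ^ b ⊠ V l φ⁻¹ ^ c ⊠ H ^ b               ≈⟨ solve 3 (λ p q h → p :* q :* h := (h :* p) :* q)
              S.refl (V l φ⁻¹ ^ b) (V l φ⁻¹ ^ c) (H ^ b) ⟩
          H ^ b ⊠ V l φ⁻¹ ^ b ⊠ V l φ⁻¹ ^ c               ≈⟨ S.*-congʳ
              (S.trans (S.sym (^-distrib-* H (V l φ⁻¹) b)) (^-congˡ b H-φ⁻¹)) ⟩
          Q ^ b ⊠ V l φ⁻¹ ^ c                             ∎

      positive : ∀ M k → Wg⁻ M (M + k) ≋ Q ^ M ⊠ t k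
      positive M k = S.trans (S.+-cong upper lower) (S.sym (S.distribˡ _ _ _))
        where
        open ≋-Reasoning
        exponent : e * M + M ≡ l * (l * M)
        exponent = N.solve 2 (λ m b → let l = N.con 1 N.:+ m ; e = m N.:+ m N.:* l in
            e N.:* b N.:+ b N.:= l N.:* (l N.:* b)) refl l′ M
        upper : U l ((X ^ (e * M)) ⊠ φ⁻¹ ^ M ⊠ G ^ (M + k)) ≋ Q ^ M ⊠ U l (G ^ k)
        upper = begin
          U l ((X ^ (e * M)) ⊠ φ⁻¹ ^ M ⊠ G ^ (M + k))
            ≈⟨ U-cong l (S.*-congˡ (^-homo-* G M k)) ⟩
          U l ((X ^ (e * M)) ⊠ φ⁻¹ ^ M ⊠ (G ^ M ⊠ G ^ k))
            ≈⟨ U-cong l (solve 4 (λ x p g h → x :* p :* (g :* h) := x :* (g :* p) :* h) S.refl (X ^ (e * M))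
                (φ⁻¹ ^ M) (G ^ M) (G ^ k)) ⟩
          U l ((X ^ (e * M)) ⊠ (G ^ M ⊠ φ⁻¹ ^ M) ⊠ G ^ k)
            ≈⟨ U-cong l (S.*-congʳ (S.*-congˡ (S.trans (S.sym (^-distrib-* G φ⁻¹ M)) (^-congˡ M G-φ⁻¹)))) ⟩
          U l ((X ^ (e * M)) ⊠ (X ^ M) ⊠ G ^ k)
            ≈⟨ U-cong l (S.*-congʳ (S.trans (S.sym (^-homo-* X (e * M) M)) (S.reflexive (cong (X ^_) exponent)))) ⟩
          U l ((X ^ (l * (l * M))) ⊠ G ^ k)
            ≈⟨ U-X^⊠ l′ (l * M) _ ⟩
          (X ^ (l * M)) ⊠ U l (G ^ k)
            ≈⟨ S.*-congʳ (^-assocʳ X l M) ⟨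
          Q ^ M ⊠ U l (G ^ k) ∎
        lower : V l φ⁻¹ ^ M ⊠ H ^ (M + k) ≋ Q ^ M ⊠ H ^ k
        lower = begin
          V l φ⁻¹ ^ M ⊠ H ^ (M + k)             ≈⟨ S.*-congˡ (^-homo-* H M k) ⟩
          V l φ⁻¹ ^ M ⊠ (H ^ M ⊠ H ^ k)         ≈⟨ solve 3 (λ p h k → p :* (h :* k) := (h :* p) :* k) S.refl
              (V l φ⁻¹ ^ M) (H ^ M) (H ^ k) ⟩
          H ^ M ⊠ V l φ⁻¹ ^ M ⊠ H ^ k           ≈⟨ S.*-congʳ
              (S.trans (S.sym (^-distrib-* H (V l φ⁻¹) M)) (^-congˡ M H-φ⁻¹)) ⟩
          Q ^ M ⊠ H ^ k                         ∎

      t-below : ∀ b c → t[ b - suc (b + c) ] ≡ t⁻ (suc c)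
      t-below zero    c = refl
      t-below (suc b) c = t-below b c

      t-above : ∀ M k → t[ M + k - M ] ≡ t k
      t-above zero    k = refl
      t-above (suc M) k = t-above M k

      Wg⁻-t : ∀ M b → Wg⁻ M b ≋ Q ^ (b ⊓ M) ⊠ t[ b - M ]
      Wg⁻-t M b with M ℕ.≤? b
      ... | yes M≤b with b ∸ M | ℕ.m+[n∸m]≡n M≤b
      ...   | k | refl = S.trans (positive M k) (S.reflexive
          (cong₂ (λ i s → Q ^ i ⊠ s) (sym (ℕ.m≥n⇒m⊓n≡n M≤b)) (sym (t-above M k))))
      Wg⁻-t M b | no M≰b with M ∸ suc b | ℕ.m+[n∸m]≡n (ℕ.≰⇒> M≰b)
      ...   | c | refl = S.trans (S.trans (S.reflexive (cong (λ i → Wg⁻ i b) (sym (ℕ.+-suc b c))))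
          (negative b (suc c)))
                (S.reflexive (cong₂ (λ i s → Q ^ i ⊠ s) (sym (ℕ.m≤n⇒m⊓n≡m (ℕ.m≤n⇒m≤1+n (ℕ.m≤m+n b c))))
                    (sym (t-below b c))))

    -- The recurrence shifted by -M and multiplied by `Q ^ M`. For b < M the factor Q^(M - b) is
    -- absorbed into t⁻ (M - b) and Q^b remains, hence the minimum.
    recurrence⁻ : ∀ M → combine (λ b → Q ^ (b ⊓ M) ⊠ t[ b - M ]) F ≋ 𝟘
    recurrence⁻ M = S.trans (combine-cong (λ b → S.sym (Wg⁻-t M b)) F) (vanishing _ _)

  private
    square-⊞ : ∀ a b → a ⊠ a ⊞ b ⊠ b ≋ (a ⊞ b) ⊠ (a ⊞ b)
    square-⊞ = solve 2 (λ a b → a :* a :+ b :* b := (a :+ b) :* (a :+ b)) S.refl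

    U-square : ∀ a → U l (a ⊠ a) ≋ U l a ⊠ U l a
    U-square a = S.trans (U-cong l (frobenius a)) (S.trans (U-V-coprime l 1 a odd-ℓ) (S.sym (frobenius (U l a))))

  t-double : ∀ k → t (k + k) ≋ t k ⊠ t k
  t-double k = S.trans (S.+-cong (S.trans (U-cong l (^-homo-* G k k)) (U-square (G ^ k))) (^-homo-* H k k))
      (square-⊞ _ _)

  t⁻-double : ∀ k → t⁻ (k + k) ≋ t⁻ k ⊠ t⁻ k
  t⁻-double k = S.trans (S.+-cong (S.trans (U-cong l eq) (U-square _)) (^-homo-* (V l φ⁻¹) k k)) (square-⊞ _ _)
    where
    eq : (X ^ (e * (k + k))) ⊠ φ⁻¹ ^ (k + k) ≋ ((X ^ (e * k)) ⊠ φ⁻¹ ^ k) ⊠ ((X ^ (e * k)) ⊠ φ⁻¹ ^ k)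
    eq = S.trans (S.*-cong (S.trans (S.reflexive (cong (X ^_) (ℕ.*-distribˡ-+ e k k)))
        (^-homo-* X (e * k) (e * k))) (^-homo-* φ⁻¹ k k))
      (solve 2 (λ x p → (x :* x) :* (p :* p) := (x :* p) :* (x :* p)) S.refl (X ^ (e * k)) (φ⁻¹ ^ k))

  t-double-𝟘 : ∀ k → t k ≋ 𝟘 → t (k + k) ≋ 𝟘
  t-double-𝟘 k z = S.trans (t-double k) (⊠-𝟘 _ z)

  t-half-𝟘 : ∀ k → t (k + k) ≋ 𝟘 → t k ≋ 𝟘
  t-half-𝟘 k z = square-zero (S.trans (S.sym (t-double k)) z)

  t₀ : t 0 ≋ 𝟘
  t₀ = S.trans (S.+-congʳ (U-𝟙 l′)) (⊞-self 𝟙)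

  order-H : Order l H
  order-H = subst (λ i → Order i H) (ℕ.*-identityʳ l) (order-V l′ order-G)

  t-below : ∀ k → Below 1 (t (suc k))
  t-below k {zero} _ = ⊞-at-≡ (below (order-^ order-G (suc k)) (s≤s z≤n))
      (below (order-^ order-H (suc k)) (s≤s z≤n))
  t-below k {suc i} (s≤s ())

  order-φ⁻¹ : Order 0 φ⁻¹
  order-φ⁻¹ = order (λ ()) (go (φ 0) (at φφ⁻¹ 0))
    where
    go : ∀ b {c} → b ∧ c ≡ true → c ≡ true
    go true p = p

  -- The constant term comes from the `V` half, since the `U` half contains a positive power of q.
  -- This is what discards the root 0 of the quadratic equation for t⁻ 1.
  order-t⁻ : ∀ k → Order 0 (t⁻ (suc k))
  order-t⁻ k = order (λ ()) (⊞-at-≡ {f = U l ((X ^ (e * suc k)) ⊠ φ⁻¹ ^ suc k)} {g = V l φ⁻¹ ^ suc k}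
    (X^⊠-below (e * suc k) (φ⁻¹ ^ suc k) (s≤s z≤n))
    (lead (order-^ {0} {V l φ⁻¹} (order (λ ()) (lead order-φ⁻¹)) (suc k))))

  t⁻-determined : ∀ n {s} → G ^ n ⊠ s ≋ X ^ n → s ≋ φ⁻¹ ^ n
  t⁻-determined n h = order⇒⊠-cancelˡ (order-^ order-G n)
    (S.trans h (S.trans (^-congˡ n (S.sym G-φ⁻¹)) (^-distrib-* G φ⁻¹ n)))

-- The premise `symmetric` says, by computation, that F(x, y) + F(y, x) is the empty sum.
eval-swap : ∀ F → foldr (λ m → addₚ (swap m ∷ [])) F F ≡ [] → ∀ {x y} → eval x y F ≋ 𝟘 → eval y x F ≋ 𝟘
eval-swap F symmetric {x} {y} h = begin
  eval y x F                                                    ≈⟨ S.+-identityʳ _ ⟨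
  eval y x F ⊞ 𝟘                                                ≈⟨ S.+-congˡ h ⟨
  eval y x F ⊞ eval x y F                                       ≈⟨ go F F ⟨
  eval x y (foldr (λ m → addₚ (swap m ∷ [])) F F)               ≡⟨ cong (eval x y) symmetric ⟩
  𝟘                                                             ∎
  where
  open ≋-Reasoning
  go : ∀ F K → eval x y (foldr (λ m → addₚ (swap m ∷ [])) K F) ≋ eval y x F ⊞ eval x y K
  go []            K = S.sym (S.+-identityˡ _)
  go ((a , b) ∷ F) K = S.trans (eval-addₚ x y ((b , a) ∷ []) (foldr (λ m → addₚ (swap m ∷ [])) K F))
      (S.trans (S.+-cong (S.trans (S.+-identityʳ _) (S.*-comm _ _)) (go F K)) (S.sym (S.+-assoc _ _ _)))

below-^ : ∀ {n f} k → Below n f → Below (n * k) (f ^ k)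
below-^ {n} zero    b rewrite ℕ.*-zeroʳ n = λ ()
below-^ {n} {f} (suc k) b = subst (λ i → Below i (f ^ suc k)) (sym (ℕ.*-suc n k))
    (below-⊠ n (n * k) b (below-^ k b))

-- Solving the recurrence at negative powers

module Conclude {G : Series} (uniformiser : Uniformiser G) (l″ : ℕ) (odd-ℓ : Coprime 2 (suc (suc l″))) where
  open Hecke uniformiser l″ odd-ℓ

  private
    B = G ^ l

    multiply : ∀ k {s} → s ≋ φ⁻¹ ^ (l * k) → B ^ k ⊠ s ≋ Q ^ k
    multiply k {s} h = begin
      B ^ k ⊠ s                          ≈⟨ S.*-cong (^-assocʳ G l k) h ⟩
      G ^ (l * k) ⊠ φ⁻¹ ^ (l * k)        ≈⟨ ^-distrib-* G φ⁻¹ (l * k) ⟨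
      (G ⊠ φ⁻¹) ^ (l * k)                ≈⟨ ^-congˡ (l * k) G-φ⁻¹ ⟩
      X ^ (l * k)                        ≈⟨ ^-assocʳ X l k ⟨
      Q ^ k                              ∎
      where open ≋-Reasoning

    determined : ∀ k {s} → B ^ k ⊠ s ≋ Q ^ k → s ≋ φ⁻¹ ^ (l * k)
    determined k h = t⁻-determined (l * k) (S.trans (S.*-congʳ (S.sym (^-assocʳ G l k)))
        (S.trans h (^-assocʳ X l k)))

  -- The recurrence around k = −2, when every t k with k ≥ 0 in it vanishes.
  conclude₁ : t⁻ 1 ⊠ (G ⊠ (G ^ l ⊠ t⁻ 1 ⊞ Q)) ≋ 𝟘 → t⁻ 1 ≋ φ⁻¹ ^ l
  conclude₁ h = t⁻-determined l (x+y≈0⇒x≈y (order⇒⊠-cancel-𝟘 order-G (order⇒⊠-cancel-𝟘 (order-t⁻ 0) h)))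

  private
    order-Q : Order l Q
    order-Q = order-X^ l

  -- The recurrence around -4: t⁻ 4 is the fourth power of t⁻ 1, so t⁻ 3 is its only unknown.
  conclude₃ : t⁻ 1 ≋ φ⁻¹ ^ l → G ⊠ (G ^ l ⊠ t⁻ 4 ⊞ Q ⊠ t⁻ 3) ≋ 𝟘 → t⁻ 3 ≋ φ⁻¹ ^ (l * 3)
  conclude₃ h₁ h = determined 3 (order⇒⊠-cancelˡ order-Q (begin
      Q ⊠ (B ^ 3 ⊠ t⁻ 3)                 ≈⟨ solve 3 (λ q b s → q :* (b :^ 3 :* s) := b :^ 3 :* (q :* s)) S.refl Q B
          (t⁻ 3) ⟩
      B ^ 3 ⊠ (Q ⊠ t⁻ 3)                 ≈⟨ S.*-congˡ (x+y≈0⇒x≈y (order⇒⊠-cancel-𝟘 order-G h)) ⟨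
      B ^ 3 ⊠ (B ⊠ t⁻ 4)                 ≈⟨ S.*-congˡ (S.*-congˡ
          (S.trans (t⁻-double 2) (S.*-cong (t⁻-double 1) (t⁻-double 1)))) ⟩
      B ^ 3 ⊠ (B ⊠ ((t⁻ 1 ⊠ t⁻ 1) ⊠ (t⁻ 1 ⊠ t⁻ 1)))
        ≈⟨ solve 2 (λ b s → b :^ 3 :* (b :* ((s :* s) :* (s :* s))) := (b :^ 1 :* s) :^ 4) S.refl B (t⁻ 1) ⟩
      (B ^ 1 ⊠ t⁻ 1) ^ 4                 ≈⟨ ^-congˡ 4 (multiply 1
          (S.trans h₁ (S.reflexive (cong (φ⁻¹ ^_) (sym (ℕ.*-identityʳ l)))))) ⟩
      (Q ^ 1) ^ 4                        ≈⟨ solve 1 (λ q → (q :^ 1) :^ 4 := q :* q :^ 3) S.refl Q ⟩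
      Q ⊠ Q ^ 3                          ∎))
    where open ≋-Reasoning

  -- The recurrence around -6, where t⁻ 6 is the square of t⁻ 3.
  conclude₅ : t⁻ 3 ≋ φ⁻¹ ^ (l * 3) → G ⊠ (G ^ l ⊠ t⁻ 6 ⊞ Q ⊠ t⁻ 5) ≋ 𝟘 → t⁻ 5 ≋ φ⁻¹ ^ (l * 5)
  conclude₅ h₃ h = determined 5 (order⇒⊠-cancelˡ order-Q (begin
      Q ⊠ (B ^ 5 ⊠ t⁻ 5)                 ≈⟨ solve 3 (λ q b s → q :* (b :^ 5 :* s) := b :^ 5 :* (q :* s)) S.refl Q B
          (t⁻ 5) ⟩
      B ^ 5 ⊠ (Q ⊠ t⁻ 5)                 ≈⟨ S.*-congˡ (x+y≈0⇒x≈y (order⇒⊠-cancel-𝟘 order-G h)) ⟨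
      B ^ 5 ⊠ (B ⊠ t⁻ 6)                 ≈⟨ S.*-congˡ (S.*-congˡ (t⁻-double 3)) ⟩
      B ^ 5 ⊠ (B ⊠ (t⁻ 3 ⊠ t⁻ 3))        ≈⟨ solve 2 (λ b s → b :^ 5 :* (b :* (s :* s)) := (b :^ 3 :* s) :^ 2)
          S.refl B (t⁻ 3) ⟩
      (B ^ 3 ⊠ t⁻ 3) ^ 2                 ≈⟨ ^-congˡ 2 (multiply 3 h₃) ⟩
      (Q ^ 3) ^ 2                        ≈⟨ solve 1 (λ q → (q :^ 3) :^ 2 := q :* q :^ 5) S.refl Q ⟩
      Q ⊠ Q ^ 5                          ∎))
    where open ≋-Reasoning

-- Split `a` into V ℓ (U ℓ a), its part at multiples of ℓ, and the rest. By `h` the rest contributes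
-- nothing to the product at multiples of ℓ, and the projection formula treats the other part.
U-⊠ : ∀ l a b → (∀ i j → suc l ∣ i + j → a i ≡ true → b j ≡ true → suc l ∣ i) → U (suc l) (a ⊠ b) ≋ U (suc l) a ⊠ U
    (suc l) b
U-⊠ l a b h = begin
  U ℓ (a ⊠ b)                                          ≈⟨ U-cong ℓ
      (solve 3 (λ a b v → a :* b := v :* b :+ (a :+ v) :* b) S.refl a b (V ℓ (U ℓ a))) ⟩
  U ℓ (V ℓ (U ℓ a) ⊠ b ⊞ rest ⊠ b)                     ≈⟨ U-⊞ ℓ _ _ ⟩
  U ℓ (V ℓ (U ℓ a) ⊠ b) ⊞ U ℓ (rest ⊠ b)               ≈⟨ S.+-cong (U-V-⊠ l (U ℓ a) b)
      (pointwise λ n → vanish (n * ℓ) rest (rest-b n)) ⟩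
  U ℓ a ⊠ U ℓ b ⊞ 𝟘                                    ≈⟨ S.+-identityʳ _ ⟩
  U ℓ a ⊠ U ℓ b                                        ∎
  where
  open ≋-Reasoning
  ℓ = suc l
  rest = a ⊞ V ℓ (U ℓ a)
  vanish : ∀ n (a : Series) → (∀ i j → i + j ≡ n → a i ∧ b j ≡ false) → (a ⊠ b) n ≡ false
  vanish zero    a z = z 0 0 refl
  vanish (suc n) a z = cong₂ _xor_ (z 0 (suc n) refl) (vanish n (tl a) (λ i j e → z (suc i) j (cong suc e)))
  rest-b : ∀ n i j → i + j ≡ n * ℓ → rest i ∧ b j ≡ false
  rest-b n i j e with ℓ ∣? i
  ... | yes (divides k refl) = trans (cong (_∧ b j) (⊞-at-≡ refl (V-at l (U ℓ a) k)))
      (cong (_∧ b j) (Bool.xor-same (a (k * ℓ))))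
  ... | no ℓ∤i = trans (cong (_∧ b j) (trans (⊞-at-≡ refl (V-at-∤ l (U ℓ a) i ℓ∤i)) (Bool.xor-identityʳ (a i))))
      (false-case (a i) (b j) refl refl)
    where
    false-case : ∀ x y → a i ≡ x → b j ≡ y → x ∧ y ≡ false
    false-case false y     _ _ = refl
    false-case true  false _ _ = refl
    false-case true  true  p q = ⊥-elim (ℓ∤i (h i j (divides n e) p q))

-- −1 is not a square modulo ℓ
Nonresidue : ℕ → Set
Nonresidue l = ∀ {a} → a < l → ∀ {b} → b < l → l ∣ a * a + b * b → a ≡ 0

nonresidue? : ∀ l → Dec (Nonresidue l)
nonresidue? l = ℕ.allUpTo? (λ a → ℕ.allUpTo? (λ b → (l ∣? (a * a + b * b)) →-dec (a ℕ.≟ 0)) l) l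

sum-of-squares : ∀ l .{{_ : NonZero l}} → Nonresidue l → ∀ x y → l ∣ x * x + y * y → l ∣ x
sum-of-squares l nr x y d = m%n≡0⇒n∣m x l (nr (m%n<n x l) (m%n<n y l) (m%n≡0⇒n∣m _ l (begin
  ((x % l) * (x % l) + (y % l) * (y % l)) % l                  ≡⟨ %-distribˡ-+ ((x % l) * (x % l))
      ((y % l) * (y % l)) l ⟩
  (((x % l) * (x % l)) % l + ((y % l) * (y % l)) % l) % l      ≡⟨ cong₂ (λ a b → (a + b) % l) (%-distribˡ-* x x l)
      (%-distribˡ-* y y l) ⟨
  ((x * x) % l + (y * y) % l) % l                              ≡⟨ %-distribˡ-+ (x * x) (y * y) l ⟨
  (x * x + y * y) % l                                          ≡⟨ n∣m⇒m%n≡0 _ l d ⟩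
  0                                                            ∎)))
  where open ≡-Reasoning

D-square : ∀ n → D n ≡ true → ∃ λ x → n ≡ x * x
D-square n t with θ-true oddSquare n t
... | a , e = suc (double a) , sym e

V₉D-square : ∀ n → V 9 D n ≡ true → ∃ λ x → n ≡ x * x
V₉D-square n t with V-true 8 D n t
... | k , refl , q with D-square k q
... | x , refl = x * 3 , N.solve 1 (λ x → x N.:* x N.:* N.con 9 N.:= (x N.:* N.con 3) N.:* (x N.:* N.con 3)) refl x

xor-true : ∀ {a b} → a xor b ≡ true → a ≡ true ⊎ b ≡ true
xor-true {true}  _ = inj₁ refl
xor-true {false} p = inj₂ p

g-square : ∀ n → g n ≡ true → ∃ λ x → n ≡ x * x
g-square n t = [ D-square n , V₉D-square n ]′ (xor-true (trans (sym (⊞-at D (V 9 D) n))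
    (trans (sym (at g-theta n)) t)))

V₄g-square : ∀ n → V 4 g n ≡ true → ∃ λ y → n ≡ y * y
V₄g-square n t = conclude (V-true 3 g n t)
  where
  quadruple : ∀ {k} → n ≡ k * 4 → ∃ (λ y → k ≡ y * y) → ∃ λ y → n ≡ y * y
  quadruple e (y , e′) = y * 2 , trans e (trans (cong (_* 4) e′)
    (N.solve 1 (λ y → y N.:* y N.:* N.con 4 N.:= (y N.:* N.con 2) N.:* (y N.:* N.con 2)) refl y))
  conclude : ∃ (λ k → n ≡ k * 4 × g k ≡ true) → ∃ λ y → n ≡ y * y
  conclude (k , e , q) = quadruple e (g-square k q)

-- Vanishing of T on positive powers of g

module EtaHecke (l″ : ℕ) (2⊥ℓ : Coprime 2 (suc (suc l″))) (3⊥ℓ : Coprime 3 (suc (suc l″)))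
    (9⊥ℓ : Coprime 9 (suc (suc l″)))
  (U-D-ℓ : U (suc (suc l″)) D ≋ V (suc (suc l″)) D) where

  open Hecke g-uniformiser l″ 2⊥ℓ public
  open Conclude g-uniformiser l″ 2⊥ℓ public

  U-g : U l g ≋ V l g
  U-g = begin
    U l g                            ≈⟨ U-cong l g-theta ⟩
    U l (D ⊞ V 9 D)                  ≈⟨ U-⊞ l D (V 9 D) ⟩
    U l D ⊞ U l (V 9 D)              ≈⟨ S.+-cong U-D-ℓ (S.trans (U-V-coprime l 8 D 9⊥ℓ) (V-cong 9 U-D-ℓ)) ⟩
    V l D ⊞ V 9 (V l D)              ≈⟨ S.+-congˡ (V-comm 8 (suc l″) D) ⟩
    V l D ⊞ V l (V 9 D)              ≈⟨ V-⊞ l D (V 9 D) ⟨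
    V l (D ⊞ V 9 D)                  ≈⟨ V-cong l g-theta ⟨
    V l g                            ∎
    where open ≋-Reasoning

  t₁ : t 1 ≋ 𝟘
  t₁ = x≈y⇒x+y≈0 (S.trans (U-cong l (S.*-identityʳ g)) (S.trans U-g (S.sym (S.*-identityʳ _))))

  t₃ : t 3 ≋ 𝟘
  t₃ = x≈y⇒x+y≈0 (begin
    U l (g ^ 3)                      ≈⟨ U-cong l g³ ⟩
    U l (V 3 D)                      ≈⟨ U-V-coprime l 2 D 3⊥ℓ ⟩
    V 3 (U l D)                      ≈⟨ V-cong 3 U-D-ℓ ⟩
    V 3 (V l D)                      ≈⟨ V-comm 2 (suc l″) D ⟩
    V l (V 3 D)                      ≈⟨ V-cong l g³ ⟨
    V l (g ^ 3)                      ≈⟨ V-^ (suc l″) g 3 ⟩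
    H ^ 3                            ∎)
    where open ≋-Reasoning

  t₂ : t 2 ≋ 𝟘
  t₂ = t-double-𝟘 1 t₁

  t₄ : t 4 ≋ 𝟘
  t₄ = t-double-𝟘 2 t₂

  t₆ : t 6 ≋ 𝟘
  t₆ = t-double-𝟘 3 t₃

  t₈ : t 8 ≋ 𝟘
  t₈ = t-double-𝟘 4 t₄

  t₁₂ : t 12 ≋ 𝟘
  t₁₂ = t-double-𝟘 6 t₆

  t₁₆ : t 16 ≋ 𝟘
  t₁₆ = t-double-𝟘 8 t₈

  t₂₄ : t 24 ≋ 𝟘
  t₂₄ = t-double-𝟘 12 t₁₂

  -- gᵏ is qᵏ times a series in q²⁴, so its coefficient at q^ℓ vanishes unless ℓ ≡ k modulo 24.
  -- Order at least 2 is needed to exclude nonzero roots of order 1 in the factored equations for t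
  -- 5 and t 7.
  below-2 : ∀ k → ((X ^ suc k) ⊠ V 24 (euler ^ suc k)) l ≡ false → Below 2 (t (suc k))
  below-2 k z {zero}  _ = t-below k (s≤s z≤n)
  below-2 k z {suc zero} _ = ⊞-at-≡ (trans (cong (g ^ suc k) (ℕ.+-identityʳ l)) (trans (at g^ l) z))
    (below (order-^ order-H (suc k)) (ℕ.<-≤-trans (s≤s (s≤s z≤n)) (ℕ.m≤m*n l (suc k))))
    where
    g^ : g ^ suc k ≋ (X ^ suc k) ⊠ V 24 (euler ^ suc k)
    g^ = S.trans (^-congˡ (suc k) g-def) (S.trans (^-distrib-* X (V 24 euler) (suc k))
        (S.*-congˡ (S.sym (V-^ 23 euler (suc k)))))
  below-2 k z {suc (suc i)} (s≤s (s≤s ()))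

  -- g⁵ = Σ q^(x² + (2y)²)
  inert⇒t₅ : Nonresidue l → t 5 ≋ 𝟘
  inert⇒t₅ nr = x≈y⇒x+y≈0 (begin
    U l (g ^ 5)                      ≈⟨ U-cong l (fifth g) ⟩
    -- `U` is multiplicative on this product because ℓ ∣ x² + y² forces ℓ ∣ x.
    U l (g ⊠ V 4 g)                  ≈⟨ U-⊠ (suc l″) g (V 4 g) squares ⟩
    U l g ⊠ U l (V 4 g)              ≈⟨ S.*-congˡ U-V₄ ⟩
    U l g ⊠ V 4 (V l g)              ≈⟨ S.*-congʳ U-g ⟩
    H ⊠ V 4 H                        ≈⟨ fifth H ⟨
    H ^ 5                            ∎)
    where
    open ≋-Reasoning
    fifth : ∀ h → h ^ 5 ≋ h ⊠ V 4 h
    fifth h = S.*-congˡ (fourth-power h)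
    U-V₄ : U l (V 4 g) ≋ V 4 (V l g)
    U-V₄ = begin
      U l (V 4 g)                    ≈⟨ U-cong l (V-V 1 1 g) ⟨
      U l (V 2 (V 2 g))              ≈⟨ U-V-coprime l 1 (V 2 g) 2⊥ℓ ⟩
      V 2 (U l (V 2 g))              ≈⟨ V-cong 2 (U-V-coprime l 1 g 2⊥ℓ) ⟩
      V 2 (V 2 (U l g))              ≈⟨ V-V 1 1 (U l g) ⟩
      V 4 (U l g)                    ≈⟨ V-cong 4 U-g ⟩
      V 4 (V l g)                    ∎
    squares : ∀ i j → l ∣ i + j → g i ≡ true → V 4 g j ≡ true → l ∣ i
    squares i j d p q = conclude (g-square i p) (V₄g-square j q)
      where
      conclude : ∃ (λ x → i ≡ x * x) → ∃ (λ y → j ≡ y * y) → l ∣ i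
      conclude (x , e) (y , e′) = subst (l ∣_) (sym e) (∣-trans
          (sum-of-squares l nr x y (subst₂ (λ a b → l ∣ a + b) e e′ d)) (n∣m*n x))

-- The values of T for each ℓ

F₃ F₅ : Poly
F₃ = (4 , 0) ∷ (1 , 1) ∷ (0 , 4) ∷ []
F₅ = (6 , 0) ∷ (1 , 1) ∷ (0 , 6) ∷ []

D-modular₃′ : eval D (V 3 D) F₃ ≋ 𝟘
D-modular₃′ = S.trans (solve 2 (λ x y → x :^ 4 :* y :^ 0 :+ (x :^ 1 :* y :^ 1 :+ (x :^ 0 :* y :^ 4 :+ con false))
    := x :* y :+ (x :^ 4 :+ y :^ 4)) S.refl D (V 3 D))
  (x≈y⇒x+y≈0 D-modular₃)

g-modular₅′ : eval g (V 5 g) F₅ ≋ 𝟘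
g-modular₅′ = S.trans (solve 2 (λ x y → x :^ 6 :* y :^ 0 :+ (x :^ 1 :* y :^ 1 :+ (x :^ 0 :* y :^ 6 :+ con false))
    := x :* y :+ (x :^ 6 :+ y :^ 6)) S.refl g (V 5 g))
  (x≈y⇒x+y≈0 g-modular₅)

-- Below, each identity writes its left-hand side as a recurrence plus multiples of series already known to
-- vanish; the variables sk and nk stand for t k and t⁻ k.
module ℓ₅ where
  open EtaHecke 3 (from-yes (coprime? 2 5)) (from-yes (coprime? 3 5)) (from-yes (coprime? 9 5))
      (U-D {1} (from-yes (prime? 5)))
  open Recurrence F₅ g-modular₅′ (eval-swap F₅ refl g-modular₅′)

  t⁻₁ : t⁻ 1 ≋ φ⁻¹ ^ 5
  t⁻₁ = conclude₁ (S.trans (solve 5 (λ g q n1 n2 s4 →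
      n1 :* (g :* (g :^ 5 :* n1 :+ q)) := (g :^ 6 :* (q :^ 0 :* n2) :+
          (g :^ 1 :* (q :^ 1 :* n1) :+ (g :^ 0 :* (q :^ 2 :* s4) :+ con false))) :+
          (g :^ 6 :* (n2 :+ n1 :* n1) :+ ((g :^ 0 :* q :^ 2) :* s4)))
      S.refl g Q (t⁻ 1) (t⁻ 2) (t 4))
    (⊞-𝟘 (recurrence⁻ 2) (⊞-𝟘 (⊠-𝟘 _ (x≈y⇒x+y≈0 (t⁻-double 1))) (⊠-𝟘 _ t₄))))

  t⁻₃ : t⁻ 3 ≋ φ⁻¹ ^ 15
  t⁻₃ = conclude₃ t⁻₁ (S.trans (solve 5 (λ g q n3 n4 s2 →
      g :* (g :^ 5 :* n4 :+ q :* n3) := (g :^ 6 :* (q :^ 0 :* n4) :+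
          (g :^ 1 :* (q :^ 1 :* n3) :+ (g :^ 0 :* (q :^ 4 :* s2) :+ con false))) :+ ((g :^ 0 :* q :^ 4) :* s2))
      S.refl g Q (t⁻ 3) (t⁻ 4) (t 2))
    (⊞-𝟘 (recurrence⁻ 4) (⊠-𝟘 _ t₂)))

  t⁻₅ : t⁻ 5 ≋ φ⁻¹ ^ 25
  t⁻₅ = conclude₅ t⁻₃ (S.trans (solve 5 (λ g q n5 n6 s0 →
      g :* (g :^ 5 :* n6 :+ q :* n5) := (g :^ 6 :* (q :^ 0 :* n6) :+
          (g :^ 1 :* (q :^ 1 :* n5) :+ (g :^ 0 :* (q :^ 6 :* s0) :+ con false))) :+ ((g :^ 0 :* q :^ 6) :* s0))
      S.refl g Q (t⁻ 5) (t⁻ 6) (t 0))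
    (⊞-𝟘 (recurrence⁻ 6) (⊠-𝟘 _ t₀)))

module ℓ₇ where
  open EtaHecke 5 (from-yes (coprime? 2 7)) (from-yes (coprime? 3 7)) (from-yes (coprime? 9 7))
      (U-D {2} (from-yes (prime? 7)))
  open Recurrence F₇ g-modular₇ (eval-swap F₇ refl g-modular₇)

  t⁻₁ : t⁻ 1 ≋ φ⁻¹ ^ 7
  t⁻₁ = conclude₁ (S.trans (solve 6 (λ g q n1 n2 s2 s6 →
      n1 :* (g :* (g :^ 7 :* n1 :+ q)) := (g :^ 8 :* (q :^ 0 :* n2) :+
          (g :^ 4 :* (q :^ 2 :* s2) :+ (g :^ 1 :* (q :^ 1 :* n1) :+ (g :^ 0 :* (q :^ 2 :* s6) :+ con false)))) :+
          (g :^ 8 :* (n2 :+ n1 :* n1) :+ ((g :^ 4 :* q :^ 2) :* s2 :+ ((g :^ 0 :* q :^ 2) :* s6))))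
      S.refl g Q (t⁻ 1) (t⁻ 2) (t 2) (t 6))
    (⊞-𝟘 (recurrence⁻ 2) (⊞-𝟘 (⊠-𝟘 _ (x≈y⇒x+y≈0 (t⁻-double 1))) (⊞-𝟘 (⊠-𝟘 _ t₂) (⊠-𝟘 _ t₆)))))

  t⁻₃ : t⁻ 3 ≋ φ⁻¹ ^ 21
  t⁻₃ = conclude₃ t⁻₁ (S.trans (solve 6 (λ g q n3 n4 s0 s4 →
      g :* (g :^ 7 :* n4 :+ q :* n3) := (g :^ 8 :* (q :^ 0 :* n4) :+
          (g :^ 4 :* (q :^ 4 :* s0) :+ (g :^ 1 :* (q :^ 1 :* n3) :+ (g :^ 0 :* (q :^ 4 :* s4) :+ con false)))) :+
          ((g :^ 4 :* q :^ 4) :* s0 :+ ((g :^ 0 :* q :^ 4) :* s4)))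
      S.refl g Q (t⁻ 3) (t⁻ 4) (t 0) (t 4))
    (⊞-𝟘 (recurrence⁻ 4) (⊞-𝟘 (⊠-𝟘 _ t₀) (⊠-𝟘 _ t₄))))

module ℓ₁₁ where
  open EtaHecke 9 (from-yes (coprime? 2 11)) (from-yes (coprime? 3 11)) (from-yes (coprime? 9 11))
      (U-D {4} (from-yes (prime? 11)))
  open Recurrence F₁₁ g-modular₁₁ (eval-swap F₁₁ refl g-modular₁₁)

  t₅ : t 5 ≋ 𝟘
  t₅ = inert⇒t₅ (from-yes (nonresidue? 11))

  t₁₀ : t 10 ≋ 𝟘
  t₁₀ = t-double-𝟘 5 t₅

  t⁻₁ : t⁻ 1 ≋ φ⁻¹ ^ 11
  t⁻₁ = conclude₁ (S.trans (solve 6 (λ g q n1 n2 s1 s10 →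
      n1 :* (g :* (g :^ 11 :* n1 :+ q)) := (g :^ 12 :* (q :^ 0 :* n2) :+
          (g :^ 3 :* (q :^ 2 :* s1) :+ (g :^ 1 :* (q :^ 1 :* n1) :+ (g :^ 0 :* (q :^ 2 :* s10) :+ con false)))) :+
          (g :^ 12 :* (n2 :+ n1 :* n1) :+ ((g :^ 3 :* q :^ 2) :* s1 :+ ((g :^ 0 :* q :^ 2) :* s10))))
      S.refl g Q (t⁻ 1) (t⁻ 2) (t 1) (t 10))
    (⊞-𝟘 (recurrence⁻ 2) (⊞-𝟘 (⊠-𝟘 _ (x≈y⇒x+y≈0 (t⁻-double 1))) (⊞-𝟘 (⊠-𝟘 _ t₁) (⊠-𝟘 _ t₁₀)))))

module ℓ₁₃ where
  open EtaHecke 11 (from-yes (coprime? 2 13)) (from-yes (coprime? 3 13)) (from-yes (coprime? 9 13))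
      (U-D {5} (from-yes (prime? 13)))
  open Recurrence F₁₃ g-modular₁₃ (eval-swap F₁₃ refl g-modular₁₃)

  t₇ : t 7 ≋ 𝟘
  t₇ = t-half-𝟘 7 (S.trans (solve 7 (λ g q s0 s1 s2 s12 s14 →
      s14 := (g :^ 14 :* s0 :+ (g :^ 12 :* s2 :+ (g :^ 2 :* s12 :+
          (g :^ 1 :* s1 :+ (g :^ 0 :* s14 :+ con false))))) :+
          (g :^ 14 :* s0 :+ (g :^ 12 :* s2 :+ (g :^ 2 :* s12 :+ (g :^ 1 :* s1)))))
      S.refl g Q (t 0) (t 1) (t 2) (t 12) (t 14))
    (⊞-𝟘 (recurrence⁺ 0) (⊞-𝟘 (⊠-𝟘 _ t₀) (⊞-𝟘 (⊠-𝟘 _ t₂) (⊞-𝟘 (⊠-𝟘 _ t₁₂) (⊠-𝟘 _ t₁))))))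

  t₁₈ : t 18 ≋ g ⊠ t 5
  t₁₈ = x+y≈0⇒x≈y (S.trans (solve 7 (λ g q s4 s5 s6 s16 s18 →
      s18 :+ g :* s5 := (g :^ 14 :* s4 :+ (g :^ 12 :* s6 :+ (g :^ 2 :* s16 :+
          (g :^ 1 :* s5 :+ (g :^ 0 :* s18 :+ con false))))) :+
          (g :^ 14 :* s4 :+ (g :^ 12 :* s6 :+ (g :^ 2 :* s16))))
      S.refl g Q (t 4) (t 5) (t 6) (t 16) (t 18))
    (⊞-𝟘 (recurrence⁺ 4) (⊞-𝟘 (⊠-𝟘 _ t₄) (⊞-𝟘 (⊠-𝟘 _ t₆) (⊠-𝟘 _ t₁₆)))))

  -- As -1 is a square modulo 13, sums of two squares give nothing. With t 20 = (t 5)⁴ and t 18 = g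
  -- t 5, the recurrence at 6 becomes (g³ + (t 5)³) t 5 = 0, whose first factor has order 3.
  t₅ : t 5 ≋ 𝟘
  t₅ = order⇒⊠-cancel-𝟘 (order-⊞ (order-^ order-g 3) (below-weaken (ℕ.m≤m+n 4 2) (below-^ 3 (below-2 4 refl))))
    (S.trans (solve 9 (λ g q s5 s6 s7 s8 s10 s18 s20 →
      (g :^ 3 :+ s5 :^ 3) :* s5 := (g :^ 14 :* s6 :+ (g :^ 12 :* s8 :+
          (g :^ 2 :* s18 :+ (g :^ 1 :* s7 :+ (g :^ 0 :* s20 :+ con false))))) :+
          (g :^ 2 :* (s18 :+ g :* s5) :+ (con true :* (s20 :+ s10 :* s10) :+
          ((s10 :+ s5 :* s5) :* (s10 :+ s5 :* s5) :+ (g :^ 14 :* s6 :+ (g :^ 12 :* s8 :+ (g :^ 1 :* s7)))))))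
      S.refl g Q (t 5) (t 6) (t 7) (t 8) (t 10) (t 18) (t 20))
    (⊞-𝟘 (recurrence⁺ 6) (⊞-𝟘 (⊠-𝟘 _ (x≈y⇒x+y≈0 t₁₈)) (⊞-𝟘 (⊠-𝟘 _ (x≈y⇒x+y≈0 (t-double 10)))
        (⊞-𝟘 (⊠-𝟘 _ (x≈y⇒x+y≈0 (t-double 5))) (⊞-𝟘 (⊠-𝟘 _ t₆) (⊞-𝟘 (⊠-𝟘 _ t₈) (⊠-𝟘 _ t₇))))))))

  t₁₀ : t 10 ≋ 𝟘
  t₁₀ = t-double-𝟘 5 t₅

  t⁻₁ : t⁻ 1 ≋ φ⁻¹ ^ 13
  t⁻₁ = conclude₁ (S.trans (solve 7 (λ g q n1 n2 s0 s10 s12 →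
      n1 :* (g :* (g :^ 13 :* n1 :+ q)) := (g :^ 14 :* (q :^ 0 :* n2) :+
          (g :^ 12 :* (q :^ 2 :* s0) :+ (g :^ 2 :* (q :^ 2 :* s10) :+
          (g :^ 1 :* (q :^ 1 :* n1) :+ (g :^ 0 :* (q :^ 2 :* s12) :+ con false))))) :+
          (g :^ 14 :* (n2 :+ n1 :* n1) :+ ((g :^ 12 :* q :^ 2) :* s0 :+
          ((g :^ 2 :* q :^ 2) :* s10 :+ ((g :^ 0 :* q :^ 2) :* s12)))))
      S.refl g Q (t⁻ 1) (t⁻ 2) (t 0) (t 10) (t 12))
    (⊞-𝟘 (recurrence⁻ 2) (⊞-𝟘 (⊠-𝟘 _ (x≈y⇒x+y≈0 (t⁻-double 1))) (⊞-𝟘 (⊠-𝟘 _ t₀) (⊞-𝟘 (⊠-𝟘 _ t₁₀) (⊠-𝟘 _ t₁₂))))))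

module ℓ₁₇ where
  open EtaHecke 15 (from-yes (coprime? 2 17)) (from-yes (coprime? 3 17)) (from-yes (coprime? 9 17))
      (U-D {7} (from-yes (prime? 17)))
  open Recurrence F₁₇ g-modular₁₇ (eval-swap F₁₇ refl g-modular₁₇)

  t₁₈ : t 18 ≋ 𝟘
  t₁₈ = S.trans (solve 9 (λ g q s0 s1 s2 s6 s8 s12 s18 →
      s18 := (g :^ 18 :* s0 :+ (g :^ 12 :* s6 :+ (g :^ 8 :* s2 :+
          (g :^ 6 :* s12 :+ (g :^ 2 :* s8 :+ (g :^ 1 :* s1 :+ (g :^ 0 :* s18 :+ con false))))))) :+
          (g :^ 18 :* s0 :+ (g :^ 12 :* s6 :+ (g :^ 8 :* s2 :+
          (g :^ 6 :* s12 :+ (g :^ 2 :* s8 :+ (g :^ 1 :* s1)))))))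
      S.refl g Q (t 0) (t 1) (t 2) (t 6) (t 8) (t 12) (t 18))
    (⊞-𝟘 (recurrence⁺ 0) (⊞-𝟘 (⊠-𝟘 _ t₀) (⊞-𝟘 (⊠-𝟘 _ t₆) (⊞-𝟘 (⊠-𝟘 _ t₂)
        (⊞-𝟘 (⊠-𝟘 _ t₁₂) (⊞-𝟘 (⊠-𝟘 _ t₈) (⊠-𝟘 _ t₁)))))))

  -- The recurrence at 6 reduces to g t 7 + g² t 14 = 0 with t 14 = (t 7)²; the cofactor 1 + g t 7
  -- is a unit.
  t₇ : t 7 ≋ 𝟘
  t₇ = order⇒⊠-cancel-𝟘 (order-⊠ order-g (order-⊞ order-𝟙 (below-⊠ˡ (t 7) (below order-g))))
    (S.trans (solve 9 (λ g q s6 s7 s8 s12 s14 s18 s24 →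
      g :* (con true :+ g :* s7) :* s7 := (g :^ 18 :* s6 :+ (g :^ 12 :* s12 :+
          (g :^ 8 :* s8 :+ (g :^ 6 :* s18 :+ (g :^ 2 :* s14 :+ (g :^ 1 :* s7 :+ (g :^ 0 :* s24 :+ con false)))))))
          :+ (g :^ 2 :* (s14 :+ s7 :* s7) :+ (g :^ 18 :* s6 :+
          (g :^ 12 :* s12 :+ (g :^ 8 :* s8 :+ (g :^ 6 :* s18 :+ (g :^ 0 :* s24)))))))
      S.refl g Q (t 6) (t 7) (t 8) (t 12) (t 14) (t 18) (t 24))
    (⊞-𝟘 (recurrence⁺ 6) (⊞-𝟘 (⊠-𝟘 _ (x≈y⇒x+y≈0 (t-double 7)))
        (⊞-𝟘 (⊠-𝟘 _ t₆) (⊞-𝟘 (⊠-𝟘 _ t₁₂) (⊞-𝟘 (⊠-𝟘 _ t₈) (⊞-𝟘 (⊠-𝟘 _ t₁₈) (⊠-𝟘 _ t₂₄))))))))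

  t₁₄ : t 14 ≋ 𝟘
  t₁₄ = t-double-𝟘 7 t₇

  -- Again -1 is a square modulo 17. The recurrence at 2 leaves g² t 10 + t 20, the square of (g + t
  -- 5) t 5, and `below-2` shows that g + t 5 has order 1.
  t₅ : t 5 ≋ 𝟘
  t₅ = order⇒⊠-cancel-𝟘 (order-⊞ order-g (below-2 4 refl)) (square-zero
    (S.trans (solve 10 (λ g q s2 s3 s4 s5 s8 s10 s14 s20 →
      ((g :+ s5) :* s5) :* ((g :+ s5) :* s5) := (g :^ 18 :* s2 :+
          (g :^ 12 :* s8 :+ (g :^ 8 :* s4 :+ (g :^ 6 :* s14 :+
          (g :^ 2 :* s10 :+ (g :^ 1 :* s3 :+ (g :^ 0 :* s20 :+ con false))))))) :+
          (g :^ 2 :* (s10 :+ s5 :* s5) :+ (con true :* (s20 :+ s10 :* s10) :+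
          ((s10 :+ s5 :* s5) :* (s10 :+ s5 :* s5) :+ (g :^ 18 :* s2 :+
          (g :^ 12 :* s8 :+ (g :^ 8 :* s4 :+ (g :^ 6 :* s14 :+ (g :^ 1 :* s3)))))))))
      S.refl g Q (t 2) (t 3) (t 4) (t 5) (t 8) (t 10) (t 14) (t 20))
    (⊞-𝟘 (recurrence⁺ 2) (⊞-𝟘 (⊠-𝟘 _ (x≈y⇒x+y≈0 (t-double 5)))
        (⊞-𝟘 (⊠-𝟘 _ (x≈y⇒x+y≈0 (t-double 10))) (⊞-𝟘 (⊠-𝟘 _ (x≈y⇒x+y≈0 (t-double 5)))
        (⊞-𝟘 (⊠-𝟘 _ t₂) (⊞-𝟘 (⊠-𝟘 _ t₈) (⊞-𝟘 (⊠-𝟘 _ t₄) (⊞-𝟘 (⊠-𝟘 _ t₁₄) (⊠-𝟘 _ t₃)))))))))))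

  t₁₀ : t 10 ≋ 𝟘
  t₁₀ = t-double-𝟘 5 t₅

  t⁻₁ : t⁻ 1 ≋ φ⁻¹ ^ 17
  t⁻₁ = conclude₁ (S.trans (solve 9 (λ g q n1 n2 s0 s4 s6 s10 s16 →
      n1 :* (g :* (g :^ 17 :* n1 :+ q)) := (g :^ 18 :* (q :^ 0 :* n2) :+
          (g :^ 12 :* (q :^ 2 :* s4) :+ (g :^ 8 :* (q :^ 2 :* s0) :+
          (g :^ 6 :* (q :^ 2 :* s10) :+ (g :^ 2 :* (q :^ 2 :* s6) :+
          (g :^ 1 :* (q :^ 1 :* n1) :+ (g :^ 0 :* (q :^ 2 :* s16) :+ con false))))))) :+
          (g :^ 18 :* (n2 :+ n1 :* n1) :+ ((g :^ 12 :* q :^ 2) :* s4 :+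
          ((g :^ 8 :* q :^ 2) :* s0 :+ ((g :^ 6 :* q :^ 2) :* s10 :+
          ((g :^ 2 :* q :^ 2) :* s6 :+ ((g :^ 0 :* q :^ 2) :* s16)))))))
      S.refl g Q (t⁻ 1) (t⁻ 2) (t 0) (t 4) (t 6) (t 10) (t 16))
    (⊞-𝟘 (recurrence⁻ 2) (⊞-𝟘 (⊠-𝟘 _ (x≈y⇒x+y≈0 (t⁻-double 1)))
        (⊞-𝟘 (⊠-𝟘 _ t₄) (⊞-𝟘 (⊠-𝟘 _ t₀) (⊞-𝟘 (⊠-𝟘 _ t₁₀) (⊞-𝟘 (⊠-𝟘 _ t₆) (⊠-𝟘 _ t₁₆))))))))

module ℓ₂₃ where
  open EtaHecke 21 (from-yes (coprime? 2 23)) (from-yes (coprime? 3 23)) (from-yes (coprime? 9 23))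
      (U-D {10} (from-yes (prime? 23)))
  open Recurrence F₂₃ g-modular₂₃ (eval-swap F₂₃ refl g-modular₂₃)

  t₅ : t 5 ≋ 𝟘
  t₅ = inert⇒t₅ (from-yes (nonresidue? 23))

  t₁₀ : t 10 ≋ 𝟘
  t₁₀ = t-double-𝟘 5 t₅

  t₁₃ : t 13 ≋ 𝟘
  t₁₃ = t-half-𝟘 13 (S.trans (solve 8 (λ g q s2 s3 s4 s5 s8 s26 →
      s26 := (g :^ 24 :* s2 :+ (g :^ 6 :* s8 :+ (g :^ 3 :* s5 :+
          (g :^ 2 :* s4 :+ (g :^ 1 :* s3 :+ (g :^ 0 :* s26 :+ con false)))))) :+
          (g :^ 24 :* s2 :+ (g :^ 6 :* s8 :+ (g :^ 3 :* s5 :+ (g :^ 2 :* s4 :+ (g :^ 1 :* s3))))))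
      S.refl g Q (t 2) (t 3) (t 4) (t 5) (t 8) (t 26))
    (⊞-𝟘 (recurrence⁺ 2) (⊞-𝟘 (⊠-𝟘 _ t₂) (⊞-𝟘 (⊠-𝟘 _ t₈) (⊞-𝟘 (⊠-𝟘 _ t₅) (⊞-𝟘 (⊠-𝟘 _ t₄) (⊠-𝟘 _ t₃)))))))

  -- The recurrence at 4 leaves t 28 + g³ t 7 with t 28 = (t 7)⁴; by `below-2` the factor g³ + (t
  -- 7)³ has order 3.
  t₇ : t 7 ≋ 𝟘
  t₇ = order⇒⊠-cancel-𝟘 (order-⊞ (order-^ order-g 3) (below-weaken (ℕ.m≤m+n 4 2) (below-^ 3 (below-2 6 refl))))
    (S.trans (solve 9 (λ g q s4 s5 s6 s7 s10 s14 s28 →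
      (g :^ 3 :+ s7 :^ 3) :* s7 := (g :^ 24 :* s4 :+ (g :^ 6 :* s10 :+
          (g :^ 3 :* s7 :+ (g :^ 2 :* s6 :+ (g :^ 1 :* s5 :+ (g :^ 0 :* s28 :+ con false)))))) :+
          (con true :* (s28 :+ s14 :* s14) :+ ((s14 :+ s7 :* s7) :* (s14 :+ s7 :* s7) :+
          (g :^ 24 :* s4 :+ (g :^ 6 :* s10 :+ (g :^ 2 :* s6 :+ (g :^ 1 :* s5)))))))
      S.refl g Q (t 4) (t 5) (t 6) (t 7) (t 10) (t 14) (t 28))
    (⊞-𝟘 (recurrence⁺ 4) (⊞-𝟘 (⊠-𝟘 _ (x≈y⇒x+y≈0 (t-double 14)))
        (⊞-𝟘 (⊠-𝟘 _ (x≈y⇒x+y≈0 (t-double 7))) (⊞-𝟘 (⊠-𝟘 _ t₄) (⊞-𝟘 (⊠-𝟘 _ t₁₀) (⊞-𝟘 (⊠-𝟘 _ t₆) (⊠-𝟘 _ t₅))))))))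

  t₁₄ : t 14 ≋ 𝟘
  t₁₄ = t-double-𝟘 7 t₇

  t₃₂ : t 32 ≋ 𝟘
  t₃₂ = t-double-𝟘 16 t₁₆

  -- In the recurrence around -2 only t 22 = (t 11)² is still unknown. This and the following
  -- relations serve to show t 9 = 0, and with it t 11 = 0.
  t₉-t₁₁ : t 9 ≋ g ⊠ g ⊠ t 11
  t₉-t₁₁ = order⇒⊠-cancelˡ order-g (x+y≈0⇒x≈y (S.trans (solve 8 (λ g q s8 s9 s10 s11 s14 s32 →
      g :* s9 :+ g :* (g :* g :* s11) := (g :^ 24 :* s8 :+ (g :^ 6 :* s14 :+
          (g :^ 3 :* s11 :+ (g :^ 2 :* s10 :+ (g :^ 1 :* s9 :+ (g :^ 0 :* s32 :+ con false)))))) :+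
          (g :^ 24 :* s8 :+ (g :^ 6 :* s14 :+ (g :^ 2 :* s10 :+ (g :^ 0 :* s32)))))
      S.refl g Q (t 8) (t 9) (t 10) (t 11) (t 14) (t 32))
    (⊞-𝟘 (recurrence⁺ 8) (⊞-𝟘 (⊠-𝟘 _ t₈) (⊞-𝟘 (⊠-𝟘 _ t₁₄) (⊞-𝟘 (⊠-𝟘 _ t₁₀) (⊠-𝟘 _ t₃₂)))))))

  below-t₉ : Below 3 (t 9)
  below-t₉ = below-resp (S.sym t₉-t₁₁) (below-⊠ 2 1 (below (order-⊠ order-g order-g)) (t-below 10))

  t₃₀ : t 30 ≋ g ^ 3 ⊠ t 9
  t₃₀ = x+y≈0⇒x≈y (S.trans (solve 8 (λ g q s6 s7 s8 s9 s12 s30 →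
      s30 :+ g :^ 3 :* s9 := (g :^ 24 :* s6 :+ (g :^ 6 :* s12 :+
          (g :^ 3 :* s9 :+ (g :^ 2 :* s8 :+ (g :^ 1 :* s7 :+ (g :^ 0 :* s30 :+ con false)))))) :+
          (g :^ 24 :* s6 :+ (g :^ 6 :* s12 :+ (g :^ 2 :* s8 :+ (g :^ 1 :* s7)))))
      S.refl g Q (t 6) (t 7) (t 8) (t 9) (t 12) (t 30))
    (⊞-𝟘 (recurrence⁺ 6) (⊞-𝟘 (⊠-𝟘 _ t₆) (⊞-𝟘 (⊠-𝟘 _ t₁₂) (⊞-𝟘 (⊠-𝟘 _ t₈) (⊠-𝟘 _ t₇))))))

  t₉-t₁₅ : t 9 ^ 4 ⊞ g ^ 6 ⊠ t 9 ^ 2 ⊞ g ^ 3 ⊠ t 15 ≋ 𝟘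
  t₉-t₁₅ = S.trans (solve 9 (λ g q s9 s12 s13 s14 s15 s18 s36 →
      s9 :^ 4 :+ g :^ 6 :* s9 :^ 2 :+ g :^ 3 :* s15 := (g :^ 24 :* s12 :+
          (g :^ 6 :* s18 :+ (g :^ 3 :* s15 :+ (g :^ 2 :* s14 :+ (g :^ 1 :* s13 :+ (g :^ 0 :* s36 :+ con false))))))
          :+ (g :^ 6 :* (s18 :+ s9 :* s9) :+ (con true :* (s36 :+ s18 :* s18) :+
          ((s18 :+ s9 :* s9) :* (s18 :+ s9 :* s9) :+ (g :^ 24 :* s12 :+ (g :^ 2 :* s14 :+ (g :^ 1 :* s13)))))))
      S.refl g Q (t 9) (t 12) (t 13) (t 14) (t 15) (t 18) (t 36))
    (⊞-𝟘 (recurrence⁺ 12) (⊞-𝟘 (⊠-𝟘 _ (x≈y⇒x+y≈0 (t-double 9)))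
        (⊞-𝟘 (⊠-𝟘 _ (x≈y⇒x+y≈0 (t-double 18))) (⊞-𝟘 (⊠-𝟘 _ (x≈y⇒x+y≈0 (t-double 9)))
        (⊞-𝟘 (⊠-𝟘 _ t₁₂) (⊞-𝟘 (⊠-𝟘 _ t₁₄) (⊠-𝟘 _ t₁₃)))))))

  -- Squaring `t₉-t₁₅` brings in (t 15)² = t 30 = g³ t 9 and so eliminates t 15: (g⁹ + (t 9)⁷ + g¹²
  -- (t 9)³) t 9 = 0. Since t 9 has order at least 3, the first factor has order 9.
  t₉ : t 9 ≋ 𝟘
  t₉ = order⇒⊠-cancel-𝟘
    (order-⊞ (order-^ order-g 9) (below-⊞ (below-weaken (ℕ.m≤m+n 10 11) (below-^ 7 below-t₉))
      (below-weaken (ℕ.m≤m+n 10 11) (below-⊠ 12 9 (below (order-^ order-g 12)) (below-^ 3 below-t₉)))))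
    (S.trans (solve 4 (λ g s9 s15 s30 → (g :^ 9 :+ (s9 :^ 7 :+ g :^ 12 :* s9 :^ 3)) :* s9
        := (s9 :^ 4 :+ g :^ 6 :* s9 :^ 2 :+ g :^ 3 :* s15) :* (s9 :^ 4 :+ g :^ 6 :* s9 :^ 2 :+ g :^ 3 :* s15)
           :+ (g :^ 6 :* (s30 :+ s15 :* s15) :+ g :^ 6 :* (s30 :+ g :^ 3 :* s9))) S.refl g (t 9) (t 15) (t 30))
      (⊞-𝟘 (⊠-𝟘 _ t₉-t₁₅) (⊞-𝟘 (⊠-𝟘 _ (x≈y⇒x+y≈0 (t-double 15))) (⊠-𝟘 _ (x≈y⇒x+y≈0 t₃₀)))))

  t₁₁ : t 11 ≋ 𝟘
  t₁₁ = order⇒⊠-cancel-𝟘 (order-⊠ order-g order-g) (S.trans (S.sym t₉-t₁₁) t₉)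

  t₂₂ : t 22 ≋ 𝟘
  t₂₂ = t-double-𝟘 11 t₁₁

  t⁻₁ : t⁻ 1 ≋ φ⁻¹ ^ 23
  t⁻₁ = conclude₁ (S.trans (solve 8 (λ g q n1 n2 s0 s1 s4 s22 →
      n1 :* (g :* (g :^ 23 :* n1 :+ q)) := (g :^ 24 :* (q :^ 0 :* n2) :+
          (g :^ 6 :* (q :^ 2 :* s4) :+ (g :^ 3 :* (q :^ 2 :* s1) :+
          (g :^ 2 :* (q :^ 2 :* s0) :+ (g :^ 1 :* (q :^ 1 :* n1) :+ (g :^ 0 :* (q :^ 2 :* s22) :+ con false))))))
          :+ (g :^ 24 :* (n2 :+ n1 :* n1) :+ ((g :^ 6 :* q :^ 2) :* s4 :+
          ((g :^ 3 :* q :^ 2) :* s1 :+ ((g :^ 2 :* q :^ 2) :* s0 :+ ((g :^ 0 :* q :^ 2) :* s22))))))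
      S.refl g Q (t⁻ 1) (t⁻ 2) (t 0) (t 1) (t 4) (t 22))
    (⊞-𝟘 (recurrence⁻ 2) (⊞-𝟘 (⊠-𝟘 _ (x≈y⇒x+y≈0 (t⁻-double 1)))
        (⊞-𝟘 (⊠-𝟘 _ t₄) (⊞-𝟘 (⊠-𝟘 _ t₁) (⊞-𝟘 (⊠-𝟘 _ t₀) (⊠-𝟘 _ t₂₂)))))))

module ℓ₁₉ where
  open EtaHecke 17 (from-yes (coprime? 2 19)) (from-yes (coprime? 3 19)) (from-yes (coprime? 9 19))
      (U-D {8} (from-yes (prime? 19)))
  open Recurrence F₁₉ g-modular₁₉ (eval-swap F₁₉ refl g-modular₁₉)

  t₅ : t 5 ≋ 𝟘
  t₅ = inert⇒t₅ (from-yes (nonresidue? 19))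

  t₁₀ : t 10 ≋ 𝟘
  t₁₀ = t-double-𝟘 5 t₅

  t₂₀ : t 20 ≋ 𝟘
  t₂₀ = t-double-𝟘 10 t₁₀

  t₁₁ : t 11 ≋ 𝟘
  t₁₁ = order⇒⊠-cancel-𝟘 (order-^ order-g 3) (S.trans (solve 11 (λ g q s0 s1 s2 s3 s6 s8 s11 s12 s20 →
      g :^ 3 :* s11 := (g :^ 20 :* s0 :+ (g :^ 12 :* s8 :+ (g :^ 11 :* s3 :+
          (g :^ 8 :* s12 :+ (g :^ 6 :* s2 :+ (g :^ 3 :* s11 :+
          (g :^ 2 :* s6 :+ (g :^ 1 :* s1 :+ (g :^ 0 :* s20 :+ con false))))))))) :+
          (g :^ 20 :* s0 :+ (g :^ 12 :* s8 :+ (g :^ 11 :* s3 :+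
          (g :^ 8 :* s12 :+ (g :^ 6 :* s2 :+ (g :^ 2 :* s6 :+ (g :^ 1 :* s1 :+ (g :^ 0 :* s20)))))))))
      S.refl g Q (t 0) (t 1) (t 2) (t 3) (t 6) (t 8) (t 11) (t 12) (t 20))
    (⊞-𝟘 (recurrence⁺ 0) (⊞-𝟘 (⊠-𝟘 _ t₀) (⊞-𝟘 (⊠-𝟘 _ t₈) (⊞-𝟘 (⊠-𝟘 _ t₃)
        (⊞-𝟘 (⊠-𝟘 _ t₁₂) (⊞-𝟘 (⊠-𝟘 _ t₂) (⊞-𝟘 (⊠-𝟘 _ t₆) (⊞-𝟘 (⊠-𝟘 _ t₁) (⊠-𝟘 _ t₂₀))))))))))

  t₂₂ : t 22 ≋ 𝟘
  t₂₂ = t-double-𝟘 11 t₁₁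

  t₁₅ : t 15 ≋ g ^ 8 ⊠ t 7
  t₁₅ = order⇒⊠-cancelˡ (order-^ order-g 3) (x+y≈0⇒x≈y (S.trans (solve 11 (λ g q s4 s5 s6 s7 s10 s12 s15 s16 s24 →
      g :^ 3 :* s15 :+ g :^ 3 :* (g :^ 8 :* s7) := (g :^ 20 :* s4 :+
          (g :^ 12 :* s12 :+ (g :^ 11 :* s7 :+ (g :^ 8 :* s16 :+
          (g :^ 6 :* s6 :+ (g :^ 3 :* s15 :+ (g :^ 2 :* s10 :+
          (g :^ 1 :* s5 :+ (g :^ 0 :* s24 :+ con false))))))))) :+
          (g :^ 20 :* s4 :+ (g :^ 12 :* s12 :+ (g :^ 8 :* s16 :+
          (g :^ 6 :* s6 :+ (g :^ 2 :* s10 :+ (g :^ 1 :* s5 :+ (g :^ 0 :* s24))))))))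
      S.refl g Q (t 4) (t 5) (t 6) (t 7) (t 10) (t 12) (t 15) (t 16) (t 24))
    (⊞-𝟘 (recurrence⁺ 4) (⊞-𝟘 (⊠-𝟘 _ t₄) (⊞-𝟘 (⊠-𝟘 _ t₁₂) (⊞-𝟘 (⊠-𝟘 _ t₁₆)
        (⊞-𝟘 (⊠-𝟘 _ t₆) (⊞-𝟘 (⊠-𝟘 _ t₁₀) (⊞-𝟘 (⊠-𝟘 _ t₅) (⊠-𝟘 _ t₂₄))))))))))

  t₂₁ : t 21 ≋ g ^ 12 ⊠ t 9 ⊞ g ^ 8 ⊠ t 13 ⊞ g ^ 2 ⊠ t 7
  t₂₁ = x+y≈0⇒x≈y (S.trans (solve 11 (λ g q s1 s2 s3 s4 s7 s9 s12 s13 s21 →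
      s21 :+ (g :^ 12 :* s9 :+ g :^ 8 :* s13 :+ g :^ 2 :* s7) :=
          (g :^ 20 :* s1 :+ (g :^ 12 :* s9 :+ (g :^ 11 :* s4 :+
          (g :^ 8 :* s13 :+ (g :^ 6 :* s3 :+ (g :^ 3 :* s12 :+
          (g :^ 2 :* s7 :+ (g :^ 1 :* s2 :+ (g :^ 0 :* s21 :+ con false))))))))) :+
          (g :^ 20 :* s1 :+ (g :^ 11 :* s4 :+ (g :^ 6 :* s3 :+ (g :^ 3 :* s12 :+ (g :^ 1 :* s2))))))
      S.refl g Q (t 1) (t 2) (t 3) (t 4) (t 7) (t 9) (t 12) (t 13) (t 21))
    (⊞-𝟘 (recurrence⁺ 1) (⊞-𝟘 (⊠-𝟘 _ t₁) (⊞-𝟘 (⊠-𝟘 _ t₄) (⊞-𝟘 (⊠-𝟘 _ t₃) (⊞-𝟘 (⊠-𝟘 _ t₁₂) (⊠-𝟘 _ t₂)))))))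

  -- The recurrence at 10, with t 21 replaced by `t₂₁` and t 30 = (t 15)² by g¹⁶ (t 7)²; the two
  -- terms in t 13 cancel.
  t₇-t₉ : t 7 ⊞ g ^ 11 ⊠ (t 7 ⊠ t 7) ⊞ g ^ 10 ⊠ t 9 ⊞ g ^ 7 ⊠ (t 9 ⊠ t 9) ≋ 𝟘
  t₇-t₉ = order⇒⊠-cancel-𝟘 (order-^ order-g 5)
    (S.trans (solve 14 (λ g q s7 s9 s10 s11 s12 s13 s15 s16 s18 s21 s22 s30 →
      g :^ 5 :* (s7 :+ g :^ 11 :* (s7 :* s7) :+ g :^ 10 :* s9 :+ g :^ 7 :* (s9 :* s9)) :=
          (g :^ 20 :* s10 :+ (g :^ 12 :* s18 :+ (g :^ 11 :* s13 :+
          (g :^ 8 :* s22 :+ (g :^ 6 :* s12 :+ (g :^ 3 :* s21 :+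
          (g :^ 2 :* s16 :+ (g :^ 1 :* s11 :+ (g :^ 0 :* s30 :+ con false))))))))) :+
          (g :^ 3 :* (s21 :+ (g :^ 12 :* s9 :+ g :^ 8 :* s13 :+ g :^ 2 :* s7)) :+
          (con true :* (s30 :+ s15 :* s15) :+ ((s15 :+ g :^ 8 :* s7) :* (s15 :+ g :^ 8 :* s7) :+
          (g :^ 12 :* (s18 :+ s9 :* s9) :+ (g :^ 20 :* s10 :+
          (g :^ 8 :* s22 :+ (g :^ 6 :* s12 :+ (g :^ 2 :* s16 :+ (g :^ 1 :* s11))))))))))
      S.refl g Q (t 7) (t 9) (t 10) (t 11) (t 12) (t 13) (t 15) (t 16) (t 18) (t 21) (t 22) (t 30))
    (⊞-𝟘 (recurrence⁺ 10) (⊞-𝟘 (⊠-𝟘 _ (x≈y⇒x+y≈0 t₂₁)) (⊞-𝟘 (⊠-𝟘 _ (x≈y⇒x+y≈0 (t-double 15)))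
        (⊞-𝟘 (⊠-𝟘 _ (x≈y⇒x+y≈0 t₁₅)) (⊞-𝟘 (⊠-𝟘 _ (x≈y⇒x+y≈0 (t-double 9)))
        (⊞-𝟘 (⊠-𝟘 _ t₁₀) (⊞-𝟘 (⊠-𝟘 _ t₂₂) (⊞-𝟘 (⊠-𝟘 _ t₁₂) (⊞-𝟘 (⊠-𝟘 _ t₁₆) (⊠-𝟘 _ t₁₁)))))))))))

  -- e and g¹¹ t₇ solve the same equation z² + z = g²¹ t₉ + g¹⁸ t₉², so they differ by 0 or 1.
  private
    e : Series
    e = φ ^ 19 ⊠ t⁻ 1

    order-e : Order 0 e
    order-e = order-⊠ (order-^ order-φ 19) (order-t⁻ 0)

    g¹⁹t⁻ : g ^ 19 ⊠ t⁻ 1 ≋ Q ⊠ e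
    g¹⁹t⁻ = S.trans (S.*-congʳ (S.trans (^-congˡ 19 G≋Xφ) (^-distrib-* X φ 19))) (S.*-assoc Q (φ ^ 19) (t⁻ 1))

  -- The recurrence around -2, multiplied by g¹⁸ so that t⁻ 1 enters only through g¹⁹ t⁻ 1 = Q e.
  -- The goal is e = 1, but the terms in t 9 cannot yet be removed.
  e-quadratic : e ⊠ e ⊞ e ⊞ (g ^ 21 ⊠ t 9 ⊞ g ^ 18 ⊠ (t 9 ⊠ t 9)) ≋ 𝟘
  e-quadratic = order⇒⊠-cancel-𝟘 (order-^ (order-X^ 19) 2)
    (S.trans (solve 12 (λ g q n1 n2 s0 s1 s4 s6 s9 s10 s18 e →
      q :^ 2 :* (e :* e :+ e :+ (g :^ 21 :* s9 :+ g :^ 18 :* (s9 :* s9))) := g :^ 18 :*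
          (g :^ 20 :* (q :^ 0 :* n2) :+ (g :^ 12 :* (q :^ 2 :* s6) :+
          (g :^ 11 :* (q :^ 2 :* s1) :+ (g :^ 8 :* (q :^ 2 :* s10) :+
          (g :^ 6 :* (q :^ 2 :* s0) :+ (g :^ 3 :* (q :^ 2 :* s9) :+
          (g :^ 2 :* (q :^ 2 :* s4) :+ (g :^ 1 :* (q :^ 1 :* n1) :+
          (g :^ 0 :* (q :^ 2 :* s18) :+ con false))))))))) :+
          (g :^ 38 :* (n2 :+ n1 :* n1) :+ ((g :^ 19 :* n1 :+ q :* e) :* (g :^ 19 :* n1 :+ q :* e) :+
          (q :* (g :^ 19 :* n1 :+ q :* e) :+ ((g :^ 18 :* q :^ 2) :* (s18 :+ s9 :* s9) :+
          ((g :^ 18 :* g :^ 12 :* q :^ 2) :* s6 :+ ((g :^ 18 :* g :^ 11 :* q :^ 2) :* s1 :+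
          ((g :^ 18 :* g :^ 8 :* q :^ 2) :* s10 :+ ((g :^ 18 :* g :^ 6 :* q :^ 2) :* s0 :+
          ((g :^ 18 :* g :^ 2 :* q :^ 2) :* s4))))))))))
      S.refl g Q (t⁻ 1) (t⁻ 2) (t 0) (t 1) (t 4) (t 6) (t 9) (t 10) (t 18) e)
    (⊞-𝟘 (⊠-𝟘 _ (recurrence⁻ 2)) (⊞-𝟘 (⊠-𝟘 _ (x≈y⇒x+y≈0 (t⁻-double 1)))
        (⊞-𝟘 (⊠-𝟘 _ (x≈y⇒x+y≈0 g¹⁹t⁻)) (⊞-𝟘 (⊠-𝟘 _ (x≈y⇒x+y≈0 g¹⁹t⁻))
        (⊞-𝟘 (⊠-𝟘 _ (x≈y⇒x+y≈0 (t-double 9))) (⊞-𝟘 (⊠-𝟘 _ t₆)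
        (⊞-𝟘 (⊠-𝟘 _ t₁) (⊞-𝟘 (⊠-𝟘 _ t₁₀) (⊞-𝟘 (⊠-𝟘 _ t₀) (⊠-𝟘 _ t₄)))))))))))

  -- Since `e` has constant term 1 and g¹¹ t 7 has constant term 0, the difference must be 1.
  e-t₇ : e ⊞ g ^ 11 ⊠ t 7 ⊞ 𝟙 ≋ 𝟘
  e-t₇ = order⇒⊠-cancel-𝟘 (order-⊞ order-e (below-⊠ˡ (t 7) (below-weaken (ℕ.m≤m+n 1 10)
      (below (order-^ order-g 11)))))
    (S.trans (solve 4 (λ g s7 s9 e → (e :+ g :^ 11 :* s7) :* (e :+ g :^ 11 :* s7 :+ con true)
        := (e :* e :+ e :+ (g :^ 21 :* s9 :+ g :^ 18 :* (s9 :* s9))) :+ g :^ 11 :*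
            (s7 :+ g :^ 11 :* (s7 :* s7) :+ g :^ 10 :* s9 :+ g :^ 7 :* (s9 :* s9))) S.refl g (t 7) (t 9) e)
      (⊞-𝟘 e-quadratic (⊠-𝟘 _ t₇-t₉)))

  -- In the recurrence around -1 the terms g²⁰ t⁻ 1 and g¹² Q t 7 add up to g Q by `e-t₇`, although
  -- neither is known separately.
  t₁₉ : t 19 ≋ g
  t₁₉ = x+y≈0⇒x≈y (order⇒⊠-cancel-𝟘 (order-X^ 19) (
    S.trans (solve 12 (λ g q n1 s0 s1 s2 s5 s7 s10 s11 s19 e →
      q :* (s19 :+ g) := con true :* (g :^ 20 :* (q :^ 0 :* n1) :+
          (g :^ 12 :* (q :^ 1 :* s7) :+ (g :^ 11 :* (q :^ 1 :* s2) :+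
          (g :^ 8 :* (q :^ 1 :* s11) :+ (g :^ 6 :* (q :^ 1 :* s1) :+
          (g :^ 3 :* (q :^ 1 :* s10) :+ (g :^ 2 :* (q :^ 1 :* s5) :+
          (g :^ 1 :* (q :^ 1 :* s0) :+ (g :^ 0 :* (q :^ 1 :* s19) :+ con false))))))))) :+
          (g :* (g :^ 19 :* n1 :+ q :* e) :+ ((q :* g) :* (e :+ g :^ 11 :* s7 :+ con true) :+
          ((con true :* g :^ 11 :* q :^ 1) :* s2 :+ ((con true :* g :^ 8 :* q :^ 1) :* s11 :+
          ((con true :* g :^ 6 :* q :^ 1) :* s1 :+ ((con true :* g :^ 3 :* q :^ 1) :* s10 :+
          ((con true :* g :^ 2 :* q :^ 1) :* s5 :+ ((con true :* g :^ 1 :* q :^ 1) :* s0)))))))))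
      S.refl g Q (t⁻ 1) (t 0) (t 1) (t 2) (t 5) (t 7) (t 10) (t 11) (t 19) e)
    (⊞-𝟘 (⊠-𝟘 _ (recurrence⁻ 1)) (⊞-𝟘 (⊠-𝟘 _ (x≈y⇒x+y≈0 g¹⁹t⁻))
        (⊞-𝟘 (⊠-𝟘 _ e-t₇) (⊞-𝟘 (⊠-𝟘 _ t₂) (⊞-𝟘 (⊠-𝟘 _ t₁₁) (⊞-𝟘 (⊠-𝟘 _ t₁)
        (⊞-𝟘 (⊠-𝟘 _ t₁₀) (⊞-𝟘 (⊠-𝟘 _ t₅) (⊠-𝟘 _ t₀)))))))))))

  t₉-t₇ : g ⊠ t 9 ⊞ (g ^ 4 ⊞ g ^ 2 ⊠ t 7 ^ 2 ⊞ t 7 ^ 4) ≋ 𝟘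
  t₉-t₇ = S.trans (solve 12 (λ g q s7 s8 s9 s10 s11 s14 s16 s19 s20 s28 →
      g :* s9 :+ (g :^ 4 :+ g :^ 2 :* s7 :^ 2 :+ s7 :^ 4) :=
          (g :^ 20 :* s8 :+ (g :^ 12 :* s16 :+ (g :^ 11 :* s11 :+
          (g :^ 8 :* s20 :+ (g :^ 6 :* s10 :+ (g :^ 3 :* s19 :+
          (g :^ 2 :* s14 :+ (g :^ 1 :* s9 :+ (g :^ 0 :* s28 :+ con false))))))))) :+
          (g :^ 3 :* (s19 :+ g) :+ (g :^ 2 :* (s14 :+ s7 :* s7) :+
          (con true :* (s28 :+ s14 :* s14) :+ ((s14 :+ s7 :* s7) :* (s14 :+ s7 :* s7) :+
          (g :^ 20 :* s8 :+ (g :^ 12 :* s16 :+ (g :^ 11 :* s11 :+ (g :^ 8 :* s20 :+ (g :^ 6 :* s10))))))))))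
      S.refl g Q (t 7) (t 8) (t 9) (t 10) (t 11) (t 14) (t 16) (t 19) (t 20) (t 28))
    (⊞-𝟘 (recurrence⁺ 8) (⊞-𝟘 (⊠-𝟘 _ (x≈y⇒x+y≈0 t₁₉)) (⊞-𝟘 (⊠-𝟘 _ (x≈y⇒x+y≈0 (t-double 7)))
        (⊞-𝟘 (⊠-𝟘 _ (x≈y⇒x+y≈0 (t-double 14))) (⊞-𝟘 (⊠-𝟘 _ (x≈y⇒x+y≈0 (t-double 7)))
        (⊞-𝟘 (⊠-𝟘 _ t₈) (⊞-𝟘 (⊠-𝟘 _ t₁₆) (⊞-𝟘 (⊠-𝟘 _ t₁₁) (⊞-𝟘 (⊠-𝟘 _ t₂₀) (⊠-𝟘 _ t₁₀))))))))))

  -- Eliminating t 9 between `t₇-t₉` and `t₉-t₇` gives (1 + g⁵ (t 7)⁷) t 7 = 0, and the first factor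
  -- is a unit.
  t₇ : t 7 ≋ 𝟘
  t₇ = order⇒⊠-cancel-𝟘 (order-⊞ order-𝟙 (below-⊠ˡ (t 7 ^ 7)
      (below-weaken (ℕ.m≤m+n 1 4) (below (order-^ order-g 5)))))
    (S.trans (solve 3 (λ g s7 s9 → (con true :+ g :^ 5 :* s7 :^ 7) :* s7
        := (s7 :+ g :^ 11 :* (s7 :* s7) :+ g :^ 10 :* s9 :+ g :^ 7 :* (s9 :* s9)) :+
            (g :^ 9 :* (g :* s9 :+ (g :^ 4 :+ g :^ 2 :* s7 :^ 2 :+ s7 :^ 4)) :+
            (g :^ 5 :* (g :* s9 :+ (g :^ 4 :+ g :^ 2 :* s7 :^ 2 :+ s7 :^ 4))) :*
            (g :* s9 :+ (g :^ 4 :+ g :^ 2 :* s7 :^ 2 :+ s7 :^ 4)))) S.refl g (t 7) (t 9))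
      (⊞-𝟘 t₇-t₉ (⊞-𝟘 (⊠-𝟘 _ t₉-t₇) (⊠-𝟘 _ t₉-t₇))))

  t⁻₁ : t⁻ 1 ≋ φ⁻¹ ^ 19
  t⁻₁ = t⁻-determined 19 (x+y≈0⇒x≈y
    (S.trans (solve 5 (λ g q n1 s7 e → g :^ 19 :* n1 :+ q := (g :^ 19 :* n1 :+ q :* e) :+
        (q :* (e :+ g :^ 11 :* s7 :+ con true) :+ (q :* g :^ 11) :* s7)) S.refl g Q (t⁻ 1) (t 7) e)
      (⊞-𝟘 (x≈y⇒x+y≈0 g¹⁹t⁻) (⊞-𝟘 (⊠-𝟘 _ e-t₇) (⊠-𝟘 _ t₇)))))

module ℓ₃ where
  open Hecke D-uniformiser 1 (from-yes (coprime? 2 3))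
  open Recurrence F₃ D-modular₃′ (eval-swap F₃ refl D-modular₃′)
  open Conclude D-uniformiser 1 (from-yes (coprime? 2 3))

  t₁ : t 1 ≋ 𝟘
  t₁ = x≈y⇒x+y≈0 (S.trans (U-cong 3 (S.*-identityʳ D)) (S.trans (U-D {0} (from-yes (prime? 3)))
      (S.sym (S.*-identityʳ _))))

  t₂ : t 2 ≋ 𝟘
  t₂ = t-double-𝟘 1 t₁

  t⁻₁ : t⁻ 1 ≋ φ⁻¹ ^ 3
  t⁻₁ = conclude₁ (S.trans (solve 5 (λ g q n1 n2 s2 →
      n1 :* (g :* (g :^ 3 :* n1 :+ q)) := (g :^ 4 :* (q :^ 0 :* n2) :+
          (g :^ 1 :* (q :^ 1 :* n1) :+ (g :^ 0 :* (q :^ 2 :* s2) :+ con false))) :+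
          (g :^ 4 :* (n2 :+ n1 :* n1) :+ ((g :^ 0 :* q :^ 2) :* s2)))
      S.refl D Q (t⁻ 1) (t⁻ 2) (t 2))
    (⊞-𝟘 (recurrence⁻ 2) (⊞-𝟘 (⊠-𝟘 _ (x≈y⇒x+y≈0 (t⁻-double 1))) (⊠-𝟘 _ t₂))))

  t⁻₃ : t⁻ 3 ≋ φ⁻¹ ^ 9
  t⁻₃ = conclude₃ t⁻₁ (S.trans (solve 5 (λ g q n3 n4 s0 →
      g :* (g :^ 3 :* n4 :+ q :* n3) := (g :^ 4 :* (q :^ 0 :* n4) :+
          (g :^ 1 :* (q :^ 1 :* n3) :+ (g :^ 0 :* (q :^ 4 :* s0) :+ con false))) :+ ((g :^ 0 :* q :^ 4) :* s0))
      S.refl D Q (t⁻ 3) (t⁻ 4) (t 0))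
    (⊞-𝟘 (recurrence⁻ 4) (⊠-𝟘 _ t₀)))

-- Densities

bit : Bool → ℕ
bit false = 0
bit true  = 1

count : Series → ℕ → ℕ
count f x = Σ≤ x (λ n → bit (f n))

Σ≤-cong : ∀ {f g : ℕ → ℕ} → (∀ n → f n ≡ g n) → ∀ x → Σ≤ x f ≡ Σ≤ x g
Σ≤-cong p zero    = p 0
Σ≤-cong p (suc x) = cong₂ _+_ (Σ≤-cong p x) (p (suc x))

Σ≤-head : ∀ x (f : ℕ → ℕ) → Σ≤ (suc x) f ≡ f 0 + Σ≤ x (λ n → f (suc n))
Σ≤-head zero    f = refl
Σ≤-head (suc x) f = trans (cong (_+ f (suc (suc x))) (Σ≤-head x f)) (ℕ.+-assoc (f 0) _ _)

count-cong : ∀ {f g} → f ≋ g → ∀ x → count f x ≡ count g x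
count-cong p = Σ≤-cong (λ n → cong bit (at p n))

count-suc-≤ : ∀ f x → count f x ≤ count f (suc x)
count-suc-≤ f x = ℕ.m≤m+n _ _

count-+-≤ : ∀ f k x → count f x ≤ count f (k + x)
count-+-≤ f zero    x = ℕ.≤-refl
count-+-≤ f (suc k) x = ℕ.≤-trans (count-+-≤ f k x) (count-suc-≤ f (k + x))

count-mono : ∀ f {x y} → x ≤ y → count f x ≤ count f y
count-mono f {x} {y} x≤y = subst (λ z → count f x ≤ count f z) (ℕ.m∸n+n≡m x≤y) (count-+-≤ f (y ∸ x) x)

count-⊞ : ∀ f g x → count (f ⊞ g) x ≤ count f x + count g x
count-⊞ f g = go
  where
  bit-xor : ∀ a b → bit (a xor b) ≤ bit a + bit b
  bit-xor false b     = ℕ.≤-refl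
  bit-xor true  false = ℕ.≤-refl
  bit-xor true  true  = z≤n
  at-n : ∀ n → bit ((f ⊞ g) n) ≤ bit (f n) + bit (g n)
  at-n n = ℕ.≤-trans (ℕ.≤-reflexive (cong bit (⊞-at f g n))) (bit-xor (f n) (g n))
  go : ∀ x → count (f ⊞ g) x ≤ count f x + count g x
  go zero    = at-n 0
  go (suc x) = ℕ.≤-trans (ℕ.+-mono-≤ (go x) (at-n (suc x))) (ℕ.≤-reflexive
    (N.solve 4 (λ a b c d → (a N.:+ b) N.:+ (c N.:+ d) N.:= (a N.:+ c) N.:+ (b N.:+ d)) refl
      (count f x) (count g x) (bit (f (suc x))) (bit (g (suc x)))))

count-U : ∀ l f x → count (U (suc l) f) x ≤ count f (x * suc l)
count-U l f zero    = ℕ.≤-refl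
count-U l f (suc x) = ℕ.+-monoˡ-≤ (bit (f (suc x * suc l))) (ℕ.≤-trans (count-U l f x) (count-+-≤ f l (x * suc l)))

count-X^ : ∀ c f x → count ((X ^ c) ⊠ f) x ≤ count f x
count-X^ zero    f x = ℕ.≤-reflexive (count-cong (S.*-identityˡ f) x)
count-X^ (suc c) f x = ℕ.≤-trans (ℕ.≤-reflexive (count-cong (S.*-assoc X (X ^ c) f) x))
    (ℕ.≤-trans (count-X _ x) (count-X^ c f x))
  where
  shifted : ∀ f x → count (X ⊠ f) (suc x) ≡ count f x
  shifted f x = trans (Σ≤-head x _) (Σ≤-cong (λ n → cong bit (X⊠-suc f n)) x)
  count-X : ∀ f x → count (X ⊠ f) x ≤ count f x
  count-X f zero    = z≤n
  count-X f (suc x) = ℕ.≤-trans (ℕ.≤-reflexive (shifted f x)) (count-suc-≤ f x)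

count-spread : ∀ l c f x → count (spread l c f) x ≤ count f x
count-spread l zero    f zero    = ℕ.≤-refl
count-spread l zero    f (suc x) = ℕ.≤-trans (ℕ.≤-reflexive (Σ≤-head x _))
  (ℕ.≤-trans (ℕ.+-monoʳ-≤ (bit (f 0)) (count-spread l l (tl f) x)) (ℕ.≤-reflexive (sym (Σ≤-head x _))))
count-spread l (suc c) f zero    = z≤n
count-spread l (suc c) f (suc x) = ℕ.≤-trans (ℕ.≤-reflexive (Σ≤-head x _))
    (ℕ.≤-trans (count-spread l c f x) (count-suc-≤ f x))

oddCount-count : ∀ t x → oddCount t x ≡ count (P ^ t) x
oddCount-count t x = trans (Σ≤-cong (λ n → mod-2 (pₜ t n)) x) (count-cong (odd-pₜ t) x)
  where
  mod-2 : ∀ n → n % 2 ≡ bit (odd n)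
  mod-2 zero          = refl
  mod-2 (suc zero)    = refl
  mod-2 (suc (suc n)) = trans (mod-2 n) (cong bit (sym (Bool.not-involutive (odd n))))

-- The congruence p_t(n) ≡ p_r(ℓn − c) + p_r(n/ℓ) modulo 2, with terms at non-integers and negative arguments omitted.
record Descends (t r l : ℕ) : Set where
  constructor descends
  field
    c          : ℕ
    congruence : P ^ t ≋ U l ((X ^ c) ⊠ P ^ r) ⊞ V l (P ^ r)

descends-count : ∀ {t r l} → Descends t r (suc l) → ∀ x → oddCount t x ≤ 2 * oddCount r (x * suc l)
descends-count {t} {r} {l} (descends c h) x = begin
  oddCount t x                                                       ≡⟨ oddCount-count t x ⟩
  count (P ^ t) x                                                    ≡⟨ count-cong h x ⟩
  count (U (suc l) ((X ^ c) ⊠ P ^ r) ⊞ V (suc l) (P ^ r)) x          ≤⟨ count-⊞ _ _ x ⟩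
  count (U (suc l) ((X ^ c) ⊠ P ^ r)) x + count (V (suc l) (P ^ r)) x
    ≤⟨ ℕ.+-mono-≤ (ℕ.≤-trans (count-U l ((X ^ c) ⊠ P ^ r) x) (count-X^ c (P ^ r) (x * suc l)))
        (ℕ.≤-trans (count-spread l 0 (P ^ r) x) (count-mono (P ^ r) (ℕ.m≤m*n x (suc l)))) ⟩
  count (P ^ r) y + count (P ^ r) y                                  ≡⟨ cong (λ z → z + z) (oddCount-count r y) ⟨
  oddCount r y + oddCount r y                                        ≡⟨ cong (_+_ (oddCount r y)) (ℕ.+-identityʳ _)
      ⟨
  2 * oddCount r y                                                   ∎
  where
  open ℕ.≤-Reasoning
  y = x * suc l

private
  -- Positive lower density expressed without rational numbers, up to the value of the constant.
  Linear : ℕ → Set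
  Linear t = ∃ λ M → ∃ λ N → ∀ x → N ≤ x → x ≤ M * oddCount t x

  positive⇒linear : ∀ t → PositiveDensity t → Linear t
  positive⇒linear t (mkℚᵘ (ℤ.+ zero) d , *<* (+<+ ()) , _)
  positive⇒linear t (mkℚᵘ -[1+ a ] d , *<* () , _)
  -- ε = (a + 1)/(d + 1), and a + 1 is bounded below by 1. The index of `ratio` is one less than x,
  -- hence `suc N`.
  positive⇒linear t (mkℚᵘ (ℤ.+ suc a) d , _ , N , h) = suc d , suc N , bound
    where
    bound : ∀ x → suc N ≤ x → x ≤ suc d * oddCount t x
    bound (suc x) (s≤s N≤x) with h x N≤x
    ... | *≤* p = ℕ.≤-trans (ℕ.m≤n*m (suc x) (suc a)) (ℕ.≤-trans
      (ℤ.drop‿+≤+ (subst₂ ℤ._≤_ (sym (ℤ.pos-* (suc a) (suc x))) (sym (ℤ.pos-* (oddCount t (suc x)) (suc d))) p))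
      (ℕ.≤-reflexive (ℕ.*-comm (oddCount t (suc x)) (suc d))))

  linear⇒positive : ∀ t → Linear t → PositiveDensity t
  linear⇒positive t (M , N , h) = mkℚᵘ (ℤ.+ 1) M , *<* (+<+ (s≤s z≤n)) , N , λ x N≤x →
    *≤* (subst₂ ℤ._≤_ (ℤ.pos-* 1 (suc x)) (ℤ.pos-* (oddCount t (suc x)) (suc M))
      (+≤+ (ℕ.≤-trans (ℕ.≤-reflexive (ℕ.*-identityˡ (suc x))) (ℕ.≤-trans (h (suc x) (ℕ.m≤n⇒m≤1+n N≤x))
        (ℕ.≤-trans (ℕ.*-monoˡ-≤ (oddCount t (suc x)) (ℕ.n≤1+n M))
            (ℕ.≤-reflexive (ℕ.*-comm (suc M) (oddCount t (suc x)))))))))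

  -- Let y = ⌊x/ℓ⌋. The threshold `suc N * ℓ` ensures y ≥ 1, so x ≤ 2ℓy, and y ≤ M · oddCount t y ≤
  -- 2M · oddCount r x; this is where 4ℓM comes from.
  linear-descends : ∀ {t r l} → Descends t r (suc l) → Linear t → Linear r
  linear-descends {t} {r} {l} d (M , N , h) = 4 * ℓ * M , suc N * ℓ , bound
    where
    ℓ = suc l
    bound : ∀ x → suc N * ℓ ≤ x → x ≤ 4 * ℓ * M * oddCount r x
    bound x big = begin
      x                                            ≡⟨ m≡m%n+[m/n]*n x ℓ ⟩
      x % ℓ + y * ℓ                                ≤⟨ ℕ.+-monoˡ-≤ (y * ℓ)
          (ℕ.≤-trans (ℕ.<⇒≤ (m%n<n x ℓ)) (ℕ.≤-trans (ℕ.≤-reflexive (sym (ℕ.*-identityˡ ℓ)))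
          (ℕ.*-monoˡ-≤ ℓ (ℕ.≤-trans (s≤s z≤n) N<y)))) ⟩
      y * ℓ + y * ℓ                                ≤⟨ ℕ.+-mono-≤ (ℕ.*-monoˡ-≤ ℓ y≤) (ℕ.*-monoˡ-≤ ℓ y≤) ⟩
      M * (2 * C) * ℓ + M * (2 * C) * ℓ
        ≡⟨ N.solve 3 (λ M C l → M N.:* (N.con 2 N.:* C) N.:* l N.:+ M N.:* (N.con 2 N.:* C) N.:* l N.:= N.con 4
            N.:* l N.:* M N.:* C) refl M C ℓ ⟩
      4 * ℓ * M * C                                ∎
      where
      open ℕ.≤-Reasoning
      y = x / ℓ
      C = oddCount r x
      N<y : suc N ≤ y
      N<y = ℕ.≤-trans (ℕ.≤-reflexive (sym (m*n/n≡m (suc N) ℓ))) (/-mono-≤ big (ℕ.≤-refl {ℓ}))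
      y≤ : y ≤ M * (2 * C)
      y≤ = ℕ.≤-trans (h y (ℕ.≤-trans (ℕ.n≤1+n N) N<y)) (ℕ.*-monoʳ-≤ M (ℕ.≤-trans (descends-count d y)
        (ℕ.*-monoʳ-≤ 2 (subst₂ _≤_ (sym (oddCount-count r (y * ℓ))) (sym (oddCount-count r x))
            (count-mono (P ^ r) (m/n*n≤m x ℓ))))))

descends-positive : ∀ {t r l} → Descends t r (suc l) → PositiveDensity t → PositiveDensity r
descends-positive {t} {r} d pos = linear⇒positive r (linear-descends d (positive⇒linear t pos))

-- From T to congruences for P

V-injective : ∀ w {a b} → V (suc w) a ≋ V (suc w) b → a ≋ b
V-injective w {a} {b} h = pointwise λ n → trans (sym (V-at w a n)) (trans (at h (n * suc w)) (V-at w b n))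

-- All series here are series in q^(w + 1), and `U` commutes with this substitution because w + 1 is
-- prime to ℓ, so the substitution can be stripped. It is applied with w + 1 = 24 for g and w + 1 =
-- 8 for D.
contract : ∀ w l {a} n r c → Coprime (suc w) (suc l) →
  U (suc l) ((X ^ (suc w * c)) ⊠ V (suc w) a ^ r) ⊞ V (suc l) (V (suc w) a) ^ r ≋ V (suc w) a ^ n →
  a ^ n ≋ U (suc l) ((X ^ c) ⊠ a ^ r) ⊞ V (suc l) (a ^ r)
contract w l {a} n r c w⊥ℓ h = V-injective w (begin
  W (a ^ n)                                                     ≈⟨ V-^ w a n ⟩
  W a ^ n                                                       ≈⟨ h ⟨
  U ℓ ((X ^ (suc w * c)) ⊠ W a ^ r) ⊞ V ℓ (W a) ^ r             ≈⟨ S.+-cong (U-cong ℓ (S.*-congˡ (V-^ w a r)))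
      (V-^ l (W a) r) ⟨
  U ℓ ((X ^ (suc w * c)) ⊠ W (a ^ r)) ⊞ V ℓ (W a ^ r)           ≈⟨ S.+-cong (U-cong ℓ (V-X^⊠ w c (a ^ r)))
      (V-cong ℓ (V-^ w a r)) ⟨
  U ℓ (W ((X ^ c) ⊠ a ^ r)) ⊞ V ℓ (W (a ^ r))                   ≈⟨ S.+-cong (U-V-coprime ℓ w _ w⊥ℓ)
      (V-comm l w (a ^ r)) ⟩
  W (U ℓ ((X ^ c) ⊠ a ^ r)) ⊞ W (V ℓ (a ^ r))                   ≈⟨ V-⊞ (suc w) _ _ ⟨
  W (U ℓ ((X ^ c) ⊠ a ^ r) ⊞ V ℓ (a ^ r))                       ∎)
  where
  open ≋-Reasoning
  ℓ = suc l
  W = V (suc w)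

-- c = r(ℓ² − 1)/24
descent-5-1 : Descends 5 1 5
descent-5-1 = descends 1 (contract 23 4 5 1 1 (from-yes (coprime? 24 5)) ℓ₅.t⁻₁)

descent-7-1 : Descends 7 1 7
descent-7-1 = descends 2 (contract 23 6 7 1 2 (from-yes (coprime? 24 7)) ℓ₇.t⁻₁)

descent-11-1 : Descends 11 1 11
descent-11-1 = descends 5 (contract 23 10 11 1 5 (from-yes (coprime? 24 11)) ℓ₁₁.t⁻₁)

descent-13-1 : Descends 13 1 13
descent-13-1 = descends 7 (contract 23 12 13 1 7 (from-yes (coprime? 24 13)) ℓ₁₃.t⁻₁)

descent-17-1 : Descends 17 1 17
descent-17-1 = descends 12 (contract 23 16 17 1 12 (from-yes (coprime? 24 17)) ℓ₁₇.t⁻₁)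

descent-19-1 : Descends 19 1 19
descent-19-1 = descends 15 (contract 23 18 19 1 15 (from-yes (coprime? 24 19)) ℓ₁₉.t⁻₁)

descent-23-1 : Descends 23 1 23
descent-23-1 = descends 22 (contract 23 22 23 1 22 (from-yes (coprime? 24 23)) ℓ₂₃.t⁻₁)

descent-25-5 : Descends 25 5 5
descent-25-5 = descends 5 (contract 23 4 25 5 5 (from-yes (coprime? 24 5)) ℓ₅.t⁻₅)

descent-15-3 : Descends 15 3 5
descent-15-3 = descends 3 (contract 23 4 15 3 3 (from-yes (coprime? 24 5)) ℓ₅.t⁻₃)

descent-21-3 : Descends 21 3 7
descent-21-3 = descends 6 (contract 23 6 21 3 6 (from-yes (coprime? 24 7)) ℓ₇.t⁻₃)

private
  -- The unit part of D is ψ(q⁸), with inverse P(q⁸)³, so the identities for powers of D⁻¹ are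
  -- identities for powers of P³.
  cubes : ∀ n r c → (P ^ 3) ^ n ≋ U 3 ((X ^ c) ⊠ (P ^ 3) ^ r) ⊞ V 3 ((P ^ 3) ^ r) → Descends (3 * n) (3 * r) 3
  cubes n r c h = descends c (begin
    P ^ (3 * n)                                                 ≈⟨ ^-assocʳ P 3 n ⟨
    (P ^ 3) ^ n                                                 ≈⟨ h ⟩
    U 3 ((X ^ c) ⊠ (P ^ 3) ^ r) ⊞ V 3 ((P ^ 3) ^ r)             ≈⟨ S.+-cong (U-cong 3 (S.*-congˡ (^-assocʳ P 3 r)))
        (V-cong 3 (^-assocʳ P 3 r)) ⟩
    U 3 ((X ^ c) ⊠ P ^ (3 * r)) ⊞ V 3 (P ^ (3 * r))             ∎)
    where open ≋-Reasoning

descent-9-3 : Descends 9 3 3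
descent-9-3 = cubes 3 1 1 (contract 7 2 3 1 1 (from-yes (coprime? 8 3)) ℓ₃.t⁻₁)

descent-27-9 : Descends 27 9 3
descent-27-9 = cubes 9 3 3 (contract 7 2 9 3 3 (from-yes (coprime? 8 3)) ℓ₃.t⁻₃)

theorem1p2 : ∀ (t r : ℕ) → (t , r) ∈ implicationPairs →
    DensityExists t → DensityExists r →
    PositiveDensity t → PositiveDensity r
theorem1p2 t r pair _ _ = implication pair
  where
  implication : ∀ {t r} → (t , r) ∈ implicationPairs → PositiveDensity t → PositiveDensity r
  implication (here refl) = descends-positive descent-5-1
  implication (there (here refl)) = descends-positive descent-7-1
  implication (there (there (here refl))) = descends-positive descent-11-1
  implication (there (there (there (here refl)))) = descends-positive descent-13-1
  implication (there (there (there (there (here refl))))) = descends-positive descent-17-1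
  implication (there (there (there (there (there (here refl)))))) = descends-positive descent-19-1
  implication (there (there (there (there (there (there (here refl))))))) = descends-positive descent-23-1
  -- The chain 25, 5, 1.
  implication (there (there (there (there (there (there (there (here refl)))))))) δ = descends-positive descent-5-1
      (descends-positive descent-25-5 δ)
  implication (there (there (there (there (there (there (there (there (here refl))))))))) = descends-positive
      descent-27-9
  implication (there (there (there (there (there (there (there (there (there (here refl)))))))))) =
      descends-positive descent-9-3
  implication (there (there (there (there (there (there (there (there (there (there (here refl))))))))))) =
      descends-positive descent-25-5
  implication (there (there (there (there (there (there (there (there (there (there (there (here refl)))))))))))) =
      descends-positive descent-15-3
  implication (there (there (there (there (there (there (there
      (there (there (there (there (there (here refl))))))))))))) = descends-positive descent-21-3
  -- The chain 27, 9, 3.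
  implication (there (there (there (there (there (there (there
      (there (there (there (there (there (there (here refl)))))))))))))) δ = descends-positive descent-9-3
      (descends-positive descent-27-9 δ)
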